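{- Let $k$ be an algebraically closed field and let $\Lambda$ and $\Gamma$ be two finite dimensional basic indecomposable hereditary $k$-algebras. If $\rho:\mathsf{s\tau\text{ - }tilt}(\Lambda)\to \mathsf{s\tau\text{ - }tilt}(\Gamma)$ is a poset isomorphism, then the restriction of $\rho$ to $\mathsf{tilt}(\Lambda)\subset \mathsf{s\tau\text{ - }tilt}(\Lambda)$ has image $\mathsf{tilt}(\Gamma)$ and induces a poset isomorphism $\rho|_{\mathsf{tilt}(\Lambda)}:\mathsf{tilt}(\Lambda)\simeq \mathsf{tilt}(\Gamma)$.
   Context: Let $\Lambda$ be a finite dimensional algebra over an algebraically closed field $k$, basic and indecomposable (as an algebra). Modules are finitely generated right modules, $\tau$ is the Auslander-Reiten translation of $\operatorname{mod}\Lambda$, and $|M|$ is the number of pairwise non-isomorphic indecomposable direct summands of $M$. A module is basic if its indecomposable direct summands are pairwise non-isomorphic; $\mathsf{add}\,M$ is the class of direct summands of finite direct sums of copies of $M$. Tilting modules: a $\Lambda$-module $T$ is tilting if $\mathrm{pd}\,T\le 1$, $\operatorname{Ext}^1_\Lambda(T,T)=0$ and $|T|=|\Lambda|$. $\mathsf{tilt}(\Lambda)$ is the set of isomorphism classes of basic tilting modules, partially ordered by $T_1\le T_2$ iff $T_1^{\perp_1}\subset T_2^{\perp_1}$, where $M^{\perp_1}=\{X\in\operatorname{mod}\Lambda\mid \operatorname{Ext}^1_\Lambda(M,X)=0\}$ (equivalently, $T_2\ge T_1$ iff $\operatorname{Ext}^1_\Lambda(T_2,T_1)=0$). Support $\tau$-tilting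 modules: a pair $(M,P)$ of a $\Lambda$-module $M$ and a projective $\Lambda$-module $P$ is a support $\tau$-tilting pair if $\operatorname{Hom}_\Lambda(M,\tau M)=0$, $\operatorname{Hom}_\Lambda(P,M)=0$ and $|M|+|P|=|\Lambda|$; then $M$ is called a support $\tau$-tilting module. For basic $M$ the basic projective $P$ is unique up to isomorphism. $\mathsf{s\tau\text{ - }tilt}(\Lambda)$ is the set of isomorphism classes of basic support $\tau$-tilting modules, partially ordered by: for support $\tau$-tilting pairs $(M,P)$, $(M',P')$ with $M,M',P,P'$ basic, $M\le M'$ iff $\operatorname{Hom}_\Lambda(M,\tau M')=0$ and $\mathsf{add}\,P'\subset \mathsf{add}\,P$. When $\Lambda$ is hereditary, $\Lambda\cong kQ$ for a finite connected acyclic quiver $Q$, and $\mathsf{s\tau\text{ - }tilt}(\Lambda)$ coincides with the set of isomorphism classes of basic support tilting modules, i.e. basic modules $M$ that are tilting as modules over $kQ(M)$, where $Q(M)$ is the full subquiver of $Q$ on the support of $M$; the order becomes $M\ge M'$ iff $\operatorname{Ext}^1_\Lambda(M,M')=0$ and $Q(M')_0\subset Q(M)_0$. Then $\mathsf{tilt}(\Lambda)$ is the subposet of $\mathsf{s\tau\text{ - }tilt}(\Lambda)$ of those $M$ with $Q(M)=Q$. -}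

module Defs where

open import Algebra.Bundles using (AbelianGroup; CommutativeMonoid; CommutativeRing; Ring)
open import Algebra.Module.Bundles using (LeftModule; RightModule)
import Algebra.Construct.DirectProduct as RingProduct
import Algebra.Module.Construct.DirectProduct as ModuleProduct
import Algebra.Module.Construct.TensorUnit as Regular
import Algebra.Module.Construct.Zero as ZeroModule
open import Algebra.Module.Morphism.Structures
  using (module LeftModuleMorphisms; module RightModuleMorphisms)
open import Algebra.Morphism.Structures
  using (module GroupMorphisms; module RingMorphisms)
import Algebra.Properties.AbelianGroup as AbelianGroupProperties
import Algebra.Properties.CommutativeSemigroup as CommutativeSemigroupProperties
import Algebra.Properties.Monoid.Sum as MonoidSum
import Algebra.Properties.Ring as RingProperties
import Algebra.Properties.Semiring.Exp as SemiringExp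
open import Data.Fin.Base using (Fin; toℕ)
open import Data.Nat.Base as ℕ using (ℕ; zero; suc)
open import Data.Product.Base using (Σ; _×_; _,_; proj₁; proj₂; ∃; ∃₂)
open import Data.Sum.Base using (_⊎_)
open import Level using (Level) renaming (suc to lsuc)
open import Relation.Binary.PropositionalEquality.Core using (_≢_)
open import Relation.Nullary.Negation.Core using (¬_)
import Relation.Binary.Reasoning.Setoid as SetoidReasoning

private
  variable
    ℓ : Level

-- Stating the field axiom as an alternative makes equality with 0# decidable.
record Field (ℓ : Level) : Set (lsuc ℓ) where
  field
    commutativeRing : CommutativeRing ℓ ℓ

  open CommutativeRing commutativeRing public

  field
    1≉0                : ¬ (1# ≈ 0#)
    zero-or-invertible : ∀ x → (x ≈ 0#) ⊎ (∃ λ y → x * y ≈ 1#)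

AlgebraicallyClosed : Field ℓ → Set ℓ
AlgebraicallyClosed k = ∀ n (a : Fin (suc n) → Carrier) →
  ∃ λ x → x ^ suc n + sum (λ i → a i * x ^ toℕ i) ≈ 0#
  where
  open Field k
  open MonoidSum +-monoid using (sum)
  open SemiringExp semiring using (_^_)

module _ {A B : AbelianGroup ℓ ℓ} where
  private
    module A = AbelianGroup A
    module B = AbelianGroup B
  open GroupMorphisms A.rawGroup B.rawGroup
  open AbelianGroupProperties B using (identityˡ-unique; inverseˡ-unique)

  additive⇒isGroupHomomorphism :
    (f : A.Carrier → B.Carrier) →
    (∀ {x y} → x A.≈ y → f x B.≈ f y) →
    (∀ x y → f (x A.∙ y) B.≈ f x B.∙ f y) →
    IsGroupHomomorphism f
  additive⇒isGroupHomomorphism f f-cong f-+ = record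
    { isMonoidHomomorphism = record
      { isMagmaHomomorphism = record
        { isRelHomomorphism = record { cong = f-cong }
        ; homo              = f-+
        }
      ; ε-homo = f-0
      }
    ; ⁻¹-homo = λ x → inverseˡ-unique _ _
        (B.trans (B.sym (f-+ _ _)) (B.trans (f-cong (A.inverseˡ x)) f-0))
    }
    where
    f-0 : f A.ε B.≈ B.ε
    f-0 = identityˡ-unique _ _
      (B.trans (B.sym (f-+ _ _)) (f-cong (A.identityˡ A.ε)))

module _ {R : Ring ℓ ℓ} where

  record Hom (M N : RightModule R ℓ ℓ) : Set ℓ where
    private
      module M = RightModule M
      module N = RightModule N
    open RightModuleMorphisms M.rawRightModule N.rawRightModule
    field
      fun                       : M.Carrierᴹ → N.Carrierᴹ
      isRightModuleHomomorphism : IsRightModuleHomomorphism fun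
    open IsRightModuleHomomorphism isRightModuleHomomorphism public

  record Homˡ (M N : LeftModule R ℓ ℓ) : Set ℓ where
    private
      module M = LeftModule M
      module N = LeftModule N
    open LeftModuleMorphisms M.rawLeftModule N.rawLeftModule
    field
      fun                      : M.Carrierᴹ → N.Carrierᴹ
      isLeftModuleHomomorphism : IsLeftModuleHomomorphism fun
    open IsLeftModuleHomomorphism isLeftModuleHomomorphism public

  module _ {M N : RightModule R ℓ ℓ} where
    private
      module R = Ring R
      module M = RightModule M
      module N = RightModule N

    mkHom : (f : M.Carrierᴹ → N.Carrierᴹ) →
            (∀ {x y} → x M.≈ᴹ y → f x N.≈ᴹ f y) →
            (∀ x y → f (x M.+ᴹ y) N.≈ᴹ f x N.+ᴹ f y) →
            (∀ r x → f (x M.*ᵣ r) N.≈ᴹ f x N.*ᵣ r) →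
            Hom M N
    mkHom f f-cong f-+ f-* = record
      { fun = f
      ; isRightModuleHomomorphism = record
        { +ᴹ-isGroupHomomorphism = additive⇒isGroupHomomorphism
            {A = M.+ᴹ-abelianGroup} {B = N.+ᴹ-abelianGroup} f f-cong f-+
        ; *ᵣ-homo = f-*
        }
      }

    IsZeroHom Injective Surjective : Hom M N → Set ℓ
    IsZeroHom f  = ∀ x → Hom.fun f x N.≈ᴹ N.0ᴹ
    Injective f  = ∀ {x y} → Hom.fun f x N.≈ᴹ Hom.fun f y → x M.≈ᴹ y
    Surjective f = ∀ y → ∃ λ x → Hom.fun f x N.≈ᴹ y

    infix 4 _≈ʰ_
    _≈ʰ_ : Hom M N → Hom M N → Set ℓ
    f ≈ʰ g = ∀ x → Hom.fun f x N.≈ᴹ Hom.fun g x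

  module _ {M N : LeftModule R ℓ ℓ} where
    private
      module R = Ring R
      module M = LeftModule M
      module N = LeftModule N

    mkHomˡ : (f : M.Carrierᴹ → N.Carrierᴹ) →
             (∀ {x y} → x M.≈ᴹ y → f x N.≈ᴹ f y) →
             (∀ x y → f (x M.+ᴹ y) N.≈ᴹ f x N.+ᴹ f y) →
             (∀ r x → f (r M.*ₗ x) N.≈ᴹ r N.*ₗ f x) →
             Homˡ M N
    mkHomˡ f f-cong f-+ f-* = record
      { fun = f
      ; isLeftModuleHomomorphism = record
        { +ᴹ-isGroupHomomorphism = additive⇒isGroupHomomorphism
            {A = M.+ᴹ-abelianGroup} {B = N.+ᴹ-abelianGroup} f f-cong f-+
        ; *ₗ-homo = f-*
        }
      }

  infixr 9 _∘ʰ_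
  _∘ʰ_ : {L M N : RightModule R ℓ ℓ} → Hom M N → Hom L M → Hom L N
  _∘ʰ_ {N = N} g f = mkHom (λ x → g.fun (f.fun x))
    (λ e → g.⟦⟧-cong (f.⟦⟧-cong e))
    (λ x y → N.≈ᴹ-trans (g.⟦⟧-cong (f.+ᴹ-homo x y)) (g.+ᴹ-homo _ _))
    (λ r x → N.≈ᴹ-trans (g.⟦⟧-cong (f.*ᵣ-homo r x)) (g.*ᵣ-homo r _))
    where
    module f = Hom f
    module g = Hom g
    module N = RightModule N

  IsZero : RightModule R ℓ ℓ → Set ℓ
  IsZero M = ∀ x → x ≈ᴹ 0ᴹ
    where open RightModule M

  infix 4 _≅_
  _≅_ : (M N : RightModule R ℓ ℓ) → Set ℓ
  M ≅ N = Σ (Hom M N) λ f → Injective f × Surjective f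

  infixr 6 _⊕_
  _⊕_ : (M N : RightModule R ℓ ℓ) → RightModule R ℓ ℓ
  M ⊕ N = ModuleProduct.rightModule M N

  infix 7 _^⊕_
  _^⊕_ : RightModule R ℓ ℓ → ℕ → RightModule R ℓ ℓ
  M ^⊕ zero  = ZeroModule.rightModule
  M ^⊕ suc n = M ⊕ M ^⊕ n

  ⊕-inj₁ : (M N : RightModule R ℓ ℓ) → Hom M (M ⊕ N)
  ⊕-inj₁ M N = mkHom (λ x → x , N.0ᴹ)
    (λ e → e , N.≈ᴹ-refl)
    (λ x y → M.≈ᴹ-refl , N.≈ᴹ-sym (N.+ᴹ-identityˡ _))
    (λ r x → M.≈ᴹ-refl , N.≈ᴹ-sym (N.*ᵣ-zeroˡ r))
    where
    module M = RightModule M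
    module N = RightModule N

  ⊕-proj₂ : (M N : RightModule R ℓ ℓ) → Hom (M ⊕ N) N
  ⊕-proj₂ M N = mkHom proj₂ proj₂ (λ x y → N.≈ᴹ-refl) (λ r x → N.≈ᴹ-refl)
    where module N = RightModule N

  Kernel : {M N : RightModule R ℓ ℓ} → Hom M N → RightModule R ℓ ℓ
  Kernel {M} {N} f = record
    { Carrierᴹ = Σ M.Carrierᴹ λ x → f.fun x N.≈ᴹ N.0ᴹ
    ; _≈ᴹ_ = λ x y → proj₁ x M.≈ᴹ proj₁ y
    ; _+ᴹ_ = λ (x , p) (y , q) → x M.+ᴹ y ,
        N.≈ᴹ-trans (f.+ᴹ-homo x y) (N.≈ᴹ-trans (N.+ᴹ-cong p q) (N.+ᴹ-identityˡ _))
    ; _*ᵣ_ = λ (x , p) r → x M.*ᵣ r ,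
        N.≈ᴹ-trans (f.*ᵣ-homo r x) (N.≈ᴹ-trans (N.*ᵣ-congʳ p) (N.*ᵣ-zeroˡ r))
    ; 0ᴹ = M.0ᴹ , f.0ᴹ-homo
    ; -ᴹ_ = λ (x , p) → M.-ᴹ x ,
        N.≈ᴹ-trans (f.-ᴹ-homo x) (N.≈ᴹ-trans (N.-ᴹ‿cong p) ε⁻¹≈ε)
    ; isRightModule = record
      { isRightSemimodule = record
        { +ᴹ-isCommutativeMonoid = record
          { isMonoid = record
            { isSemigroup = record
              { isMagma = record
                { isEquivalence = record
                  { refl = M.≈ᴹ-refl ; sym = M.≈ᴹ-sym ; trans = M.≈ᴹ-trans }
                ; ∙-cong = M.+ᴹ-cong
                }
              ; assoc = λ _ _ _ → M.+ᴹ-assoc _ _ _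
              }
            ; identity = (λ _ → M.+ᴹ-identityˡ _) , (λ _ → M.+ᴹ-identityʳ _)
            }
          ; comm = λ _ _ → M.+ᴹ-comm _ _
          }
        ; isPrerightSemimodule = record
          { *ᵣ-cong      = M.*ᵣ-cong
          ; *ᵣ-zeroʳ     = λ _ → M.*ᵣ-zeroʳ _
          ; *ᵣ-distribˡ  = λ _ _ _ → M.*ᵣ-distribˡ _ _ _
          ; *ᵣ-identityʳ = λ _ → M.*ᵣ-identityʳ _
          ; *ᵣ-assoc     = λ _ _ _ → M.*ᵣ-assoc _ _ _
          ; *ᵣ-zeroˡ     = λ _ → M.*ᵣ-zeroˡ _
          ; *ᵣ-distribʳ  = λ _ _ _ → M.*ᵣ-distribʳ _ _ _
          }
        }
      ; -ᴹ‿cong    = M.-ᴹ‿cong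
      ; -ᴹ‿inverse = (λ _ → M.-ᴹ‿inverseˡ _) , (λ _ → M.-ᴹ‿inverseʳ _)
      }
    }
    where
    module f = Hom f
    module M = RightModule M
    module N = RightModule N
    open AbelianGroupProperties N.+ᴹ-abelianGroup using (ε⁻¹≈ε)

  Kernel-incl : {M N : RightModule R ℓ ℓ} (f : Hom M N) → Hom (Kernel f) M
  Kernel-incl {M} f = mkHom proj₁ (λ e → e) (λ _ _ → M.≈ᴹ-refl) (λ _ _ → M.≈ᴹ-refl)
    where module M = RightModule M

  -- N / f(M): the carrier of N with a coarser equality.
  Cokerˡ : {M N : LeftModule R ℓ ℓ} → Homˡ M N → LeftModule R ℓ ℓ
  Cokerˡ {M} {N} f = record
    { Carrierᴹ = N.Carrierᴹ
    ; _≈ᴹ_ = _≋_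
    ; _+ᴹ_ = N._+ᴹ_
    ; _*ₗ_ = N._*ₗ_
    ; 0ᴹ = N.0ᴹ
    ; -ᴹ_ = N.-ᴹ_
    ; isLeftModule = record
      { isLeftSemimodule = record
        { +ᴹ-isCommutativeMonoid = record
          { isMonoid = record
            { isSemigroup = record
              { isMagma = record
                { isEquivalence = record
                  { refl = ↑ N.≈ᴹ-refl ; sym = ≋-sym ; trans = ≋-trans }
                ; ∙-cong = ≋-+
                }
              ; assoc = λ x y z → ↑ (N.+ᴹ-assoc x y z)
              }
            ; identity = (λ x → ↑ (N.+ᴹ-identityˡ x)) , (λ x → ↑ (N.+ᴹ-identityʳ x))
            }
          ; comm = λ x y → ↑ (N.+ᴹ-comm x y)
          }
        ; isPreleftSemimodule = record
          { *ₗ-cong      = ≋-*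
          ; *ₗ-zeroˡ     = λ x → ↑ (N.*ₗ-zeroˡ x)
          ; *ₗ-distribʳ  = λ x r s → ↑ (N.*ₗ-distribʳ x r s)
          ; *ₗ-identityˡ = λ x → ↑ (N.*ₗ-identityˡ x)
          ; *ₗ-assoc     = λ r s x → ↑ (N.*ₗ-assoc r s x)
          ; *ₗ-zeroʳ     = λ r → ↑ (N.*ₗ-zeroʳ r)
          ; *ₗ-distribˡ  = λ r x y → ↑ (N.*ₗ-distribˡ r x y)
          }
        }
      ; -ᴹ‿cong    = ≋-neg
      ; -ᴹ‿inverse = (λ x → ↑ (N.-ᴹ‿inverseˡ x)) , (λ x → ↑ (N.-ᴹ‿inverseʳ x))
      }
    }
    where
    module f = Homˡ f
    module M = LeftModule M
    module N = LeftModule N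
    open AbelianGroupProperties N.+ᴹ-abelianGroup using (⁻¹-∙-comm)
    open CommutativeSemigroupProperties
      (CommutativeMonoid.commutativeSemigroup N.+ᴹ-commutativeMonoid) using (interchange)
    open SetoidReasoning N.≈ᴹ-setoid

    infix 4 _≋_
    _≋_ : N.Carrierᴹ → N.Carrierᴹ → Set _
    x ≋ y = ∃ λ z → x N.≈ᴹ y N.+ᴹ f.fun z

    ↑ : ∀ {x y} → x N.≈ᴹ y → x ≋ y
    ↑ {x} {y} e = M.0ᴹ , (begin
      x                   ≈⟨ e ⟩
      y                   ≈⟨ N.+ᴹ-identityʳ y ⟨
      y N.+ᴹ N.0ᴹ         ≈⟨ N.+ᴹ-congˡ f.0ᴹ-homo ⟨
      y N.+ᴹ f.fun M.0ᴹ   ∎)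

    ≋-sym : ∀ {x y} → x ≋ y → y ≋ x
    ≋-sym {x} {y} (z , e) = M.-ᴹ z , (begin
      y                                         ≈⟨ N.+ᴹ-identityʳ y ⟨
      y N.+ᴹ N.0ᴹ                               ≈⟨ N.+ᴹ-congˡ (N.-ᴹ‿inverseʳ (f.fun z)) ⟨
      y N.+ᴹ (f.fun z N.+ᴹ N.-ᴹ f.fun z)        ≈⟨ N.+ᴹ-assoc _ _ _ ⟨
      (y N.+ᴹ f.fun z) N.+ᴹ N.-ᴹ f.fun z        ≈⟨ N.+ᴹ-cong e (f.-ᴹ-homo z) ⟨
      x N.+ᴹ f.fun (M.-ᴹ z)                     ∎)

    ≋-trans : ∀ {x y z} → x ≋ y → y ≋ z → x ≋ z
    ≋-trans {x} {y} {z} (u , d) (v , e) = v M.+ᴹ u , (begin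
      x                                     ≈⟨ d ⟩
      y N.+ᴹ f.fun u                        ≈⟨ N.+ᴹ-congʳ e ⟩
      (z N.+ᴹ f.fun v) N.+ᴹ f.fun u         ≈⟨ N.+ᴹ-assoc _ _ _ ⟩
      z N.+ᴹ (f.fun v N.+ᴹ f.fun u)         ≈⟨ N.+ᴹ-congˡ (f.+ᴹ-homo v u) ⟨
      z N.+ᴹ f.fun (v M.+ᴹ u)               ∎)

    ≋-+ : ∀ {x y u v} → x ≋ y → u ≋ v → x N.+ᴹ u ≋ y N.+ᴹ v
    ≋-+ {x} {y} {u} {v} (a , d) (b , e) = a M.+ᴹ b , (begin
      x N.+ᴹ u                                        ≈⟨ N.+ᴹ-cong d e ⟩
      (y N.+ᴹ f.fun a) N.+ᴹ (v N.+ᴹ f.fun b)          ≈⟨ interchange _ _ _ _ ⟩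
      (y N.+ᴹ v) N.+ᴹ (f.fun a N.+ᴹ f.fun b)          ≈⟨ N.+ᴹ-congˡ (f.+ᴹ-homo a b) ⟨
      (y N.+ᴹ v) N.+ᴹ f.fun (a M.+ᴹ b)                ∎)

    ≋-* : ∀ {r s x y} → Ring._≈_ R r s → x ≋ y → r N.*ₗ x ≋ s N.*ₗ y
    ≋-* {r} {s} {x} {y} d (z , e) = s M.*ₗ z , (begin
      r N.*ₗ x                                ≈⟨ N.*ₗ-cong d e ⟩
      s N.*ₗ (y N.+ᴹ f.fun z)                 ≈⟨ N.*ₗ-distribˡ s _ _ ⟩
      s N.*ₗ y N.+ᴹ s N.*ₗ f.fun z            ≈⟨ N.+ᴹ-congˡ (f.*ₗ-homo s z) ⟨
      s N.*ₗ y N.+ᴹ f.fun (s M.*ₗ z)          ∎)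

    ≋-neg : ∀ {x y} → x ≋ y → N.-ᴹ x ≋ N.-ᴹ y
    ≋-neg {x} {y} (z , e) = M.-ᴹ z , (begin
      N.-ᴹ x                                ≈⟨ N.-ᴹ‿cong e ⟩
      N.-ᴹ (y N.+ᴹ f.fun z)                 ≈⟨ ⁻¹-∙-comm _ _ ⟨
      N.-ᴹ y N.+ᴹ N.-ᴹ f.fun z              ≈⟨ N.+ᴹ-congˡ (f.-ᴹ-homo z) ⟨
      N.-ᴹ y N.+ᴹ f.fun (M.-ᴹ z)            ∎)

  -- The left module Hom(M, R), with (r f)(x) = r f(x).
  _* : RightModule R ℓ ℓ → LeftModule R ℓ ℓ
  M * = record
    { Carrierᴹ = Hom M Rᴿ
    ; _≈ᴹ_ = _≈ʰ_
    ; _+ᴹ_ = λ f g → mkHom (λ x → fun f x R.+ fun g x)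
        (λ e → R.+-cong (⟦⟧-cong f e) (⟦⟧-cong g e))
        (λ x y → R.trans (R.+-cong (+ᴹ-homo f x y) (+ᴹ-homo g x y)) (interchange _ _ _ _))
        (λ r x → R.trans (R.+-cong (*ᵣ-homo f r x) (*ᵣ-homo g r x)) (R.sym (R.distribʳ _ _ _)))
    ; _*ₗ_ = λ r f → mkHom (λ x → r R.* fun f x)
        (λ e → R.*-congˡ (⟦⟧-cong f e))
        (λ x y → R.trans (R.*-congˡ (+ᴹ-homo f x y)) (R.distribˡ _ _ _))
        (λ s x → R.trans (R.*-congˡ (*ᵣ-homo f s x)) (R.sym (R.*-assoc _ _ _)))
    ; 0ᴹ = mkHom (λ _ → R.0#) (λ _ → R.refl)
        (λ _ _ → R.sym (R.+-identityˡ _)) (λ r _ → R.sym (R.zeroˡ r))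
    ; -ᴹ_ = λ f → mkHom (λ x → R.- fun f x)
        (λ e → R.-‿cong (⟦⟧-cong f e))
        (λ x y → R.trans (R.-‿cong (+ᴹ-homo f x y)) (R.sym (⁻¹-∙-comm _ _)))
        (λ r x → R.trans (R.-‿cong (*ᵣ-homo f r x)) (-‿distribˡ-* _ _))
    ; isLeftModule = record
      { isLeftSemimodule = record
        { +ᴹ-isCommutativeMonoid = record
          { isMonoid = record
            { isSemigroup = record
              { isMagma = record
                { isEquivalence = record
                  { refl  = λ _ → R.refl
                  ; sym   = λ d x → R.sym (d x)
                  ; trans = λ d e x → R.trans (d x) (e x)
                  }
                ; ∙-cong = λ d e x → R.+-cong (d x) (e x)
                }
              ; assoc = λ _ _ _ _ → R.+-assoc _ _ _
              }
            ; identity = (λ _ _ → R.+-identityˡ _) , (λ _ _ → R.+-identityʳ _)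
            }
          ; comm = λ _ _ _ → R.+-comm _ _
          }
        ; isPreleftSemimodule = record
          { *ₗ-cong      = λ d e x → R.*-cong d (e x)
          ; *ₗ-zeroˡ     = λ _ _ → R.zeroˡ _
          ; *ₗ-distribʳ  = λ _ _ _ _ → R.distribʳ _ _ _
          ; *ₗ-identityˡ = λ _ _ → R.*-identityˡ _
          ; *ₗ-assoc     = λ _ _ _ _ → R.*-assoc _ _ _
          ; *ₗ-zeroʳ     = λ _ _ → R.zeroʳ _
          ; *ₗ-distribˡ  = λ _ _ _ _ → R.distribˡ _ _ _
          }
        }
      ; -ᴹ‿cong    = λ d x → R.-‿cong (d x)
      ; -ᴹ‿inverse = (λ _ _ → R.-‿inverseˡ _) , (λ _ _ → R.-‿inverseʳ _)
      }
    }
    where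
    module R = Ring R
    open Hom
    open AbelianGroupProperties R.+-abelianGroup using (⁻¹-∙-comm)
    open RingProperties R using (-‿distribˡ-*)
    open CommutativeSemigroupProperties
      (CommutativeMonoid.commutativeSemigroup R.+-commutativeMonoid) using (interchange)

    Rᴿ : RightModule R _ _
    Rᴿ = Regular.rightModule

  transpose : {M N : RightModule R ℓ ℓ} → Hom M N → Homˡ (N *) (M *)
  transpose f = mkHomˡ (λ g → g ∘ʰ f)
    (λ e x → e (Hom.fun f x)) (λ _ _ _ → R.refl) (λ _ _ _ → R.refl)
    where module R = Ring R

module _ {R S : Ring ℓ ℓ} where
  private
    module R = Ring R
    module S = Ring S
  open RingMorphisms R.rawRing S.rawRing

  module _ {φ : R.Carrier → S.Carrier} (isHom : IsRingHomomorphism φ) where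
    private
      module φ = IsRingHomomorphism isHom

    restrictʳ : RightModule S ℓ ℓ → RightModule R ℓ ℓ
    restrictʳ M = record
      { _*ᵣ_ = λ x r → x M.*ᵣ φ r
      ; isRightModule = record
        { isRightSemimodule = record
          { +ᴹ-isCommutativeMonoid = M.+ᴹ-isCommutativeMonoid
          ; isPrerightSemimodule = record
            { *ᵣ-cong      = λ d e → M.*ᵣ-cong d (φ.⟦⟧-cong e)
            ; *ᵣ-zeroʳ     = λ x → M.≈ᴹ-trans (M.*ᵣ-congˡ φ.0#-homo) (M.*ᵣ-zeroʳ x)
            ; *ᵣ-distribˡ  = λ x r s → M.≈ᴹ-trans (M.*ᵣ-congˡ (φ.+-homo r s)) (M.*ᵣ-distribˡ _ _ _)
            ; *ᵣ-identityʳ = λ x → M.≈ᴹ-trans (M.*ᵣ-congˡ φ.1#-homo) (M.*ᵣ-identityʳ x)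
            ; *ᵣ-assoc     = λ x r s → M.≈ᴹ-trans (M.*ᵣ-assoc _ _ _) (M.*ᵣ-congˡ (S.sym (φ.*-homo r s)))
            ; *ᵣ-zeroˡ     = λ r → M.*ᵣ-zeroˡ (φ r)
            ; *ᵣ-distribʳ  = λ r x y → M.*ᵣ-distribʳ (φ r) x y
            }
          }
        ; -ᴹ‿cong    = M.-ᴹ‿cong
        ; -ᴹ‿inverse = M.-ᴹ‿inverse
        }
      }
      where module M = RightModule M

    restrictˡ : LeftModule S ℓ ℓ → LeftModule R ℓ ℓ
    restrictˡ M = record
      { _*ₗ_ = λ r x → φ r M.*ₗ x
      ; isLeftModule = record
        { isLeftSemimodule = record
          { +ᴹ-isCommutativeMonoid = M.+ᴹ-isCommutativeMonoid
          ; isPreleftSemimodule = record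
            { *ₗ-cong      = λ d e → M.*ₗ-cong (φ.⟦⟧-cong d) e
            ; *ₗ-zeroˡ     = λ x → M.≈ᴹ-trans (M.*ₗ-congʳ φ.0#-homo) (M.*ₗ-zeroˡ x)
            ; *ₗ-distribʳ  = λ x r s → M.≈ᴹ-trans (M.*ₗ-congʳ (φ.+-homo r s)) (M.*ₗ-distribʳ _ _ _)
            ; *ₗ-identityˡ = λ x → M.≈ᴹ-trans (M.*ₗ-congʳ φ.1#-homo) (M.*ₗ-identityˡ x)
            ; *ₗ-assoc     = λ r s x → M.≈ᴹ-trans (M.*ₗ-congʳ (φ.*-homo r s)) (M.*ₗ-assoc _ _ _)
            ; *ₗ-zeroʳ     = λ r → M.*ₗ-zeroʳ (φ r)
            ; *ₗ-distribˡ  = λ r x y → M.*ₗ-distribˡ (φ r) x y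
            }
          }
        ; -ᴹ‿cong    = M.-ᴹ‿cong
        ; -ᴹ‿inverse = M.-ᴹ‿inverse
        }
      }
      where module M = LeftModule M

FiniteDimensional : (k : Field ℓ) → RightModule (Field.ring k) ℓ ℓ → Set ℓ
FiniteDimensional k V = ∃ λ n → Σ (Fin n → Carrierᴹ) λ b →
  (∀ x → ∃ λ (c : Fin n → Carrier) → x ≈ᴹ sum (λ i → b i *ᵣ c i)) ×
  (∀ (c : Fin n → Carrier) → sum (λ i → b i *ᵣ c i) ≈ᴹ 0ᴹ → ∀ i → c i ≈ 0#)
  where
  open Field k
  open RightModule V
  open MonoidSum +ᴹ-monoid using (sum)

-- The k-algebra structure of a ring is a ring homomorphism from k to its centre.
record FDAlgebra (k : Field ℓ) : Set (lsuc ℓ) where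
  private
    module k = Field k
  field
    ring : Ring ℓ ℓ
  open Ring ring public
  open RingMorphisms k.rawRing rawRing using (IsRingHomomorphism)
  field
    ι       : k.Carrier → Carrier
    ι-isHom : IsRingHomomorphism ι
    central : ∀ c x → ι c * x ≈ x * ι c
  regular : RightModule ring ℓ ℓ
  regular = Regular.rightModule
  field
    regular-finiteDimensional : FiniteDimensional k (restrictʳ {R = k.ring} ι-isHom regular)

module _ {k : Field ℓ} where
  private
    module k = Field k

  IsProductOf : (Λ A B : FDAlgebra k) → Set ℓ
  IsProductOf Λ A B = Σ (Λ.Carrier → A×B.Carrier) λ φ →
    IsRingIsomorphism φ × (∀ c → φ (Λ.ι c) A×B.≈ (A.ι c , B.ι c))
    where
    module Λ = FDAlgebra Λ
    module A = FDAlgebra A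
    module B = FDAlgebra B
    module A×B = Ring (RingProduct.ring A.ring B.ring)
    open RingMorphisms Λ.rawRing A×B.rawRing using (IsRingIsomorphism)

  IsZeroAlgebra : FDAlgebra k → Set ℓ
  IsZeroAlgebra Λ = 1# ≈ 0#
    where open FDAlgebra Λ

  IndecomposableAlgebra : FDAlgebra k → Set (lsuc ℓ)
  IndecomposableAlgebra Λ = ¬ IsZeroAlgebra Λ ×
    (∀ A B → IsProductOf Λ A B → IsZeroAlgebra A ⊎ IsZeroAlgebra B)

  -- A module over a finite dimensional algebra is finitely generated
  -- exactly when it is finite dimensional.
  record Mod (Λ : FDAlgebra k) : Set (lsuc ℓ) where
    open FDAlgebra Λ using (ring; ι-isHom)
    field
      mod               : RightModule ring ℓ ℓ
      finiteDimensional : FiniteDimensional k (restrictʳ {R = k.ring} ι-isHom mod)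

module _ {k : Field ℓ} {Λ : FDAlgebra k} where
  private
    module k = Field k
    module Λ = FDAlgebra Λ
  open Mod

  -- The k-dual Hom_k(L, k) of a left module, with (f a)(x) = f(a x).
  D : LeftModule Λ.ring ℓ ℓ → RightModule Λ.ring ℓ ℓ
  D L = record
    { Carrierᴹ = Homˡ Lₖ kₖ
    ; _≈ᴹ_ = λ f g → ∀ x → fun f x k.≈ fun g x
    ; _+ᴹ_ = λ f g → mkHomˡ (λ x → fun f x k.+ fun g x)
        (λ e → k.+-cong (⟦⟧-cong f e) (⟦⟧-cong g e))
        (λ x y → k.trans (k.+-cong (+ᴹ-homo f x y) (+ᴹ-homo g x y)) (interchange _ _ _ _))
        (λ c x → k.trans (k.+-cong (*ₗ-homo f c x) (*ₗ-homo g c x)) (k.sym (k.distribˡ _ _ _)))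
    ; _*ᵣ_ = λ f a → mkHomˡ (λ x → fun f (a L.*ₗ x))
        (λ e → ⟦⟧-cong f (L.*ₗ-congˡ e))
        (λ x y → k.trans (⟦⟧-cong f (L.*ₗ-distribˡ a x y)) (+ᴹ-homo f _ _))
        (λ c x → k.trans (⟦⟧-cong f (swap a c x)) (*ₗ-homo f c _))
    ; 0ᴹ = mkHomˡ (λ _ → k.0#) (λ _ → k.refl)
        (λ _ _ → k.sym (k.+-identityˡ _)) (λ c _ → k.sym (k.zeroʳ c))
    ; -ᴹ_ = λ f → mkHomˡ (λ x → k.- fun f x)
        (λ e → k.-‿cong (⟦⟧-cong f e))
        (λ x y → k.trans (k.-‿cong (+ᴹ-homo f x y)) (k.sym (⁻¹-∙-comm _ _)))
        (λ c x → k.trans (k.-‿cong (*ₗ-homo f c x)) (-‿distribʳ-* _ _))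
    ; isRightModule = record
      { isRightSemimodule = record
        { +ᴹ-isCommutativeMonoid = record
          { isMonoid = record
            { isSemigroup = record
              { isMagma = record
                { isEquivalence = record
                  { refl  = λ _ → k.refl
                  ; sym   = λ d x → k.sym (d x)
                  ; trans = λ d e x → k.trans (d x) (e x)
                  }
                ; ∙-cong = λ d e x → k.+-cong (d x) (e x)
                }
              ; assoc = λ _ _ _ _ → k.+-assoc _ _ _
              }
            ; identity = (λ _ _ → k.+-identityˡ _) , (λ _ _ → k.+-identityʳ _)
            }
          ; comm = λ _ _ _ → k.+-comm _ _
          }
        ; isPrerightSemimodule = record
          { *ᵣ-cong      = λ {f} d e x → k.trans (⟦⟧-cong f (L.*ₗ-congʳ e)) (d _)
          ; *ᵣ-zeroʳ     = λ f x → k.trans (⟦⟧-cong f (L.*ₗ-zeroˡ x)) (0ᴹ-homo f)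
          ; *ᵣ-distribˡ  = λ f a b x → k.trans (⟦⟧-cong f (L.*ₗ-distribʳ x a b)) (+ᴹ-homo f _ _)
          ; *ᵣ-identityʳ = λ f x → ⟦⟧-cong f (L.*ₗ-identityˡ x)
          ; *ᵣ-assoc     = λ f a b x → ⟦⟧-cong f (L.≈ᴹ-sym (L.*ₗ-assoc a b x))
          ; *ᵣ-zeroˡ     = λ _ _ → k.refl
          ; *ᵣ-distribʳ  = λ _ _ _ _ → k.refl
          }
        }
      ; -ᴹ‿cong    = λ d x → k.-‿cong (d x)
      ; -ᴹ‿inverse = (λ _ _ → k.-‿inverseˡ _) , (λ _ _ → k.-‿inverseʳ _)
      }
    }
    where
    module L = LeftModule L
    open Homˡ
    open AbelianGroupProperties k.+-abelianGroup using (⁻¹-∙-comm)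
    open RingProperties k.ring using (-‿distribʳ-*)
    open CommutativeSemigroupProperties
      (CommutativeMonoid.commutativeSemigroup k.+-commutativeMonoid) using (interchange)

    Lₖ kₖ : LeftModule k.ring _ _
    Lₖ = restrictˡ {R = k.ring} Λ.ι-isHom L
    kₖ = Regular.leftModule

    swap : ∀ a c x → a L.*ₗ (Λ.ι c L.*ₗ x) L.≈ᴹ Λ.ι c L.*ₗ (a L.*ₗ x)
    swap a c x = L.≈ᴹ-trans (L.≈ᴹ-sym (L.*ₗ-assoc _ _ _))
      (L.≈ᴹ-trans (L.*ₗ-congʳ (Λ.sym (Λ.central c a))) (L.*ₗ-assoc _ _ _))

  DirectSummand : (N : Mod Λ) (M : RightModule Λ.ring ℓ ℓ) → Set (lsuc ℓ)
  DirectSummand N M = ∃ λ (L : Mod Λ) → mod N ⊕ mod L ≅ M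

  infix 4 _∈add_
  _∈add_ : (N M : Mod Λ) → Set (lsuc ℓ)
  N ∈add M = ∃ λ n → DirectSummand N (mod M ^⊕ n)

  Indecomposable : Mod Λ → Set (lsuc ℓ)
  Indecomposable M = ¬ IsZero (mod M) ×
    (∀ (A B : Mod Λ) → mod A ⊕ mod B ≅ mod M → IsZero (mod A) ⊎ IsZero (mod B))

  -- Repetition is meant within a decomposition: complementary indecomposable
  -- summands N₁, N₂ in M ≅ N₁ ⊕ N₂ ⊕ L are never isomorphic.
  Basic : RightModule Λ.ring ℓ ℓ → Set (lsuc ℓ)
  Basic M = ∀ (N₁ N₂ L : Mod Λ) → Indecomposable N₁ → Indecomposable N₂ →
    mod N₁ ⊕ mod N₂ ⊕ mod L ≅ M → ¬ (mod N₁ ≅ mod N₂)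

  -- The cardinality |M| is a relation: the isomorphism classes of indecomposable
  -- direct summands of M are enumerated without repetition by Fin n.
  record ∣_∣≡_ (M : RightModule Λ.ring ℓ ℓ) (n : ℕ) : Set (lsuc ℓ) where
    field
      summand        : Fin n → Mod Λ
      indecomposable : ∀ i → Indecomposable (summand i)
      isSummand      : ∀ i → DirectSummand (summand i) M
      distinct       : ∀ i j → i ≢ j → ¬ (mod (summand i) ≅ mod (summand j))
      complete       : ∀ N → Indecomposable N → DirectSummand N M →
                       ∃ λ i → mod N ≅ mod (summand i)

  Projective : Mod Λ → Set (lsuc ℓ)
  Projective P = ∀ (X Y : Mod Λ) (g : Hom (mod X) (mod Y)) → Surjective g →
    ∀ (f : Hom (mod P) (mod Y)) → ∃ λ (h : Hom (mod P) (mod X)) → g ∘ʰ h ≈ʰ f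

  record ShortExact (A B C : RightModule Λ.ring ℓ ℓ) : Set ℓ where
    private
      module B = RightModule B
      module C = RightModule C
    field
      i        : Hom A B
      p        : Hom B C
      i-inj    : Injective i
      p-surj   : Surjective p
      p∘i≈0    : IsZeroHom (p ∘ʰ i)
      ker⊆im   : ∀ y → Hom.fun p y C.≈ᴹ C.0ᴹ → ∃ λ x → Hom.fun i x B.≈ᴹ y

  -- Finite dimensionality of the middle term is automatic.
  Extension : (M N : Mod Λ) → Set (lsuc ℓ)
  Extension M N = ∃ λ E → ShortExact (mod N) E (mod M)

  infix 4 _≈ᴱ_
  _≈ᴱ_ : {M N : Mod Λ} → Extension M N → Extension M N → Set ℓ
  (E , e) ≈ᴱ (E′ , e′) = ∃ λ (φ : Hom E E′) →
    (φ ∘ʰ e.i ≈ʰ e′.i) × (e′.p ∘ʰ φ ≈ʰ e.p)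
    where
    module e  = ShortExact e
    module e′ = ShortExact e′

  trivialExtension : (M N : Mod Λ) → Extension M N
  trivialExtension M N = mod N ⊕ mod M , record
    { i      = ⊕-inj₁ (mod N) (mod M)
    ; p      = ⊕-proj₂ (mod N) (mod M)
    ; i-inj  = proj₁
    ; p-surj = λ y → (N.0ᴹ , y) , M.≈ᴹ-refl
    ; p∘i≈0  = λ _ → M.≈ᴹ-refl
    ; ker⊆im = λ (x , y) e → x , (N.≈ᴹ-refl , M.≈ᴹ-sym e)
    }
    where
    module M = RightModule (mod M)
    module N = RightModule (mod N)

  -- Ext¹(M, N) = 0, for the Yoneda group of classes of extensions of M by N.
  Ext¹-vanishes : (M N : Mod Λ) → Set (lsuc ℓ)
  Ext¹-vanishes M N = ∀ (e : Extension M N) → _≈ᴱ_ {M} {N} e (trivialExtension M N)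

  ProjectiveDimension≤1 : Mod Λ → Set (lsuc ℓ)
  ProjectiveDimension≤1 M = ∃₂ λ P₁ P₀ →
    Projective P₁ × Projective P₀ × ShortExact (mod P₁) (mod P₀) (mod M)

  record IsProjectiveCover (P : Mod Λ) {X : RightModule Λ.ring ℓ ℓ}
                           (f : Hom (mod P) X) : Set (lsuc ℓ) where
    field
      projective : Projective P
      surjective : Surjective f
      essential  : ∀ (Y : Mod Λ) (g : Hom (mod Y) (mod P)) →
                   Surjective (f ∘ʰ g) → Surjective g

  record MinimalPresentation (M : Mod Λ) : Set (lsuc ℓ) where
    field
      P₁ P₀    : Mod Λ
      d₀       : Hom (mod P₀) (mod M)
      d₁       : Hom (mod P₁) (Kernel d₀)
      d₀-cover : IsProjectiveCover P₀ d₀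
      d₁-cover : IsProjectiveCover P₁ d₁

  Tr : {M : Mod Λ} → MinimalPresentation M → LeftModule Λ.ring ℓ ℓ
  Tr p = Cokerˡ (transpose (Kernel-incl d₀ ∘ʰ d₁))
    where open MinimalPresentation p

  τ : {M : Mod Λ} → MinimalPresentation M → RightModule Λ.ring ℓ ℓ
  τ p = D (Tr p)

  HomVanishes : (M N : RightModule Λ.ring ℓ ℓ) → Set ℓ
  HomVanishes M N = ∀ (f : Hom M N) → IsZeroHom f

  -- Hom(M, τN) = 0.  Every N has a minimal projective presentation and τN is
  -- independent of it up to isomorphism, so the choice is quantified over.
  Hom-τ-vanishes : (M N : Mod Λ) → Set (lsuc ℓ)
  Hom-τ-vanishes M N = ∀ (p : MinimalPresentation N) → HomVanishes (mod M) (τ p)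

  record IsTilting (T : Mod Λ) : Set (lsuc ℓ) where
    field
      pd≤1  : ProjectiveDimension≤1 T
      rigid : Ext¹-vanishes T T
      count : ∃ λ n → (∣ mod T ∣≡ n) × (∣ Λ.regular ∣≡ n)

  record IsSupportτTiltingPair (M P : Mod Λ) : Set (lsuc ℓ) where
    field
      projective : Projective P
      τ-rigid    : Hom-τ-vanishes M M
      Hom[P,M]≈0 : HomVanishes (mod P) (mod M)
      count      : ∃₂ λ m p →
                   (∣ mod M ∣≡ m) × (∣ mod P ∣≡ p) × (∣ Λ.regular ∣≡ (m ℕ.+ p))

module _ {k : Field ℓ} (Λ : FDAlgebra k) where
  private
    module Λ = FDAlgebra Λ
  open Mod

  BasicAlgebra : Set (lsuc ℓ)
  BasicAlgebra = Basic {Λ = Λ} Λ.regular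

  Hereditary : Set (lsuc ℓ)
  Hereditary = ∀ (P N : Mod Λ) (f : Hom (mod N) (mod P)) →
    Projective P → Injective f → Projective N

  record tilt : Set (lsuc ℓ) where
    field
      T         : Mod Λ
      basic     : Basic {Λ = Λ} (mod T)
      isTilting : IsTilting T

  -- The projective P accompanying M is determined by M up to isomorphism, and
  -- is not part of the equality of s-τ-tilt.
  record s-τ-tilt : Set (lsuc ℓ) where
    field
      M       : Mod Λ
      basic   : Basic {Λ = Λ} (mod M)
      P       : Mod Λ
      P-basic : Basic {Λ = Λ} (mod P)
      isPair  : IsSupportτTiltingPair M P

module _ {k : Field ℓ} {Λ : FDAlgebra k} where
  open Mod

  infix 4 _≈ᵗ_ _≤ᵗ_ _≈ˢ_ _≤ˢ_

  _≈ᵗ_ : (T₁ T₂ : tilt Λ) → Set ℓ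
  T₁ ≈ᵗ T₂ = mod (tilt.T T₁) ≅ mod (tilt.T T₂)

  _≤ᵗ_ : (T₁ T₂ : tilt Λ) → Set (lsuc ℓ)
  T₁ ≤ᵗ T₂ = ∀ (X : Mod Λ) →
    Ext¹-vanishes (tilt.T T₁) X → Ext¹-vanishes (tilt.T T₂) X

  _≈ˢ_ : (M M′ : s-τ-tilt Λ) → Set ℓ
  M ≈ˢ M′ = mod (s-τ-tilt.M M) ≅ mod (s-τ-tilt.M M′)

  _≤ˢ_ : (M M′ : s-τ-tilt Λ) → Set (lsuc ℓ)
  M ≤ˢ M′ = Hom-τ-vanishes (s-τ-tilt.M M) (s-τ-tilt.M M′) ×
    (∀ (N : Mod Λ) → N ∈add s-τ-tilt.P M′ → N ∈add s-τ-tilt.P M)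

IsTiltingElement : {k : Field ℓ} {Λ : FDAlgebra k} → s-τ-tilt Λ → Set (lsuc ℓ)
IsTiltingElement M = IsTilting (s-τ-tilt.M M)

-- ρ′ is the restriction of ρ along the inclusion of tilt Λ into s-τ-tilt Λ:
-- each T in tilt Λ is (isomorphic to) some M in s-τ-tilt Λ, and ρ′ T is ρ M.
IsRestriction : {k : Field ℓ} {Λ Γ : FDAlgebra k} →
  (s-τ-tilt Λ → s-τ-tilt Γ) → (tilt Λ → tilt Γ) → Set (lsuc ℓ)
IsRestriction {Λ = Λ} ρ ρ′ = ∀ (T : tilt Λ) → ∃ λ (M : s-τ-tilt Λ) →
  (mod (s-τ-tilt.M M) ≅ mod (tilt.T T)) ×
  (mod (s-τ-tilt.M (ρ M)) ≅ mod (tilt.T (ρ′ T)))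
  where open Mod

{-# OPTIONS --safe #-}
module Submission where

-- M is tilting exactly when its pair (M, P) has P = 0. Write Pⱼ for the indecomposable projectives and
-- Sⱼ = top Pⱼ. A summand Pᵢ of P is seen by the order: M ≤ Y for every Y that lies above all simples Sⱼ
-- with j ≠ i (dévissage, because Sᵢ is not a composition factor of M), and one such Y is Λ/ΛeᵢΛ, whose own
-- projective is Pᵢ. The simples are the minimal nonzero elements, so an isomorphism permutes them, and
-- therefore preserves and reflects P ≠ 0.
-- On tilting modules the order of s-τ-tilt says Ext¹(T₂, T₁) = 0, by the Auslander-Reiten formula. This is
-- T₁^⊥ ⊆ T₂^⊥ because T₁^⊥ consists of the quotients of sums of T₁: the dimension vectors of the summands
-- of T₁ are independent (Happel-Ringel), so no nonzero C has Hom(T₁, C) = 0 = Ext¹(T₁, C).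
-- Existence statements are proved under double negation, and the conclusions are decidable by linear algebra.

open import Defs
open import Algebra.Bundles using (CommutativeMonoid; Ring)
open import Algebra.Module.Bundles using (LeftModule; RightModule)
import Algebra.Module.Construct.TensorUnit as Regular
import Algebra.Module.Construct.Zero as ZeroModule
import Algebra.Properties.AbelianGroup as AbelianGroupProperties
import Algebra.Properties.CommutativeSemigroup as CommutativeSemigroupProperties
open import Data.Empty using (⊥; ⊥-elim)
open import Data.Nat.Base as ℕ using (ℕ; zero; suc; z≤n; s≤s)
open import Data.Product.Base using (Σ; _×_; _,_; proj₁; proj₂; ∃; ∃₂)
open import Data.Sum.Base using (_⊎_; inj₁; inj₂; [_,_]′)
open import Level using (Level) renaming (suc to lsuc)
open import Relation.Nullary.Negation.Core using (¬_)
import Relation.Binary.Reasoning.Setoid as SetoidReasoning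
import Data.Nat.Properties as ℕₚ
open import Relation.Binary.PropositionalEquality.Core using (_≡_; refl; cong; subst; sym; trans; _≢_; cong₂)
import Algebra.Properties.Monoid.Sum as MonoidSum
open import Data.Fin.Base as Fin using (Fin; zero; suc; punchIn; punchOut)
open import Data.Vec.Functional using (_∷_; insertAt)
open import Algebra.Morphism.Structures using (module RingMorphisms)
import Data.Fin.Properties as Finₚ
import Algebra.Properties.Semiring.Sum as SemiringSum
open import Data.Integer.Base as ℤ using (ℤ; 0ℤ; 1ℤ)
import Data.Integer.Properties as ℤₚ
open import Data.Integer.Tactic.RingSolver using (solve-∀)
open import Data.Vec.Functional.Properties using (insertAt-lookup; insertAt-punchIn)
open import Relation.Nullary.Decidable using (yes; no; ¬?; decidable-stable)
open import Function.Bundles using (_⇔_; mk⇔)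
open import Relation.Binary.Morphism.Structures using (IsOrderIsomorphism)

private
  variable
    ℓ ℓ₁ ℓ₂ : Level

infixl 1 _>>=_
_>>=_ : {A : Set ℓ₁} {B : Set ℓ₂} → ¬ ¬ A → (A → ¬ ¬ B) → ¬ ¬ B
(m >>= f) k = m (λ x → f x k)

return : {A : Set ℓ₁} → A → ¬ ¬ A
return x k = k x

¬¬-em : (A : Set ℓ₁) → ¬ ¬ (A ⊎ ¬ A)
¬¬-em A k = k (inj₂ (λ x → k (inj₁ x)))

open RightModule using () renaming (≈ᴹ-trans to transᴹ; ≈ᴹ-sym to symᴹ; ≈ᴹ-refl to reflᴹ; 0ᴹ to zeroᴹ)

module ModuleOps {R : Ring ℓ ℓ} (M : RightModule R ℓ ℓ) where
  open RightModule M public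
  open AbelianGroupProperties +ᴹ-abelianGroup public
    using (ε⁻¹≈ε; ⁻¹-∙-comm; x∙y⁻¹≈ε⇒x≈y; x≈y⇒x∙y⁻¹≈ε; ⁻¹-involutive; inverseˡ-unique)
  open CommutativeSemigroupProperties
    (CommutativeMonoid.commutativeSemigroup +ᴹ-commutativeMonoid) public using (interchange)
  open SetoidReasoning ≈ᴹ-setoid public

  infixl 6 _⊖_
  _⊖_ : Carrierᴹ → Carrierᴹ → Carrierᴹ
  x ⊖ y = x +ᴹ -ᴹ y

  ⊖-cong : ∀ {x y u v} → x ≈ᴹ y → u ≈ᴹ v → x ⊖ u ≈ᴹ y ⊖ v
  ⊖-cong d e = +ᴹ-cong d (-ᴹ‿cong e)

  ⊖-identityʳ : ∀ x → x ⊖ 0ᴹ ≈ᴹ x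
  ⊖-identityʳ x = ≈ᴹ-trans (+ᴹ-congˡ ε⁻¹≈ε) (+ᴹ-identityʳ x)

  ⊖-inverse : ∀ x → x ⊖ x ≈ᴹ 0ᴹ
  ⊖-inverse = -ᴹ‿inverseʳ

  ⊖-+ : ∀ x y → (x ⊖ y) +ᴹ y ≈ᴹ x
  ⊖-+ x y = ≈ᴹ-trans (+ᴹ-assoc _ _ _)
    (≈ᴹ-trans (+ᴹ-congˡ (-ᴹ‿inverseˡ y)) (+ᴹ-identityʳ x))

  +-⊖ : ∀ x y → (x +ᴹ y) ⊖ y ≈ᴹ x
  +-⊖ x y = ≈ᴹ-trans (+ᴹ-assoc _ _ _)
    (≈ᴹ-trans (+ᴹ-congˡ (-ᴹ‿inverseʳ y)) (+ᴹ-identityʳ x))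

  ⊖-⊖ : ∀ x y → x ⊖ (x ⊖ y) ≈ᴹ y
  ⊖-⊖ x y = begin
    x +ᴹ -ᴹ (x +ᴹ -ᴹ y)         ≈⟨ +ᴹ-congˡ (⁻¹-∙-comm _ _) ⟨
    x +ᴹ (-ᴹ x +ᴹ -ᴹ (-ᴹ y))    ≈⟨ +ᴹ-assoc _ _ _ ⟨
    (x +ᴹ -ᴹ x) +ᴹ -ᴹ (-ᴹ y)    ≈⟨ +ᴹ-cong (-ᴹ‿inverseʳ x) (⁻¹-involutive y) ⟩
    0ᴹ +ᴹ y                     ≈⟨ +ᴹ-identityˡ y ⟩
    y                           ∎

  +-⊖-interchange : ∀ x y u v → (x +ᴹ y) ⊖ (u +ᴹ v) ≈ᴹ (x ⊖ u) +ᴹ (y ⊖ v)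
  +-⊖-interchange x y u v =
    ≈ᴹ-trans (+ᴹ-congˡ (≈ᴹ-sym (⁻¹-∙-comm u v))) (interchange _ _ _ _)

  -‿*ᵣ : ∀ x r → (-ᴹ x) *ᵣ r ≈ᴹ -ᴹ (x *ᵣ r)
  -‿*ᵣ x r = inverseˡ-unique _ _ (≈ᴹ-trans (≈ᴹ-sym (*ᵣ-distribʳ _ _ _))
    (≈ᴹ-trans (*ᵣ-congʳ (-ᴹ‿inverseˡ x)) (*ᵣ-zeroˡ r)))

  ⊖-*ᵣ : ∀ x y r → (x ⊖ y) *ᵣ r ≈ᴹ x *ᵣ r ⊖ y *ᵣ r
  ⊖-*ᵣ x y r = ≈ᴹ-trans (*ᵣ-distribʳ _ _ _) (+ᴹ-congˡ (-‿*ᵣ y r))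

  ⊖≈0⇒≈ : ∀ {x y} → x ⊖ y ≈ᴹ 0ᴹ → x ≈ᴹ y
  ⊖≈0⇒≈ = x∙y⁻¹≈ε⇒x≈y _ _

  ≈⇒⊖≈0 : ∀ {x y} → x ≈ᴹ y → x ⊖ y ≈ᴹ 0ᴹ
  ≈⇒⊖≈0 = x≈y⇒x∙y⁻¹≈ε

module _ {R : Ring ℓ ℓ} where
  private
    module R = Ring R

  El : RightModule R ℓ ℓ → Set ℓ
  El = RightModule.Carrierᴹ

  infixl 20 _⟨_⟩
  _⟨_⟩ : {M N : RightModule R ℓ ℓ} → Hom M N → El M → El N
  _⟨_⟩ = Hom.fun

  infix 4 _∋_≈_ _⟨_⟩≈0
  _∋_≈_ : (M : RightModule R ℓ ℓ) → El M → El M → Set ℓ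
  M ∋ x ≈ y = RightModule._≈ᴹ_ M x y

  _⟨_⟩≈0 : {M N : RightModule R ℓ ℓ} → Hom M N → El M → Set ℓ
  _⟨_⟩≈0 {N = N} f x = N ∋ f ⟨ x ⟩ ≈ zeroᴹ N

  module _ {M N : RightModule R ℓ ℓ} where
    private
      module M = ModuleOps M
      module N = ModuleOps N

    cong-h : (f : Hom M N) → ∀ {x y} → x M.≈ᴹ y → f ⟨ x ⟩ N.≈ᴹ f ⟨ y ⟩
    cong-h f = Hom.⟦⟧-cong f

    ⊖-homo : (f : Hom M N) → ∀ x y → f ⟨ x M.⊖ y ⟩ N.≈ᴹ f ⟨ x ⟩ N.⊖ f ⟨ y ⟩
    ⊖-homo f x y = N.≈ᴹ-trans (Hom.+ᴹ-homo f _ _) (N.+ᴹ-congˡ (Hom.-ᴹ-homo f y))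

    0ʰ : Hom M N
    0ʰ = mkHom (λ _ → N.0ᴹ) (λ _ → N.≈ᴹ-refl)
      (λ _ _ → N.≈ᴹ-sym (N.+ᴹ-identityˡ _)) (λ r _ → N.≈ᴹ-sym (N.*ᵣ-zeroˡ r))

    infixl 6 _+ʰ_ _-ʰ_
    _+ʰ_ _-ʰ_ : Hom M N → Hom M N → Hom M N
    f +ʰ g = mkHom (λ x → f ⟨ x ⟩ N.+ᴹ g ⟨ x ⟩)
      (λ e → N.+ᴹ-cong (cong-h f e) (cong-h g e))
      (λ x y → N.≈ᴹ-trans (N.+ᴹ-cong (Hom.+ᴹ-homo f x y) (Hom.+ᴹ-homo g x y)) (N.interchange _ _ _ _))
      (λ r x → N.≈ᴹ-trans (N.+ᴹ-cong (Hom.*ᵣ-homo f r x) (Hom.*ᵣ-homo g r x)) (N.≈ᴹ-sym (N.*ᵣ-distribʳ _ _ _)))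
    f -ʰ g = mkHom (λ x → f ⟨ x ⟩ N.⊖ g ⟨ x ⟩)
      (λ e → N.⊖-cong (cong-h f e) (cong-h g e))
      (λ x y → N.≈ᴹ-trans (N.⊖-cong (Hom.+ᴹ-homo f x y) (Hom.+ᴹ-homo g x y)) (N.+-⊖-interchange _ _ _ _))
      (λ r x → N.≈ᴹ-trans (N.⊖-cong (Hom.*ᵣ-homo f r x) (Hom.*ᵣ-homo g r x)) (N.≈ᴹ-sym (N.⊖-*ᵣ _ _ _)))

    ker≈0⇒injective : (f : Hom M N) → (∀ x → f ⟨ x ⟩≈0 → x M.≈ᴹ M.0ᴹ) → Injective f
    ker≈0⇒injective f h {x} {y} e = M.⊖≈0⇒≈ (h _ (N.≈ᴹ-trans (⊖-homo f x y) (N.≈⇒⊖≈0 e)))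

    injective⇒ker≈0 : (f : Hom M N) → Injective f → ∀ x → f ⟨ x ⟩≈0 → x M.≈ᴹ M.0ᴹ
    injective⇒ker≈0 f inj x e = inj (N.≈ᴹ-trans e (N.≈ᴹ-sym (Hom.0ᴹ-homo f)))

  idʰ : {M : RightModule R ℓ ℓ} → Hom M M
  idʰ {M} = mkHom (λ x → x) (λ e → e) (λ _ _ → M.≈ᴹ-refl) (λ _ _ → M.≈ᴹ-refl)
    where module M = RightModule M

  _^ʰ_ : {M : RightModule R ℓ ℓ} → Hom M M → ℕ → Hom M M
  f ^ʰ zero  = idʰ
  f ^ʰ suc n = f ∘ʰ (f ^ʰ n)

  module _ {M N : RightModule R ℓ ℓ} where
    private
      module M = ModuleOps M
      module N = ModuleOps N

    factor-at : {C : RightModule R ℓ ℓ} (q : Hom M C) → Surjective q → (f : Hom M N) →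
      (∀ x → q ⟨ x ⟩≈0 → f ⟨ x ⟩≈0) →
      Σ (Hom C N) λ f̄ → f̄ ∘ʰ q ≈ʰ f
    factor-at {C} q q-surj f ker = f̄ , λ x → same (proj₂ (q-surj (q ⟨ x ⟩)))
      where
      module C = ModuleOps C
      same : ∀ {x y} → q ⟨ x ⟩ C.≈ᴹ q ⟨ y ⟩ → f ⟨ x ⟩ N.≈ᴹ f ⟨ y ⟩
      same e = N.⊖≈0⇒≈ (N.≈ᴹ-trans (N.≈ᴹ-sym (⊖-homo f _ _))
        (ker _ (C.≈ᴹ-trans (⊖-homo q _ _) (C.≈⇒⊖≈0 e))))
      lift : El C → El M
      lift y = proj₁ (q-surj y)
      lift-ok : ∀ y → q ⟨ lift y ⟩ C.≈ᴹ y
      lift-ok y = proj₂ (q-surj y)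
      f̄ : Hom C N
      f̄ = mkHom (λ y → f ⟨ lift y ⟩)
        (λ e → same (C.≈ᴹ-trans (lift-ok _) (C.≈ᴹ-trans e (C.≈ᴹ-sym (lift-ok _)))))
        (λ x y → N.≈ᴹ-trans
          (same (C.≈ᴹ-trans (lift-ok _) (C.≈ᴹ-sym (C.≈ᴹ-trans (Hom.+ᴹ-homo q _ _) (C.+ᴹ-cong (lift-ok _) (lift-ok _))))))
          (Hom.+ᴹ-homo f _ _))
        (λ r x → N.≈ᴹ-trans
          (same (C.≈ᴹ-trans (lift-ok _) (C.≈ᴹ-sym (C.≈ᴹ-trans (Hom.*ᵣ-homo q _ _) (C.*ᵣ-congʳ (lift-ok _))))))
          (Hom.*ᵣ-homo f _ _))

    inverse : (e : M ≅ N) → Hom N M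
    inverse (f , inj , surj) = mkHom (λ y → proj₁ (surj y))
      (λ e → inj (N.≈ᴹ-trans (proj₂ (surj _)) (N.≈ᴹ-trans e (N.≈ᴹ-sym (proj₂ (surj _))))))
      (λ x y → inj (N.≈ᴹ-trans (proj₂ (surj _)) (N.≈ᴹ-sym
        (N.≈ᴹ-trans (Hom.+ᴹ-homo f _ _) (N.+ᴹ-cong (proj₂ (surj x)) (proj₂ (surj y)))))))
      (λ r x → inj (N.≈ᴹ-trans (proj₂ (surj _)) (N.≈ᴹ-sym
        (N.≈ᴹ-trans (Hom.*ᵣ-homo f _ _) (N.*ᵣ-congʳ (proj₂ (surj x)))))))

    inverseʳ : (e : M ≅ N) → ∀ y → proj₁ e ⟨ inverse e ⟨ y ⟩ ⟩ N.≈ᴹ y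
    inverseʳ (f , inj , surj) y = proj₂ (surj y)

    inverseˡ : (e : M ≅ N) → ∀ x → inverse e ⟨ proj₁ e ⟨ x ⟩ ⟩ M.≈ᴹ x
    inverseˡ (f , inj , surj) x = inj (proj₂ (surj _))

    mk≅ : (f : Hom M N) (g : Hom N M) → (∀ x → g ⟨ f ⟨ x ⟩ ⟩ M.≈ᴹ x) → (∀ y → f ⟨ g ⟨ y ⟩ ⟩ N.≈ᴹ y) → M ≅ N
    mk≅ f g gf fg = f ,
      (λ {x} {y} e → M.≈ᴹ-trans (M.≈ᴹ-sym (gf x)) (M.≈ᴹ-trans (cong-h g e) (gf y))) ,
      (λ y → g ⟨ y ⟩ , fg y)

    Kernel-cong : {V W : RightModule R ℓ ℓ} (f : Hom M V) (g : Hom N W) (φ : Hom M N) (ψ : Hom N M) →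
      (∀ x → ψ ⟨ φ ⟨ x ⟩ ⟩ M.≈ᴹ x) → (∀ y → φ ⟨ ψ ⟨ y ⟩ ⟩ N.≈ᴹ y) →
      (∀ x → f ⟨ x ⟩≈0 → g ⟨ φ ⟨ x ⟩ ⟩≈0) →
      (∀ y → g ⟨ y ⟩≈0 → f ⟨ ψ ⟨ y ⟩ ⟩≈0) →
      Kernel f ≅ Kernel g
    Kernel-cong f g φ ψ ψφ φψ to from =
      mkHom (λ (x , p) → φ ⟨ x ⟩ , to x p) (cong-h φ) (λ _ _ → Hom.+ᴹ-homo φ _ _) (λ _ _ → Hom.*ᵣ-homo φ _ _) ,
      (λ {x} {y} e → M.≈ᴹ-trans (M.≈ᴹ-sym (ψφ _)) (M.≈ᴹ-trans (cong-h ψ e) (ψφ _))) ,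
      (λ (y , q) → (ψ ⟨ y ⟩ , from y q) , φψ y)

  ≅-refl : {M : RightModule R ℓ ℓ} → M ≅ M
  ≅-refl {M} = idʰ , (λ e → e) , (λ y → y , reflᴹ M)

  ≅-sym : {M N : RightModule R ℓ ℓ} → M ≅ N → N ≅ M
  ≅-sym e = mk≅ (inverse e) (proj₁ e) (inverseʳ e) (inverseˡ e)

  ≅-trans : {L M N : RightModule R ℓ ℓ} → L ≅ M → M ≅ N → L ≅ N
  ≅-trans {N = N} (f , f-inj , f-surj) (g , g-inj , g-surj) =
    g ∘ʰ f , (λ e → f-inj (g-inj e)) ,
    λ z → let y , p = g-surj z ; x , q = f-surj y in
      x , transᴹ N (cong-h g q) p

  ≅-zero : {M N : RightModule R ℓ ℓ} → M ≅ N → IsZero M → IsZero N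
  ≅-zero {M} {N} e z y = N.≈ᴹ-trans (N.≈ᴹ-sym (inverseʳ e y))
    (N.≈ᴹ-trans (cong-h (proj₁ e) (z _)) (Hom.0ᴹ-homo (proj₁ e)))
    where module N = RightModule N

  infix 4 _◁_
  _◁_ : (N M : RightModule R ℓ ℓ) → Set ℓ
  N ◁ M = Σ (Hom N M) λ i → Σ (Hom M N) λ r → r ∘ʰ i ≈ʰ idʰ

  ◁-refl : {M : RightModule R ℓ ℓ} → M ◁ M
  ◁-refl {M} = idʰ , idʰ , λ x → reflᴹ M

  ◁-trans : {L M N : RightModule R ℓ ℓ} → L ◁ M → M ◁ N → L ◁ N
  ◁-trans {L} (i , r , e) (i′ , r′ , e′) =
    i′ ∘ʰ i , r ∘ʰ r′ , λ x → transᴹ L (cong-h r (e′ _)) (e x)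

  ≅⇒◁ : {M N : RightModule R ℓ ℓ} → M ≅ N → M ◁ N
  ≅⇒◁ e = proj₁ e , inverse e , inverseˡ e

  ⊕-inj₂ : (M N : RightModule R ℓ ℓ) → Hom N (M ⊕ N)
  ⊕-inj₂ M N = mkHom (λ y → M.0ᴹ , y) (λ e → M.≈ᴹ-refl , e)
    (λ _ _ → M.≈ᴹ-sym (M.+ᴹ-identityˡ _) , N.≈ᴹ-refl)
    (λ r _ → M.≈ᴹ-sym (M.*ᵣ-zeroˡ r) , N.≈ᴹ-refl)
    where
    module M = RightModule M
    module N = RightModule N

  ⊕-proj₁ : (M N : RightModule R ℓ ℓ) → Hom (M ⊕ N) M
  ⊕-proj₁ M N = mkHom proj₁ proj₁ (λ _ _ → M.≈ᴹ-refl) (λ _ _ → M.≈ᴹ-refl)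
    where module M = RightModule M

  ⊕-◁₁ : {M N : RightModule R ℓ ℓ} → M ◁ M ⊕ N
  ⊕-◁₁ {M} {N} = ⊕-inj₁ M N , ⊕-proj₁ M N , λ _ → reflᴹ M

  ⊕-◁₂ : {M N : RightModule R ℓ ℓ} → N ◁ M ⊕ N
  ⊕-◁₂ {M} {N} = ⊕-inj₂ M N , ⊕-proj₂ M N , λ _ → reflᴹ N

  [_,_]ʰ : {L M N : RightModule R ℓ ℓ} → Hom L N → Hom M N → Hom (L ⊕ M) N
  [_,_]ʰ {L} {M} f g = f ∘ʰ ⊕-proj₁ L M +ʰ g ∘ʰ ⊕-proj₂ L M

  ⟨_,_⟩ʰ : {L M N : RightModule R ℓ ℓ} → Hom L M → Hom L N → Hom L (M ⊕ N)
  ⟨ f , g ⟩ʰ = mkHom (λ x → f ⟨ x ⟩ , g ⟨ x ⟩) (λ e → cong-h f e , cong-h g e)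
    (λ _ _ → Hom.+ᴹ-homo f _ _ , Hom.+ᴹ-homo g _ _)
    (λ _ _ → Hom.*ᵣ-homo f _ _ , Hom.*ᵣ-homo g _ _)

  ⊕-split : {M N L : RightModule R ℓ ℓ} (f : Hom (M ⊕ N) L) → ∀ x y →
    L ∋ f ⟨ x , y ⟩ ≈ RightModule._+ᴹ_ L (f ⟨ x , zeroᴹ N ⟩) (f ⟨ zeroᴹ M , y ⟩)
  ⊕-split {M} {N} {L} f x y = L.≈ᴹ-trans
    (cong-h f (M.≈ᴹ-sym (M.+ᴹ-identityʳ x) , N.≈ᴹ-sym (N.+ᴹ-identityˡ y)))
    (Hom.+ᴹ-homo f _ _)
    where
    module L = RightModule L
    module M = RightModule M
    module N = RightModule N

  ⊕-map-◁ : {M N M′ N′ : RightModule R ℓ ℓ} → M ◁ M′ → N ◁ N′ → M ⊕ N ◁ M′ ⊕ N′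
  ⊕-map-◁ {M} {N} {M′} {N′} (i , r , e) (i′ , r′ , e′) =
    ⟨ i ∘ʰ ⊕-proj₁ M N , i′ ∘ʰ ⊕-proj₂ M N ⟩ʰ , ⟨ r ∘ʰ ⊕-proj₁ M′ N′ , r′ ∘ʰ ⊕-proj₂ M′ N′ ⟩ʰ ,
    λ (x , y) → e x , e′ y

  Zero : RightModule R ℓ ℓ
  Zero = ZeroModule.rightModule

  module _ {L M : RightModule R ℓ ℓ} (f : Hom L M) where
    private
      module L = ModuleOps L
      module M = ModuleOps M

    Coker : RightModule R ℓ ℓ
    Coker = record
      { Carrierᴹ = M.Carrierᴹ
      ; _≈ᴹ_ = _≋_
      ; _+ᴹ_ = M._+ᴹ_
      ; _*ᵣ_ = M._*ᵣ_
      ; 0ᴹ = M.0ᴹ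
      ; -ᴹ_ = M.-ᴹ_
      ; isRightModule = record
        { isRightSemimodule = record
          { +ᴹ-isCommutativeMonoid = record
            { isMonoid = record
              { isSemigroup = record
                { isMagma = record
                  { isEquivalence = record
                    { refl = ↑ M.≈ᴹ-refl ; sym = ≋-sym ; trans = ≋-trans }
                  ; ∙-cong = ≋-+
                  }
                ; assoc = λ x y z → ↑ (M.+ᴹ-assoc x y z)
                }
              ; identity = (λ x → ↑ (M.+ᴹ-identityˡ x)) , (λ x → ↑ (M.+ᴹ-identityʳ x))
              }
            ; comm = λ x y → ↑ (M.+ᴹ-comm x y)
            }
          ; isPrerightSemimodule = record
            { *ᵣ-cong      = ≋-*
            ; *ᵣ-zeroʳ     = λ x → ↑ (M.*ᵣ-zeroʳ x)
            ; *ᵣ-distribˡ  = λ x r s → ↑ (M.*ᵣ-distribˡ x r s)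
            ; *ᵣ-identityʳ = λ x → ↑ (M.*ᵣ-identityʳ x)
            ; *ᵣ-assoc     = λ x r s → ↑ (M.*ᵣ-assoc x r s)
            ; *ᵣ-zeroˡ     = λ r → ↑ (M.*ᵣ-zeroˡ r)
            ; *ᵣ-distribʳ  = λ r x y → ↑ (M.*ᵣ-distribʳ r x y)
            }
          }
        ; -ᴹ‿cong    = ≋-neg
        ; -ᴹ‿inverse = (λ x → ↑ (M.-ᴹ‿inverseˡ x)) , (λ x → ↑ (M.-ᴹ‿inverseʳ x))
        }
      }
      where
      infix 4 _≋_
      _≋_ : M.Carrierᴹ → M.Carrierᴹ → Set _
      x ≋ y = ∃ λ z → x M.≈ᴹ f ⟨ z ⟩ M.+ᴹ y

      ↑ : ∀ {x y} → x M.≈ᴹ y → x ≋ y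
      ↑ {x} {y} e = L.0ᴹ , M.≈ᴹ-trans e (M.≈ᴹ-sym
        (M.≈ᴹ-trans (M.+ᴹ-congʳ (Hom.0ᴹ-homo f)) (M.+ᴹ-identityˡ y)))

      ≋-sym : ∀ {x y} → x ≋ y → y ≋ x
      ≋-sym {x} {y} (z , e) = L.-ᴹ z , (M.begin
        y                                         M.≈⟨ M.+ᴹ-identityˡ y ⟨
        M.0ᴹ M.+ᴹ y                               M.≈⟨ M.+ᴹ-congʳ (M.-ᴹ‿inverseˡ (f ⟨ z ⟩)) ⟨
        (M.-ᴹ (f ⟨ z ⟩) M.+ᴹ f ⟨ z ⟩) M.+ᴹ y      M.≈⟨ M.+ᴹ-assoc _ _ _ ⟩
        M.-ᴹ (f ⟨ z ⟩) M.+ᴹ (f ⟨ z ⟩ M.+ᴹ y)      M.≈⟨ M.+ᴹ-cong (Hom.-ᴹ-homo f z) e ⟨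
        f ⟨ L.-ᴹ z ⟩ M.+ᴹ x                       M.∎)

      ≋-trans : ∀ {x y z} → x ≋ y → y ≋ z → x ≋ z
      ≋-trans (u , d) (v , e) = u L.+ᴹ v , M.≈ᴹ-trans d (M.≈ᴹ-trans (M.+ᴹ-congˡ e)
        (M.≈ᴹ-trans (M.≈ᴹ-sym (M.+ᴹ-assoc _ _ _)) (M.+ᴹ-congʳ (M.≈ᴹ-sym (Hom.+ᴹ-homo f u v)))))

      ≋-+ : ∀ {x y u v} → x ≋ y → u ≋ v → x M.+ᴹ u ≋ y M.+ᴹ v
      ≋-+ (a , d) (b , e) = a L.+ᴹ b , M.≈ᴹ-trans (M.+ᴹ-cong d e)
        (M.≈ᴹ-trans (M.interchange _ _ _ _) (M.+ᴹ-congʳ (M.≈ᴹ-sym (Hom.+ᴹ-homo f a b))))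

      ≋-* : ∀ {x y r s} → x ≋ y → r R.≈ s → x M.*ᵣ r ≋ y M.*ᵣ s
      ≋-* {r = r} {s} (z , e) d = z L.*ᵣ s , M.≈ᴹ-trans (M.*ᵣ-cong e d)
        (M.≈ᴹ-trans (M.*ᵣ-distribʳ _ _ _) (M.+ᴹ-congʳ (M.≈ᴹ-sym (Hom.*ᵣ-homo f s z))))

      ≋-neg : ∀ {x y} → x ≋ y → M.-ᴹ x ≋ M.-ᴹ y
      ≋-neg (z , e) = L.-ᴹ z , M.≈ᴹ-trans (M.-ᴹ‿cong e)
        (M.≈ᴹ-trans (M.≈ᴹ-sym (M.⁻¹-∙-comm _ _)) (M.+ᴹ-congʳ (M.≈ᴹ-sym (Hom.-ᴹ-homo f z))))

    coker : Hom M Coker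
    coker = mkHom (λ x → x)
      (λ e → L.0ᴹ , M.≈ᴹ-trans e (M.≈ᴹ-sym
        (M.≈ᴹ-trans (M.+ᴹ-congʳ (Hom.0ᴹ-homo f)) (M.+ᴹ-identityˡ _))))
      (λ x y → reflᴹ Coker)
      (λ r x → reflᴹ Coker)

    coker-surjective : Surjective coker
    coker-surjective y = y , reflᴹ Coker

    coker-∘ : ∀ z → coker ⟨ f ⟨ z ⟩ ⟩≈0
    coker-∘ z = z , M.≈ᴹ-sym (M.+ᴹ-identityʳ _)

    coker-exact : ∀ x → coker ⟨ x ⟩≈0 → ∃ λ z → f ⟨ z ⟩ M.≈ᴹ x
    coker-exact x (z , e) = z , M.≈ᴹ-sym (M.≈ᴹ-trans e (M.+ᴹ-identityʳ _))

module LinearAlgebra {ℓ} (k : Field ℓ) where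
  private module k = Field k

  Space : Set (lsuc ℓ)
  Space = RightModule k.ring ℓ ℓ

  K¹ : Space
  K¹ = Regular.rightModule {R = k.ring}

  Dim : Space → ℕ → Set ℓ
  Dim V zero    = IsZero V
  Dim V (suc n) = Σ (Hom V K¹) λ g → Σ (El V) λ v → (g ⟨ v ⟩ k.≈ k.1#) × Dim (Kernel g) n

  Dim-≅ : ∀ {n} {V W : Space} → V ≅ W → Dim V n → Dim W n
  Dim-≅ {zero} e d = ≅-zero e d
  Dim-≅ {suc n} {V} {W} e (g , v , gv , d) =
    g ∘ʰ inverse e , proj₁ e ⟨ v ⟩ , k.trans (cong-h g (inverseˡ e v)) gv ,
    Dim-≅ (Kernel-cong g (g ∘ʰ inverse e) (proj₁ e) (inverse e) (inverseˡ e) (inverseʳ e)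
      (λ x p → k.trans (cong-h g (inverseˡ e x)) p) (λ y p → p)) d

  invert : ∀ {c} → ¬ c k.≈ k.0# → ∃ λ d → c k.* d k.≈ k.1#
  invert {c} c≉0 with k.zero-or-invertible c
  ... | inj₁ c≈0 = ⊥-elim (c≉0 c≈0)
  ... | inj₂ d   = d

  module _ {V : Space} where
    private module V = ModuleOps V

    module Split (g : Hom V K¹) (v : V.Carrierᴹ) (gv : g ⟨ v ⟩ k.≈ k.1#) where
      component : Hom V V
      component = mkHom (λ x → v V.*ᵣ g ⟨ x ⟩) (λ e → V.*ᵣ-congˡ (cong-h g e))
        (λ x y → V.≈ᴹ-trans (V.*ᵣ-congˡ (Hom.+ᴹ-homo g x y)) (V.*ᵣ-distribˡ _ _ _))
        (λ r x → V.≈ᴹ-trans (V.*ᵣ-congˡ (Hom.*ᵣ-homo g r x)) (V.≈ᴹ-sym (V.*ᵣ-assoc _ _ _)))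

      g-component : ∀ x → g ⟨ component ⟨ x ⟩ ⟩ k.≈ g ⟨ x ⟩
      g-component x = k.trans (Hom.*ᵣ-homo g _ _) (k.trans (k.*-congʳ gv) (k.*-identityˡ _))

      project : Hom V (Kernel g)
      project = mkHom
        (λ x → x V.⊖ component ⟨ x ⟩ ,
          k.trans (⊖-homo g _ _) (ModuleOps.≈⇒⊖≈0 K¹ (k.sym (g-component x))))
        (cong-h p) (Hom.+ᴹ-homo p) (Hom.*ᵣ-homo p)
        where
        p : Hom V V
        p = idʰ -ʰ component

      project-ker : ∀ x → g ⟨ x ⟩≈0 → V ∋ proj₁ (project ⟨ x ⟩) ≈ x
      project-ker x p = V.≈ᴹ-trans
        (V.⊖-cong V.≈ᴹ-refl (V.≈ᴹ-trans (V.*ᵣ-congˡ p) (V.*ᵣ-zeroʳ v))) (V.⊖-identityʳ x)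

      decompose : {W : Space} (f : Hom V W) → ∀ x →
        W ∋ f ⟨ x ⟩ ≈ RightModule._+ᴹ_ W (f ⟨ proj₁ (project ⟨ x ⟩) ⟩) (RightModule._*ᵣ_ W (f ⟨ v ⟩) (g ⟨ x ⟩))
      decompose {W} f x = W.≈ᴹ-trans (cong-h f (V.≈ᴹ-sym (V.⊖-+ x _)))
        (W.≈ᴹ-trans (Hom.+ᴹ-homo f _ _) (W.+ᴹ-congˡ (Hom.*ᵣ-homo f _ _)))
        where module W = RightModule W

    normalise : (g : Hom V K¹) → ∀ x → ¬ g ⟨ x ⟩≈0 → ∃ λ v → g ⟨ v ⟩ k.≈ k.1#
    normalise g x gx≉0 = let d , e = invert gx≉0 in x V.*ᵣ d , k.trans (Hom.*ᵣ-homo g _ _) e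

    scale : (g : Hom V K¹) → ∀ x → ¬ g ⟨ x ⟩≈0 → ∃ λ (χ : Hom V K¹) → χ ⟨ x ⟩ k.≈ k.1#
    scale g x gx≉0 = let d , e = invert gx≉0 in
      mkHom (λ y → d k.* g ⟨ y ⟩) (λ e → k.*-congˡ (cong-h g e))
        (λ y z → k.trans (k.*-congˡ (Hom.+ᴹ-homo g y z)) (k.distribˡ _ _ _))
        (λ r y → k.trans (k.*-congˡ (Hom.*ᵣ-homo g r y)) (k.sym (k.*-assoc _ _ _))) ,
      k.trans (k.*-comm _ _) e

    1≉0-value : (g : Hom V K¹) → ∀ {v} → g ⟨ v ⟩ k.≈ k.1# → ¬ V ∋ v ≈ V.0ᴹ
    1≉0-value g gv v≈0 = k.1≉0 (k.trans (k.sym gv) (k.trans (cong-h g v≈0) (Hom.0ᴹ-homo g)))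

  k-zero? : ∀ c → (c k.≈ k.0#) ⊎ (¬ c k.≈ k.0#)
  k-zero? c with k.zero-or-invertible c
  ... | inj₁ e = inj₁ e
  ... | inj₂ (d , e) = inj₂ λ c≈0 → k.1≉0
    (k.trans (k.sym e) (k.trans (k.*-congʳ c≈0) (k.zeroˡ d)))

  functional-zero? : ∀ {n} {V : Space} → Dim V n → (g : Hom V K¹) →
    IsZeroHom g ⊎ ∃ λ v → g ⟨ v ⟩ k.≈ k.1#
  functional-zero? {zero} d g = inj₁ λ x → k.trans (cong-h g (d x)) (Hom.0ᴹ-homo g)
  functional-zero? {suc n} {V} (h , w , hw , d) g with k-zero? (g ⟨ w ⟩)
  ... | inj₂ gw≉0 = inj₂ (normalise g w gw≉0)
  ... | inj₁ gw≈0 with functional-zero? d (g ∘ʰ Kernel-incl h)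
  ...   | inj₂ ((v , _) , e) = inj₂ (v , e)
  ...   | inj₁ z = inj₁ λ x → k.trans (decompose g x)
            (k.trans (k.+-cong (z (project ⟨ x ⟩)) (k.trans (k.*-congʳ gw≈0) (k.zeroˡ _))) (k.+-identityˡ _))
    where open Split h w hw

  zero-or-detected : ∀ {n} {V : Space} → Dim V n → ∀ x →
    V ∋ x ≈ zeroᴹ V ⊎ ∃ λ (χ : Hom V K¹) → χ ⟨ x ⟩ k.≈ k.1#
  zero-or-detected {zero} d x = inj₁ (d x)
  zero-or-detected {suc n} {V} (g , v , gv , d) x with k-zero? (g ⟨ x ⟩)
  ... | inj₂ gx≉0 = inj₂ (scale g x gx≉0)
  ... | inj₁ gx≈0 with zero-or-detected d (x , gx≈0)
  ...   | inj₁ x≈0 = inj₁ x≈0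
  ...   | inj₂ (χ , e) = inj₂ (χ ∘ʰ project ,
            k.trans (cong-h χ {project ⟨ x ⟩} {x , gx≈0} (project-ker x gx≈0)) e)
    where open Split g v gv

  Dim-drop : ∀ {n} {V : Space} → Dim V (suc n) → (g : Hom V K¹) → ∀ {v} → g ⟨ v ⟩ k.≈ k.1# → Dim (Kernel g) n
  Dim-drop {n} {V} (h , w , hw , d) g {v} gv with functional-zero? d (g ∘ʰ Kernel-incl h)
  ... | inj₁ z = Dim-≅ (Kernel-cong h g idʰ idʰ (λ _ → V.≈ᴹ-refl) (λ _ → V.≈ᴹ-refl)
          (λ x p → z (x , p)) (λ x p → to x p)) d
    where
    module V = ModuleOps V
    open Split h w hw
    g-scaled : ∀ x → g ⟨ x ⟩ k.≈ g ⟨ w ⟩ k.* h ⟨ x ⟩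
    g-scaled x = k.trans (decompose g x) (k.trans (k.+-congʳ (z (project ⟨ x ⟩))) (k.+-identityˡ _))
    to : ∀ x → g ⟨ x ⟩≈0 → h ⟨ x ⟩≈0
    to x p = k.trans (k.sym (k.*-identityˡ _)) (k.trans (k.*-congʳ (k.trans (k.sym gv)
      (k.trans (g-scaled v) (k.*-comm _ _))))
      (k.trans (k.*-assoc _ _ _) (k.trans (k.*-congˡ (k.trans (k.sym (g-scaled x)) p)) (k.zeroʳ _))))
  Dim-drop {zero} {V} (h , w , hw , d) g gv | inj₂ ((u , hu) , gu) = ⊥-elim (1≉0-value {V = V} g gu (d (u , hu)))
  Dim-drop {suc n} {V} (h , w , hw , d) g gv | inj₂ ((u , hu) , gu) =
    h ∘ʰ Kernel-incl g , project ⟨ w ⟩ ,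
    k.trans (⊖-homo h _ _) (k.trans (ModuleOps.⊖-cong K¹ hw (k.trans (Hom.*ᵣ-homo h _ _)
      (k.trans (k.*-congʳ hu) (k.zeroˡ _)))) (ModuleOps.⊖-identityʳ K¹ _)) ,
    Dim-≅ (mkHom (λ ((x , p) , q) → (x , q) , p) (λ e → e) (λ _ _ → V.≈ᴹ-refl) (λ _ _ → V.≈ᴹ-refl) ,
           (λ e → e) , λ ((x , q) , p) → ((x , p) , q) , V.≈ᴹ-refl)
      (Dim-drop d (g ∘ʰ Kernel-incl h) {u , hu} gu)
    where
    module V = ModuleOps V
    open Split g u gu

  Dim-unique : ∀ {m n} {V : Space} → Dim V m → Dim V n → m ≡ n
  Dim-unique {zero} {zero} _ _ = refl
  Dim-unique {zero} {suc n} {V} d (g , v , gv , _) = ⊥-elim (1≉0-value {V = V} g gv (d v))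
  Dim-unique {suc m} {zero} {V} (g , v , gv , _) d = ⊥-elim (1≉0-value {V = V} g gv (d v))
  Dim-unique {suc m} {suc n} (g , v , gv , d) d′ = cong suc (Dim-unique d (Dim-drop d′ g gv))

  module _ {U W : Space} (i : Hom U W) (h : Hom W K¹) where
    private
      module U = ModuleOps U
      module W = ModuleOps W

    restrict-ker : Hom (Kernel (h ∘ʰ i)) (Kernel h)
    restrict-ker = mkHom (λ (x , p) → i ⟨ x ⟩ , p) (cong-h i) (λ _ _ → Hom.+ᴹ-homo i _ _) (λ _ _ → Hom.*ᵣ-homo i _ _)

    corestrict-ker : IsZeroHom (h ∘ʰ i) → Hom U (Kernel h)
    corestrict-ker z = mkHom (λ x → i ⟨ x ⟩ , z x) (cong-h i) (λ _ _ → Hom.+ᴹ-homo i _ _) (λ _ _ → Hom.*ᵣ-homo i _ _)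

  injective⇒≤ : ∀ {m n} {U W : Space} → Dim U m → Dim W n → (i : Hom U W) → Injective i → m ℕ.≤ n
  injective⇒≤ {zero} _ _ _ _ = z≤n
  injective⇒≤ {suc m} {zero} {U} {W} (g , v , gv , _) d i inj =
    ⊥-elim (1≉0-value {V = U} g gv (injective⇒ker≈0 i inj v (d _)))
  injective⇒≤ {suc m} {suc n} {U} dU (h , w , hw , d) i inj with functional-zero? dU (h ∘ʰ i)
  ... | inj₁ z = ℕₚ.m≤n⇒m≤1+n (injective⇒≤ dU d (corestrict-ker i h z) inj)
  ... | inj₂ (u , hu) = s≤s (injective⇒≤ (Dim-drop dU (h ∘ʰ i) hu) d (restrict-ker i h) inj)

  injective⇒surjective : ∀ {n} {U W : Space} → Dim U n → Dim W n → (i : Hom U W) → Injective i → Surjective i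
  injective⇒surjective {zero} {U} {W} dU dW i inj y = zeroᴹ U ,
    transᴹ W (dW _) (symᴹ W (dW _))
  injective⇒surjective {suc n} {U} {W} dU (h , w , hw , d) i inj y with functional-zero? dU (h ∘ʰ i)
  ... | inj₁ z = ⊥-elim (ℕₚ.<-irrefl refl (injective⇒≤ dU d (corestrict-ker i h z) inj))
  ... | inj₂ (u , hu) =
    let (x , _) , e = injective⇒surjective (Dim-drop dU (h ∘ʰ i) hu) d (restrict-ker i h) inj (project ⟨ y ⟩)
    in x U.+ᴹ u U.*ᵣ h ⟨ y ⟩ , W.≈ᴹ-trans (Hom.+ᴹ-homo i _ _)
      (W.≈ᴹ-trans (W.+ᴹ-cong e (Hom.*ᵣ-homo i _ _)) (W.⊖-+ y _))
    where
    module U = ModuleOps U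
    module W = ModuleOps W
    open Split h (i ⟨ u ⟩) hu

  abstract
    Dim-exact : ∀ {m n} {A B C : Space} (i : Hom A B) (p : Hom B C) → Injective i → Surjective p →
      IsZeroHom (p ∘ʰ i) → (∀ y → p ⟨ y ⟩≈0 → ∃ λ x → B ∋ i ⟨ x ⟩ ≈ y) →
      Dim A m → Dim C n → Dim B (n ℕ.+ m)
    Dim-exact {n = zero} i p i-inj p-surj pi≈0 ker dA dC = Dim-≅ (i , i-inj , λ y → ker y (dC _)) dA
    Dim-exact {n = suc n} {A} {B} {C} i p i-inj p-surj pi≈0 ker dA (g , c , gc , dC) =
      g ∘ʰ p , proj₁ (p-surj c) , k.trans (cong-h g (proj₂ (p-surj c))) gc ,
      Dim-exact (corestrict-ker i (g ∘ʰ p) gpi) (restrict-ker p g) i-inj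
        (λ (y , e) → let b , q = p-surj y in (b , k.trans (cong-h g q) e) , q)
        pi≈0 (λ (y , _) → ker y) dA dC
      where
      gpi : IsZeroHom ((g ∘ʰ p) ∘ʰ i)
      gpi x = k.trans (cong-h g (pi≈0 x)) (Hom.0ᴹ-homo g)

  Dim-⊕ : ∀ {m n} {A C : Space} → Dim A m → Dim C n → Dim (A ⊕ C) (n ℕ.+ m)
  Dim-⊕ {A = A} {C} = Dim-exact (⊕-inj₁ A C) (⊕-proj₂ A C) proj₁
    (λ y → (A.0ᴹ , y) , C.≈ᴹ-refl) (λ _ → C.≈ᴹ-refl)
    (λ (x , y) e → x , A.≈ᴹ-refl , C.≈ᴹ-sym e)
    where
    module A = RightModule A
    module C = RightModule C

  abstract
    Dim-Kernel : ∀ {m n} {V W : Space} → Dim V m → Dim W n → (A : Hom V W) → ∃ (Dim (Kernel A))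
    Dim-Kernel {m} {zero} {V} dV dW A = m , Dim-≅ (≅-sym (Kernel-incl A , (λ e → e) , λ x → (x , dW _) , reflᴹ V)) dV
    Dim-Kernel {m} {suc n} {V} dV (h , w , hw , d) A with functional-zero? dV (h ∘ʰ A)
    ... | inj₁ z = let r , D = Dim-Kernel dV d (corestrict-ker A h z) in
      r , Dim-≅ (Kernel-cong (corestrict-ker A h z) A idʰ idʰ (λ _ → reflᴹ V) (λ _ → reflᴹ V)
        (λ _ p → p) (λ _ p → p)) D
    Dim-Kernel {zero} {suc n} {V} dV (h , w , hw , d) A | inj₂ (u , hu) = ⊥-elim (1≉0-value {V = V} (h ∘ʰ A) hu (dV u))
    Dim-Kernel {suc m} {suc n} {V} {W} dV (h , w , hw , d) A | inj₂ (u , hu) =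
      let r , D = Dim-Kernel (Dim-drop dV (h ∘ʰ A) hu) d (restrict-ker A h) in
      r , Dim-≅ (mkHom (λ ((x , _) , q) → x , q) (λ e → e) (λ _ _ → V.≈ᴹ-refl) (λ _ _ → V.≈ᴹ-refl) , (λ e → e) ,
        λ (x , q) → ((x , k.trans (cong-h h q) (Hom.0ᴹ-homo h)) , q) , V.≈ᴹ-refl) D
      where
      module V = RightModule V

  hom-zero? : ∀ {m n} {V W : Space} → Dim V m → Dim W n → (f : Hom V W) →
    IsZeroHom f ⊎ ∃₂ λ x (χ : Hom W K¹) → χ ⟨ f ⟨ x ⟩ ⟩ k.≈ k.1#
  hom-zero? {zero} {W = W} dV dW f = inj₁ λ x → transᴹ W (cong-h f (dV x)) (Hom.0ᴹ-homo f)
  hom-zero? {suc m} {W = W} (g , v , gv , dV) dW f with zero-or-detected dW (f ⟨ v ⟩)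
  ... | inj₂ (χ , e) = inj₂ (v , χ , e)
  ... | inj₁ fv≈0 with hom-zero? dV dW (f ∘ʰ Kernel-incl g)
  ...   | inj₂ ((x , _) , χ , e) = inj₂ (x , χ , e)
  ...   | inj₁ z = inj₁ λ x → W.≈ᴹ-trans (decompose f x) (W.≈ᴹ-trans
            (W.+ᴹ-cong (z (project ⟨ x ⟩)) (W.≈ᴹ-trans (W.*ᵣ-congʳ fv≈0) (W.*ᵣ-zeroˡ _))) (W.+ᴹ-identityˡ _))
    where
    open Split g v gv
    module W = RightModule W

  abstract
    Dim-cokernel : ∀ {l m} {U V C : Space} → Dim U l → Dim V m → (f : Hom U V) (p : Hom V C) →
      Surjective p → IsZeroHom (p ∘ʰ f) → (∀ y → p ⟨ y ⟩≈0 → ∃ λ x → V ∋ f ⟨ x ⟩ ≈ y) → ∃ (Dim C)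
    Dim-cokernel {l} {m} {U} {V} {C} dU dV f p p-surj pf≈0 ker with hom-zero? dU dV f
    ... | inj₁ z = m , Dim-≅ (p , ker≈0⇒injective p (λ y e → let x , q = ker y e in
            transᴹ V (symᴹ V q) (z x)) , p-surj) dV
    Dim-cokernel {m = zero} {U} {V} dU dV f p p-surj pf≈0 ker | inj₂ (x , χ , χfx) =
      ⊥-elim (1≉0-value {V = V} χ χfx (dV _))
    Dim-cokernel {l = zero} {U = U} dU dV f p p-surj pf≈0 ker | inj₂ (x , χ , χfx) =
      ⊥-elim (1≉0-value {V = U} (χ ∘ʰ f) χfx (dU _))
    Dim-cokernel {suc l} {suc m} {U} {V} {C} dU dV f p p-surj pf≈0 ker | inj₂ (x , χ , χfx) =
      Dim-cokernel (Dim-drop dU (χ ∘ʰ f) χfx) (Dim-drop dV χ χfx) (restrict-ker f χ) (p ∘ʰ Kernel-incl χ)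
        (λ y → let v , e = p-surj y in project ⟨ v ⟩ , C.≈ᴹ-trans (⊖-homo p _ _)
          (C.≈ᴹ-trans (C.⊖-cong e (C.≈ᴹ-trans (Hom.*ᵣ-homo p _ _) (C.≈ᴹ-trans (C.*ᵣ-congʳ (pf≈0 x)) (C.*ᵣ-zeroˡ _))))
            (C.⊖-identityʳ y)))
        (λ (u , _) → pf≈0 u)
        (λ (y , q) e → let u , e′ = ker y e in (u , k.trans (cong-h χ e′) q) , e′)
      where
      module C = ModuleOps C
      open Split χ (f ⟨ x ⟩) χfx

  -- Gaussian elimination, one generator of V at a time.
  solve : ∀ {m n} {V W : Space} → Dim V m → Dim W n → (A : Hom V W) → ∀ w →
    (∃ λ x → W ∋ A ⟨ x ⟩ ≈ w) ⊎ ∃ λ (ψ : Hom W K¹) → IsZeroHom (ψ ∘ʰ A) × (ψ ⟨ w ⟩ k.≈ k.1#)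
  solve {zero} {V = V} {W} dV dW A w with zero-or-detected dW w
  ... | inj₁ w≈0 = inj₁ (zeroᴹ V , transᴹ W (Hom.0ᴹ-homo A) (symᴹ W w≈0))
  ... | inj₂ (χ , e) = inj₂ (χ , (λ x → k.trans (cong-h (χ ∘ʰ A) (dV x)) (Hom.0ᴹ-homo (χ ∘ʰ A))) , e)
  solve {suc m} {V = V} {W} (g , v , gv , dV) dW A w with zero-or-detected dW (A ⟨ v ⟩)
  ... | inj₁ Av≈0 = case (solve dV dW (A ∘ʰ Kernel-incl g) w)
    where
    module W = ModuleOps W
    open Split g v gv
    case : _ → _
    case (inj₁ ((x , _) , e)) = inj₁ (x , e)
    case (inj₂ (ψ , z , e)) = inj₂ (ψ , (λ x → k.trans (decompose (ψ ∘ʰ A) x)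
      (k.trans (k.+-cong (z (project ⟨ x ⟩)) (k.trans (k.*-congʳ (k.trans (cong-h ψ Av≈0) (Hom.0ᴹ-homo ψ))) (k.zeroˡ _)))
        (k.+-identityˡ _))) , e)
  ... | inj₂ (χ , χAv) = case (solve dV dW (P ∘ʰ A ∘ʰ Kernel-incl g) (P ⟨ w ⟩))
    where
    module V = ModuleOps V
    module W = ModuleOps W
    module g = Split g v gv
    open Split χ (A ⟨ v ⟩) χAv
    P : Hom W W
    P = Kernel-incl χ ∘ʰ project
    PAv : W ∋ P ⟨ A ⟨ v ⟩ ⟩ ≈ W.0ᴹ
    PAv = W.≈⇒⊖≈0 (W.≈ᴹ-sym (W.≈ᴹ-trans (W.*ᵣ-congˡ χAv) (W.*ᵣ-identityʳ _)))
    case : _ → _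
    case (inj₁ ((x , _) , e)) = inj₁ (x V.+ᴹ v V.*ᵣ (χ ⟨ w ⟩ k.- χ ⟨ A ⟨ x ⟩ ⟩) , W.⊖≈0⇒≈ (W.begin
      A ⟨ x V.+ᴹ v V.*ᵣ c ⟩ W.⊖ w
        W.≈⟨ W.⊖-cong (W.≈ᴹ-trans (Hom.+ᴹ-homo A _ _) (W.+ᴹ-congˡ (Hom.*ᵣ-homo A _ _))) W.≈ᴹ-refl ⟩
      (A ⟨ x ⟩ W.+ᴹ A ⟨ v ⟩ W.*ᵣ c) W.⊖ w
        W.≈⟨ W.⊖-cong (W.≈ᴹ-sym (decompose idʰ _)) (W.≈ᴹ-sym (decompose idʰ w)) ⟨
      (P ⟨ A ⟨ x ⟩ W.+ᴹ A ⟨ v ⟩ W.*ᵣ c ⟩ W.+ᴹ A ⟨ v ⟩ W.*ᵣ χ ⟨ A ⟨ x ⟩ W.+ᴹ A ⟨ v ⟩ W.*ᵣ c ⟩) W.⊖ (P ⟨ w ⟩ W.+ᴹ A ⟨ v ⟩ W.*ᵣ χ ⟨ w ⟩)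
        W.≈⟨ W.⊖-cong (W.+ᴹ-cong Pe (W.*ᵣ-congˡ χe)) W.≈ᴹ-refl ⟩
      (P ⟨ w ⟩ W.+ᴹ A ⟨ v ⟩ W.*ᵣ χ ⟨ w ⟩) W.⊖ (P ⟨ w ⟩ W.+ᴹ A ⟨ v ⟩ W.*ᵣ χ ⟨ w ⟩)
        W.≈⟨ W.⊖-inverse _ ⟩
      W.0ᴹ W.∎))
      where
      c = χ ⟨ w ⟩ k.- χ ⟨ A ⟨ x ⟩ ⟩
      Pe : W ∋ P ⟨ A ⟨ x ⟩ W.+ᴹ A ⟨ v ⟩ W.*ᵣ c ⟩ ≈ P ⟨ w ⟩
      Pe = W.≈ᴹ-trans (Hom.+ᴹ-homo P _ _) (W.≈ᴹ-trans (W.+ᴹ-cong e (W.≈ᴹ-trans (Hom.*ᵣ-homo P _ _)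
        (W.≈ᴹ-trans (W.*ᵣ-congʳ PAv) (W.*ᵣ-zeroˡ c)))) (W.+ᴹ-identityʳ _))
      χe : χ ⟨ A ⟨ x ⟩ W.+ᴹ A ⟨ v ⟩ W.*ᵣ c ⟩ k.≈ χ ⟨ w ⟩
      χe = k.trans (Hom.+ᴹ-homo χ _ _) (k.trans (k.+-congˡ (k.trans (Hom.*ᵣ-homo χ _ _)
        (k.trans (k.*-congʳ χAv) (k.*-identityˡ _)))) (k.trans (k.+-comm _ _) (ModuleOps.⊖-+ K¹ _ _)))
    case (inj₂ (ψ , z , e)) = inj₂ (ψ ∘ʰ P , (λ x → k.trans (g.decompose (ψ ∘ʰ P ∘ʰ A) x)
      (k.trans (k.+-cong (z (g.project ⟨ x ⟩)) (k.trans (k.*-congʳ (k.trans (cong-h ψ PAv) (Hom.0ᴹ-homo ψ))) (k.zeroˡ _)))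
        (k.+-identityˡ _))) , e)

module Bases {ℓ} (k : Field ℓ) where
  open LinearAlgebra k
  private module k = Field k

  comb : ∀ {n} (V : Space) → (Fin n → El V) → (Fin n → k.Carrier) → El V
  comb V b c = MonoidSum.sum (RightModule.+ᴹ-monoid V) (λ i → RightModule._*ᵣ_ V (b i) (c i))

  module _ (V : Space) where
    private module V = ModuleOps V

    comb-cong : ∀ {n} (b : Fin n → El V) {c d} → (∀ i → c i k.≈ d i) → V ∋ comb V b c ≈ comb V b d
    comb-cong {zero} b e = V.≈ᴹ-refl
    comb-cong {suc n} b e = V.+ᴹ-cong (V.*ᵣ-congˡ (e zero)) (comb-cong (λ i → b (suc i)) (λ i → e (suc i)))

    comb-+ : ∀ {n} (b : Fin n → El V) c d → V ∋ comb V b (λ i → c i k.+ d i) ≈ comb V b c V.+ᴹ comb V b d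
    comb-+ {zero} b c d = V.≈ᴹ-sym (V.+ᴹ-identityˡ _)
    comb-+ {suc n} b c d = V.≈ᴹ-trans (V.+ᴹ-cong (V.*ᵣ-distribˡ _ _ _) (comb-+ (λ i → b (suc i)) _ _)) (V.interchange _ _ _ _)

    comb-* : ∀ {n} (b : Fin n → El V) c r → V ∋ comb V b (λ i → c i k.* r) ≈ comb V b c V.*ᵣ r
    comb-* {zero} b c r = V.≈ᴹ-sym (V.*ᵣ-zeroˡ r)
    comb-* {suc n} b c r = V.≈ᴹ-trans (V.+ᴹ-cong (V.≈ᴹ-sym (V.*ᵣ-assoc _ _ _)) (comb-* (λ i → b (suc i)) _ r))
      (V.≈ᴹ-sym (V.*ᵣ-distribʳ _ _ _))

    comb-0 : ∀ {n} (b : Fin n → El V) → V ∋ comb V b (λ _ → k.0#) ≈ V.0ᴹ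
    comb-0 {zero} b = V.≈ᴹ-refl
    comb-0 {suc n} b = V.≈ᴹ-trans (V.+ᴹ-cong (V.*ᵣ-zeroʳ _) (comb-0 (λ i → b (suc i)))) (V.+ᴹ-identityˡ _)

  comb-hom : ∀ {n} {V W : Space} (f : Hom V W) (b : Fin n → El V) c →
    W ∋ f ⟨ comb V b c ⟩ ≈ comb W (λ i → f ⟨ b i ⟩) c
  comb-hom {zero} f b c = Hom.0ᴹ-homo f
  comb-hom {suc n} {W = W} f b c = W.≈ᴹ-trans (Hom.+ᴹ-homo f _ _)
    (W.+ᴹ-cong (Hom.*ᵣ-homo f _ _) (comb-hom f (λ i → b (suc i)) (λ i → c (suc i))))
    where module W = RightModule W

  basis⇒Dim : ∀ {n} {V : Space} (b : Fin n → El V) →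
    (∀ x → ∃ λ c → V ∋ x ≈ comb V b c) →
    (∀ c → V ∋ comb V b c ≈ zeroᴹ V → ∀ i → c i k.≈ k.0#) → Dim V n
  basis⇒Dim {zero} b span indep x = proj₂ (span x)
  basis⇒Dim {suc n} {V} b span indep = g , b zero , gb , basis⇒Dim b′ span′ indep′
    where
    module V = ModuleOps V
    unique : ∀ c d → V ∋ comb V b c ≈ comb V b d → ∀ i → c i k.≈ d i
    unique c d e i = ModuleOps.⊖≈0⇒≈ K¹ (indep′′ i)
      where
      neg : V ∋ comb V b (λ i → k.- d i) ≈ V.-ᴹ comb V b d
      neg = V.inverseˡ-unique _ _ (V.≈ᴹ-trans (V.≈ᴹ-sym (comb-+ V b (λ i → k.- d i) d))
        (V.≈ᴹ-trans (comb-cong V b {λ i → k.- d i k.+ d i} {λ _ → k.0#} (λ i → k.-‿inverseˡ (d i))) (comb-0 V b)))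
      indep′′ : ∀ i → c i k.- d i k.≈ k.0#
      indep′′ = indep _ (V.≈ᴹ-trans (comb-+ V b c (λ i → k.- d i)) (V.≈ᴹ-trans (V.+ᴹ-congˡ neg) (V.≈⇒⊖≈0 e)))
    coord : El V → k.Carrier
    coord x = proj₁ (span x) zero
    spanned : ∀ x → V ∋ x ≈ comb V b (proj₁ (span x))
    spanned x = proj₂ (span x)
    read : ∀ x c → V ∋ x ≈ comb V b c → coord x k.≈ c zero
    read x c e = unique (proj₁ (span x)) c (V.≈ᴹ-trans (V.≈ᴹ-sym (spanned x)) e) zero
    g : Hom V K¹
    g = mkHom coord
      (λ {x} {y} e → read x (proj₁ (span y)) (V.≈ᴹ-trans e (spanned _)))
      (λ x y → read _ (λ i → proj₁ (span x) i k.+ proj₁ (span y) i)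
        (V.≈ᴹ-trans (V.+ᴹ-cong (spanned x) (spanned y)) (V.≈ᴹ-sym (comb-+ V b (proj₁ (span x)) (proj₁ (span y))))))
      (λ r x → read _ (λ i → proj₁ (span x) i k.* r)
        (V.≈ᴹ-trans (V.*ᵣ-congʳ (spanned x)) (V.≈ᴹ-sym (comb-* V b (proj₁ (span x)) r))))
    tail : Fin n → El V
    tail i = b (suc i)
    gb : g ⟨ b zero ⟩ k.≈ k.1#
    gb = read _ (k.1# ∷ λ _ → k.0#) (V.≈ᴹ-sym (V.≈ᴹ-trans (V.+ᴹ-cong (V.*ᵣ-identityʳ _) (comb-0 V tail)) (V.+ᴹ-identityʳ _)))
    cons-0 : ∀ c → V ∋ comb V b (k.0# ∷ c) ≈ comb V tail c
    cons-0 c = V.≈ᴹ-trans (V.+ᴹ-congʳ (V.*ᵣ-zeroʳ _)) (V.+ᴹ-identityˡ _)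
    unit : ∀ {m} → Fin m → Fin m → k.Carrier
    unit zero    zero    = k.1#
    unit zero    (suc j) = k.0#
    unit (suc i) zero    = k.0#
    unit (suc i) (suc j) = unit i j
    comb-unit : ∀ {m} (a : Fin m → El V) i → V ∋ a i ≈ comb V a (unit i)
    comb-unit a zero = V.≈ᴹ-sym (V.≈ᴹ-trans (V.+ᴹ-cong (V.*ᵣ-identityʳ _) (comb-0 V (λ i → a (suc i)))) (V.+ᴹ-identityʳ _))
    comb-unit a (suc i) = V.≈ᴹ-sym (V.≈ᴹ-trans (V.+ᴹ-congʳ (V.*ᵣ-zeroʳ _))
      (V.≈ᴹ-trans (V.+ᴹ-identityˡ _) (V.≈ᴹ-sym (comb-unit (λ i → a (suc i)) i))))
    b′ : Fin n → El (Kernel g)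
    b′ i = b (suc i) , read _ (k.0# ∷ unit i) (V.≈ᴹ-trans (comb-unit tail i) (V.≈ᴹ-sym (cons-0 (unit i))))
    span′ : ∀ x → ∃ λ c → Kernel g ∋ x ≈ comb (Kernel g) b′ c
    span′ (x , p) = (λ i → proj₁ (span x) (suc i)) , V.≈ᴹ-trans (spanned x)
      (V.≈ᴹ-trans (V.+ᴹ-congʳ (V.≈ᴹ-trans (V.*ᵣ-congˡ p) (V.*ᵣ-zeroʳ _)))
      (V.≈ᴹ-trans (V.+ᴹ-identityˡ _) (V.≈ᴹ-sym (comb-hom (Kernel-incl g) b′ _))))
    indep′ : ∀ c → Kernel g ∋ comb (Kernel g) b′ c ≈ zeroᴹ (Kernel g) → ∀ i → c i k.≈ k.0#
    indep′ c e i = indep (k.0# ∷ c) (V.≈ᴹ-trans (cons-0 c) (V.≈ᴹ-trans (V.≈ᴹ-sym (comb-hom (Kernel-incl g) b′ c)) e)) (suc i)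

  abstract
    FiniteDimensional⇒Dim : {V : Space} (fd : FiniteDimensional k V) → Dim V (proj₁ fd)
    FiniteDimensional⇒Dim (n , b , span , indep) = basis⇒Dim b span indep

  Dim⇒basis : ∀ {n} {V : Space} → Dim V n → FiniteDimensional k V
  Dim⇒basis {zero} d = 0 , (λ ()) , (λ x → (λ ()) , d x) , λ _ _ ()
  Dim⇒basis {suc n} {V} (g , v , gv , d) with Dim⇒basis d
  ... | m , b , span , indep = suc m , basis ,
    (λ x → (g ⟨ x ⟩ ∷ proj₁ (span (project ⟨ x ⟩))) , V.≈ᴹ-trans (decompose idʰ x)
      (V.≈ᴹ-trans (V.+ᴹ-comm _ _) (V.+ᴹ-congˡ (V.≈ᴹ-trans (proj₂ (span (project ⟨ x ⟩))) (comb-hom (Kernel-incl g) b _))))) ,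
    indep′
    where
    module V = ModuleOps V
    open Split g v gv
    basis : Fin (suc m) → El V
    basis = v ∷ λ i → proj₁ (b i)
    module _ (c : Fin (suc m) → k.Carrier) (e : V ∋ comb V basis c ≈ V.0ᴹ) where
      rest = λ i → c (suc i)
      in-ker : V ∋ v V.*ᵣ c zero V.+ᴹ proj₁ (comb (Kernel g) b rest) ≈ V.0ᴹ
      in-ker = V.≈ᴹ-trans (V.+ᴹ-congˡ (comb-hom (Kernel-incl g) b rest)) e
      c₀ : c zero k.≈ k.0#
      c₀ = k.trans (k.sym (k.trans (k.+-cong (k.trans (Hom.*ᵣ-homo g _ _) (k.trans (k.*-congʳ gv) (k.*-identityˡ _)))
        (proj₂ (comb (Kernel g) b rest))) (k.+-identityʳ _)))
        (k.trans (k.sym (Hom.+ᴹ-homo g _ _)) (k.trans (cong-h g in-ker) (Hom.0ᴹ-homo g)))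
      indep′ : ∀ i → c i k.≈ k.0#
      indep′ zero = c₀
      indep′ (suc i) = indep rest (V.≈ᴹ-trans (V.≈ᴹ-sym (V.≈ᴹ-trans (V.+ᴹ-congʳ
        (V.≈ᴹ-trans (V.*ᵣ-congˡ c₀) (V.*ᵣ-zeroʳ _))) (V.+ᴹ-identityˡ _))) in-ker) i

  abstract
    Dim⇒FiniteDimensional : ∀ {n} {V : Space} → Dim V n → FiniteDimensional k V
    Dim⇒FiniteDimensional = Dim⇒basis

minimal : ∀ {a} {A : Set a} (μ : A → ℕ) → A → ¬ ¬ Σ A λ x → ∀ y → μ x ℕ.≤ μ y
minimal {A = A} μ x no-min = below (suc (μ x)) x ℕₚ.≤-refl
  where
  below : ∀ n y → μ y ℕ.< n → ⊥
  below (suc n) y (s≤s y≤n) = no-min (y , least)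
    where
    least : ∀ z → μ y ℕ.≤ μ z
    least z with μ y ℕₚ.≤? μ z
    ... | yes p = p
    ... | no ¬p = ⊥-elim (below n z (ℕₚ.<-≤-trans (ℕₚ.≰⇒> ¬p) y≤n))

module Modules {ℓ} {k : Field ℓ} (Λ : FDAlgebra k) where
  open LinearAlgebra k public
  open Bases k public
  open Mod public
  private
    module k = Field k
    module Λ = FDAlgebra Λ

  Module : Set (lsuc ℓ)
  Module = RightModule Λ.ring ℓ ℓ

  res : Module → Space
  res = restrictʳ {R = k.ring} Λ.ι-isHom

  resʰ : {M N : Module} → Hom M N → Hom (res M) (res N)
  resʰ {M} {N} f = mkHom (Hom.fun f) (Hom.⟦⟧-cong f) (Hom.+ᴹ-homo f) (λ r x → Hom.*ᵣ-homo f (Λ.ι r) x)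

  infix 4 _⟶_
  _⟶_ : Mod Λ → Mod Λ → Set ℓ
  M ⟶ N = Hom (mod M) (mod N)

  dim : Mod Λ → ℕ
  dim M = proj₁ (finiteDimensional M)

  hasDim : (M : Mod Λ) → Dim (res (mod M)) (dim M)
  hasDim M = FiniteDimensional⇒Dim (finiteDimensional M)

  dim-unique : (M : Mod Λ) → ∀ {n} → Dim (res (mod M)) n → dim M ≡ n
  dim-unique M d = Dim-unique (hasDim M) d

  toMod : (M : Module) → ∀ {n} → Dim (res M) n → Mod Λ
  toMod M d = record { mod = M ; finiteDimensional = Dim⇒FiniteDimensional d }

  res-Kernel : {M N : Module} (f : Hom M N) → Kernel (resʰ f) ≅ res (Kernel f)
  res-Kernel {M} f = mkHom (λ x → x) (λ e → e) (λ _ _ → M.≈ᴹ-refl) (λ _ _ → M.≈ᴹ-refl) , (λ e → e) ,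
    λ y → y , M.≈ᴹ-refl
    where module M = RightModule M

  kerMod : {M N : Mod Λ} → M ⟶ N → Mod Λ
  kerMod {M} {N} f = toMod (Kernel f) (Dim-≅ (res-Kernel f) (proj₂ (Dim-Kernel (hasDim M) (hasDim N) (resʰ f))))

  cokMod : {M N : Mod Λ} → M ⟶ N → Mod Λ
  cokMod {M} {N} f = toMod (Coker f) (proj₂ (Dim-cokernel (hasDim M) (hasDim N) (resʰ f) (resʰ (coker f))
    (coker-surjective f) (coker-∘ f) (coker-exact f)))

  coimMod : {M N : Mod Λ} → M ⟶ N → Mod Λ
  coimMod {M} {N} f = cokMod {kerMod {M} {N} f} {M} (Kernel-incl f)

  coim : {M N : Mod Λ} (f : M ⟶ N) → M ⟶ coimMod {M} {N} f
  coim f = coker (Kernel-incl f)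

  coim-ker : {M N : Mod Λ} (f : M ⟶ N) → ∀ x → f ⟨ x ⟩≈0 → coim {M} {N} f ⟨ x ⟩≈0
  coim-ker f x e = coker-∘ (Kernel-incl f) (x , e)

  coim-exact : {M N : Mod Λ} (f : M ⟶ N) → ∀ x → coim {M} {N} f ⟨ x ⟩≈0 → f ⟨ x ⟩≈0
  coim-exact {N = N} f x e = let (z , fz) , q = coker-exact (Kernel-incl f) x e in
    transᴹ (mod N) (symᴹ (mod N) (cong-h f q)) fz

  zeroMod : Mod Λ
  zeroMod = toMod Zero {0} (λ _ → _)

  infixr 6 _⊕ᴹ_
  _⊕ᴹ_ : Mod Λ → Mod Λ → Mod Λ
  M ⊕ᴹ N = toMod (mod M ⊕ mod N) (Dim-≅ same (Dim-⊕ (hasDim M) (hasDim N)))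
    where
    same : res (mod M) ⊕ res (mod N) ≅ res (mod M ⊕ mod N)
    same = mkHom (λ x → x) (λ e → e) (λ _ _ → reflᴹ (mod M ⊕ mod N)) (λ _ _ → reflᴹ (mod M ⊕ mod N)) ,
      (λ e → e) , λ y → y , reflᴹ (mod M ⊕ mod N)

  infix 7 _^ᴹ_
  _^ᴹ_ : Mod Λ → ℕ → Mod Λ
  M ^ᴹ zero  = zeroMod
  M ^ᴹ suc n = M ⊕ᴹ (M ^ᴹ n)

  ^ᴹ-mod : ∀ M n → mod (M ^ᴹ n) ≡ mod M ^⊕ n
  ^ᴹ-mod M zero = refl
  ^ᴹ-mod M (suc n) = cong (mod M ⊕_) (^ᴹ-mod M n)

  Λᴹ : Mod Λ
  Λᴹ = record { mod = Λ.regular ; finiteDimensional = Λ.regular-finiteDimensional }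

  injective⇒dim≤ : {M N : Mod Λ} (f : M ⟶ N) → Injective f → dim M ℕ.≤ dim N
  injective⇒dim≤ {M} {N} f inj = injective⇒≤ (hasDim M) (hasDim N) (resʰ f) inj

  injective∧dim≥⇒surjective : {M N : Mod Λ} (f : M ⟶ N) → Injective f → dim N ℕ.≤ dim M → Surjective f
  injective∧dim≥⇒surjective {M} {N} f inj le = injective⇒surjective (hasDim M)
    (subst (Dim _) (ℕₚ.≤-antisym le (injective⇒dim≤ {M} {N} f inj)) (hasDim N)) (resʰ f) inj

  endo-surjective : {M : Mod Λ} (f : M ⟶ M) → Injective f → Surjective f
  endo-surjective {M} f inj = injective∧dim≥⇒surjective {M} {M} f inj ℕₚ.≤-refl

  dim-exact : {A B C : Mod Λ} (i : A ⟶ B) (p : B ⟶ C) → Injective i → Surjective p →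
    IsZeroHom (p ∘ʰ i) → (∀ y → p ⟨ y ⟩≈0 → ∃ λ x → mod B ∋ i ⟨ x ⟩ ≈ y) → dim B ≡ dim C ℕ.+ dim A
  dim-exact {A} {B} {C} i p inj surj pi ker = dim-unique B
    (Dim-exact (resʰ i) (resʰ p) inj surj pi ker (hasDim A) (hasDim C))

  dim-ker : {M N : Mod Λ} (f : M ⟶ N) → Surjective f → dim M ≡ dim N ℕ.+ dim (kerMod {M} {N} f)
  dim-ker {M} {N} f surj = dim-exact {kerMod {M} {N} f} {M} {N} (Kernel-incl f) f (λ e → e) surj proj₂
    (λ y e → (y , e) , reflᴹ (mod M))

  dim-⊕ : (M N : Mod Λ) → dim (M ⊕ᴹ N) ≡ dim N ℕ.+ dim M
  dim-⊕ M N = dim-exact {M} {M ⊕ᴹ N} {N} (⊕-inj₁ _ _) (⊕-proj₂ _ _) proj₁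
    (λ y → (M.0ᴹ , y) , N.≈ᴹ-refl) (λ _ → N.≈ᴹ-refl) (λ (x , y) e → x , M.≈ᴹ-refl , N.≈ᴹ-sym e)
    where
    module M = RightModule (mod M)
    module N = RightModule (mod N)

  dim≡0⇒IsZero : (M : Mod Λ) → dim M ≡ 0 → IsZero (mod M)
  dim≡0⇒IsZero M e = subst (Dim (res (mod M))) e (hasDim M)

  IsZero⇒dim≡0 : (M : Mod Λ) → IsZero (mod M) → dim M ≡ 0
  IsZero⇒dim≡0 M z = dim-unique M {0} z

  isZero? : (M : Mod Λ) → IsZero (mod M) ⊎ ¬ IsZero (mod M)
  isZero? M with dim M ℕₚ.≟ 0
  ... | yes e = inj₁ (dim≡0⇒IsZero M e)
  ... | no ¬e = inj₂ λ z → ¬e (IsZero⇒dim≡0 M z)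

  nonzero⇒dim>0 : (M : Mod Λ) → ¬ IsZero (mod M) → 0 ℕ.< dim M
  nonzero⇒dim>0 M nz = ℕₚ.n≢0⇒n>0 λ e → nz (dim≡0⇒IsZero M e)

  injective? : {M N : Mod Λ} (f : M ⟶ N) → Injective f ⊎ ¬ Injective f
  injective? {M} {N} f with isZero? (kerMod {M} {N} f)
  ... | inj₁ z = inj₁ (ker≈0⇒injective f λ x e → z (x , e))
  ... | inj₂ nz = inj₂ λ inj → nz λ (x , e) → injective⇒ker≈0 f inj x e

  surjective⇒dim≤ : {M N : Mod Λ} (f : M ⟶ N) → Surjective f → dim N ℕ.≤ dim M
  surjective⇒dim≤ {M} {N} f surj = subst (dim N ℕ.≤_) (sym (dim-ker {M} {N} f surj)) (ℕₚ.m≤m+n _ _)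

  surjective∧dim≤⇒injective : {M N : Mod Λ} (f : M ⟶ N) → Surjective f → dim M ℕ.≤ dim N → Injective f
  surjective∧dim≤⇒injective {M} {N} f surj le = ker≈0⇒injective f λ x e →
    dim≡0⇒IsZero (kerMod {M} {N} f) (ℕₚ.n≤0⇒n≡0 (ℕₚ.+-cancelˡ-≤ (dim N) _ _
      (subst (ℕ._≤ dim N ℕ.+ 0) (dim-ker {M} {N} f surj) (subst (dim M ℕ.≤_) (sym (ℕₚ.+-identityʳ _)) le)))) (x , e)

  ≅⇒dim≡ : {M N : Mod Λ} → mod M ≅ mod N → dim M ≡ dim N
  ≅⇒dim≡ {M} {N} (f , inj , surj) = ℕₚ.≤-antisym (injective⇒dim≤ {M} {N} f inj) (surjective⇒dim≤ {M} {N} f surj)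

  zeroHom? : {M N : Mod Λ} (f : M ⟶ N) → IsZeroHom f ⊎ ∃ λ x → ¬ f ⟨ x ⟩≈0
  zeroHom? {M} {N} f with hom-zero? (hasDim M) (hasDim N) (resʰ f)
  ... | inj₁ z = inj₁ z
  ... | inj₂ (x , χ , e) = inj₂ (x , 1≉0-value χ e)

  zeroHom-stable : {M N : Mod Λ} (f : M ⟶ N) → ¬ ¬ IsZeroHom f → IsZeroHom f
  zeroHom-stable {M} {N} f nn with zeroHom? {M} {N} f
  ... | inj₁ z = z
  ... | inj₂ (x , nz) = ⊥-elim (nn λ z → nz (z x))

  injective-stable : {M N : Mod Λ} (f : M ⟶ N) → ¬ ¬ Injective f → Injective f
  injective-stable {M} {N} f nn with injective? {M} {N} f
  ... | inj₁ i = i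
  ... | inj₂ ni = ⊥-elim (nn ni)

  surjective-stable : {M N : Mod Λ} (f : M ⟶ N) → ¬ ¬ Surjective f → Surjective f
  surjective-stable {M} {N} f nn y with solve (hasDim M) (hasDim N) (resʰ f) y
  ... | inj₁ x = x
  ... | inj₂ (ψ , ψf≈0 , ψy≈1) = ⊥-elim (nn λ surj → let x , e = surj y in
    k.1≉0 (k.trans (k.sym ψy≈1) (k.trans (k.sym (cong-h ψ e)) (ψf≈0 x))))

  module _ {M : Mod Λ} where
    private module M = ModuleOps (mod M)

    ^ʰ-+ : (f : M ⟶ M) → ∀ m n x → mod M ∋ (f ^ʰ (m ℕ.+ n)) ⟨ x ⟩ ≈ (f ^ʰ m) ⟨ (f ^ʰ n) ⟨ x ⟩ ⟩
    ^ʰ-+ f zero n x = M.≈ᴹ-refl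
    ^ʰ-+ f (suc m) n x = cong-h f (^ʰ-+ f m n x)

    ^ʰ-comm : (f : M ⟶ M) → ∀ n x → mod M ∋ (f ^ʰ n) ⟨ f ⟨ x ⟩ ⟩ ≈ f ⟨ (f ^ʰ n) ⟨ x ⟩ ⟩
    ^ʰ-comm f zero x = M.≈ᴹ-refl
    ^ʰ-comm f (suc n) x = cong-h f (^ʰ-comm f n x)

    ^ʰ-fix : {N : Module} (π : Hom (mod M) N) (f : M ⟶ M) → π ∘ʰ f ≈ʰ π → ∀ n → π ∘ʰ (f ^ʰ n) ≈ʰ π
    ^ʰ-fix {N} π f e zero x = reflᴹ N
    ^ʰ-fix {N} π f e (suc n) x = transᴹ N (e _) (^ʰ-fix π f e n x)

    image : {N : Mod Λ} (f : M ⟶ N) → coimMod {M} {N} f ⟶ N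
    image {N} f = proj₁ (factor-at (coim {M} {N} f) (coker-surjective (Kernel-incl f)) f (coim-exact {M} {N} f))

    stable⇒splits : (g : M ⟶ M) → (∀ x → g ⟨ g ⟨ x ⟩ ⟩≈0 → g ⟨ x ⟩≈0) →
      mod (kerMod {M} {M} g) ⊕ mod (coimMod {M} {M} g) ≅ mod M
    stable⇒splits g stable = sum , (λ {x} {y} → ker≈0⇒injective sum sum-ker {x} {y}) , sum-surj
      where
      C = coimMod {M} {M} g
      module C = ModuleOps (mod C)
      q : M ⟶ C
      q = coim {M} {M} g
      ι : C ⟶ M
      ι = image {M} g
      g̃ : C ⟶ C
      g̃ = q ∘ʰ ι
      g̃-surj : Surjective g̃
      g̃-surj = endo-surjective {C} g̃ (ker≈0⇒injective g̃ λ y e →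
        coim-ker {M} {M} g y (stable y (coim-exact {M} {M} g _ e)))
      sum : Hom (Kernel g ⊕ mod C) (mod M)
      sum = [ Kernel-incl g , ι ]ʰ
      sum-ker : ∀ x → sum ⟨ x ⟩≈0 → RightModule._≈ᴹ_ (Kernel g ⊕ mod C) x (zeroᴹ (Kernel g ⊕ mod C))
      sum-ker ((x , gx≈0) , y) e = M.≈ᴹ-trans (M.≈ᴹ-sym (M.+ᴹ-identityʳ x)) (M.≈ᴹ-trans (M.+ᴹ-congˡ (M.≈ᴹ-sym gy≈0)) e) ,
        coim-ker {M} {M} g y gy≈0
        where
        gy≈0 : g ⟨ y ⟩≈0
        gy≈0 = stable y (M.≈ᴹ-trans (M.≈ᴹ-sym (M.+ᴹ-identityˡ _)) (M.≈ᴹ-trans (M.+ᴹ-congʳ (M.≈ᴹ-sym gx≈0))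
          (M.≈ᴹ-trans (M.≈ᴹ-sym (Hom.+ᴹ-homo g _ _)) (M.≈ᴹ-trans (cong-h g e) (Hom.0ᴹ-homo g)))))
      sum-surj : Surjective sum
      sum-surj x = ((x M.⊖ g ⟨ y ⟩ , M.≈ᴹ-trans (⊖-homo g _ _) (M.≈⇒⊖≈0 (M.≈ᴹ-sym ggy≈gx))) , y) , M.⊖-+ x _
        where
        y = proj₁ (g̃-surj x)
        ggy≈gx : mod M ∋ g ⟨ g ⟨ y ⟩ ⟩ ≈ g ⟨ x ⟩
        ggy≈gx = M.⊖≈0⇒≈ (M.≈ᴹ-trans (M.≈ᴹ-sym (⊖-homo g _ _)) (coim-exact {M} {M} g _ (C.≈ᴹ-trans (⊖-homo q _ x)
          (C.≈⇒⊖≈0 (proj₂ (g̃-surj x))))))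

    fitting : (f : M ⟶ M) → ¬ ¬ ∃ λ n → ∀ x → (f ^ʰ suc n) ⟨ (f ^ʰ suc n) ⟨ x ⟩ ⟩≈0 → (f ^ʰ suc n) ⟨ x ⟩≈0
    fitting f = minimal (λ n → dim (coimMod {M} {M} (f ^ʰ suc n))) 0 >>= λ (n , least) → return (n , λ x e →
      coim-exact {M} {M} (f ^ʰ suc n) x (injective⇒ker≈0 (φ n) (φ-injective n (least (n ℕ.+ suc n))) _
        (transᴹ (mod (C₂ n)) (φ-ok n x) (coim-ker {M} {M} (f ^ʰ suc (n ℕ.+ suc n)) x (M.≈ᴹ-trans (^ʰ-+ f (suc n) (suc n) x) e)))))
      where
      C C₂ : ℕ → Mod Λ
      C n = coimMod {M} {M} (f ^ʰ suc n)
      C₂ n = C (n ℕ.+ suc n)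
      factored : ∀ n → Σ (C n ⟶ C₂ n) λ φ → φ ∘ʰ coim {M} {M} (f ^ʰ suc n) ≈ʰ coim {M} {M} (f ^ʰ suc (n ℕ.+ suc n))
      factored n = factor-at (coim {M} {M} (f ^ʰ suc n)) (coker-surjective (Kernel-incl (f ^ʰ suc n)))
        (coim {M} {M} (f ^ʰ suc (n ℕ.+ suc n))) λ x e →
        coim-ker {M} {M} (f ^ʰ suc (n ℕ.+ suc n)) x (M.≈ᴹ-trans (^ʰ-+ f (suc n) (suc n) x)
          (M.≈ᴹ-trans (cong-h (f ^ʰ suc n) (coim-exact {M} {M} (f ^ʰ suc n) x e)) (Hom.0ᴹ-homo (f ^ʰ suc n))))
      φ : ∀ n → C n ⟶ C₂ n
      φ n = proj₁ (factored n)
      φ-ok = λ n → proj₂ (factored n)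
      φ-injective : ∀ n → dim (C n) ℕ.≤ dim (C₂ n) → Injective (φ n)
      φ-injective n = surjective∧dim≤⇒injective {C n} {C₂ n} (φ n) (λ y → y , φ-ok n y)

    nilpotent-or-injective : Indecomposable M → (f : M ⟶ M) →
      ¬ ¬ (Injective f ⊎ ∃ λ n → IsZeroHom (f ^ʰ n))
    nilpotent-or-injective (_ , ind) f = fitting f >>= λ (n , stable) → return (case n
      (ind (kerMod {M} {M} (f ^ʰ suc n)) (coimMod {M} {M} (f ^ʰ suc n)) (stable⇒splits (f ^ʰ suc n) stable)))
      where
      case : ∀ n → _ → Injective f ⊎ ∃ λ n → IsZeroHom (f ^ʰ n)
      case n (inj₁ z) = inj₁ (ker≈0⇒injective f λ x e → z (x , M.≈ᴹ-trans (M.≈ᴹ-sym (^ʰ-comm f n x))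
        (M.≈ᴹ-trans (cong-h (f ^ʰ n) e) (Hom.0ᴹ-homo (f ^ʰ n)))))
      case n (inj₂ z) = inj₂ (suc n , λ x → coim-exact {M} {M} (f ^ʰ suc n) x (z x))

    local : Indecomposable M → (a b : M ⟶ M) → (∀ x → mod M ∋ a ⟨ x ⟩ M.+ᴹ b ⟨ x ⟩ ≈ x) → Injective a ⊎ Injective b
    local ind a b a+b≈1 with injective? {M} {M} a | injective? {M} {M} b
    ... | inj₁ i  | _       = inj₁ i
    ... | inj₂ _  | inj₁ i  = inj₂ i
    ... | inj₂ na | inj₂ nb = ⊥-elim (nilpotent-or-injective ind a λ
      { (inj₁ i) → na i
      ; (inj₂ (n , z)) → nb (ker≈0⇒injective b λ x bx≈0 →
          M.≈ᴹ-trans (M.≈ᴹ-sym (fix x bx≈0 n)) (z x)) })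
      where
      fix : ∀ x → b ⟨ x ⟩≈0 → ∀ n → mod M ∋ (a ^ʰ n) ⟨ x ⟩ ≈ x
      fix x bx≈0 zero = M.≈ᴹ-refl
      fix x bx≈0 (suc n) = M.≈ᴹ-trans (cong-h a (fix x bx≈0 n))
        (M.≈ᴹ-trans (M.≈ᴹ-sym (M.+ᴹ-identityʳ _)) (M.≈ᴹ-trans (M.+ᴹ-congˡ (M.≈ᴹ-sym bx≈0)) (a+b≈1 x)))

    over⇒injective : Indecomposable M → {N : Module} (π : Hom (mod M) N) → ¬ IsZeroHom π →
      (h : M ⟶ M) → π ∘ʰ h ≈ʰ π → Injective h
    over⇒injective ind {N} π π≉0 h πh≈π = injective-stable {M} {M} h λ not-inj →
      nilpotent-or-injective ind h λ
      { (inj₁ i) → not-inj i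
      ; (inj₂ (n , z)) → π≉0 λ x → N.≈ᴹ-trans (N.≈ᴹ-sym (^ʰ-fix π h πh≈π n x))
          (N.≈ᴹ-trans (cong-h π (z x)) (Hom.0ᴹ-homo π)) }
      where module N = RightModule N

module _ {ℓ} {R : Ring ℓ ℓ} where

  ^⊕-◁ : {M N : RightModule R ℓ ℓ} → M ◁ N → ∀ n → M ^⊕ n ◁ N ^⊕ n
  ^⊕-◁ s zero = ◁-refl
  ^⊕-◁ s (suc n) = ⊕-map-◁ s (^⊕-◁ s n)

  ⊕-assoc-◁ : (L M N : RightModule R ℓ ℓ) → (L ⊕ M) ⊕ N ◁ L ⊕ (M ⊕ N)
  ⊕-assoc-◁ L M N = mkHom (λ ((x , y) , z) → x , y , z) (λ ((d , e) , f) → d , e , f) (λ _ _ → ≈r) (λ _ _ → ≈r) ,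
    mkHom (λ (x , y , z) → (x , y) , z) (λ (d , e , f) → (d , e) , f) (λ _ _ → ≈l) (λ _ _ → ≈l) , λ _ → ≈l
    where
    ≈r : ∀ {x} → L ⊕ (M ⊕ N) ∋ x ≈ x
    ≈r = reflᴹ (L ⊕ (M ⊕ N))
    ≈l : ∀ {x} → (L ⊕ M) ⊕ N ∋ x ≈ x
    ≈l = reflᴹ ((L ⊕ M) ⊕ N)

  ^⊕-+ : (M : RightModule R ℓ ℓ) → ∀ m n → M ^⊕ m ⊕ M ^⊕ n ◁ M ^⊕ (m ℕ.+ n)
  ^⊕-+ M zero n = ⊕-proj₂ _ _ , ⊕-inj₂ _ _ , λ _ → _ , reflᴹ (M ^⊕ n)
  ^⊕-+ M (suc m) n = ◁-trans (⊕-assoc-◁ M (M ^⊕ m) (M ^⊕ n)) (⊕-map-◁ ◁-refl (^⊕-+ M m n))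

  ^⊕-* : (M : RightModule R ℓ ℓ) → ∀ m n → (M ^⊕ n) ^⊕ m ◁ M ^⊕ (m ℕ.* n)
  ^⊕-* M zero n = ◁-refl
  ^⊕-* M (suc m) n = ◁-trans (⊕-map-◁ ◁-refl (^⊕-* M m n)) (^⊕-+ M n (m ℕ.* n))

  ◁-zero : {M N : RightModule R ℓ ℓ} → M ◁ N → IsZero N → IsZero M
  ◁-zero {M} (i , r , e) z x = M.≈ᴹ-trans (M.≈ᴹ-sym (e x)) (M.≈ᴹ-trans (cong-h r (z _)) (Hom.0ᴹ-homo r))
    where module M = RightModule M

module Summands {ℓ} {k : Field ℓ} (Λ : FDAlgebra k) where
  open Modules Λ public
  private
    module Λ = FDAlgebra Λ

  Vanishes : (M N : Module) → Set ℓ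
  Vanishes M N = ∀ (f : Hom M N) → IsZeroHom f

  summand⇒◁ : {N : Mod Λ} {M : Module} → DirectSummand N M → mod N ◁ M
  summand⇒◁ (L , e) = ◁-trans ⊕-◁₁ (≅⇒◁ e)

  ◁⇒complement : {N M : Mod Λ} (s : mod N ◁ mod M) → mod N ⊕ Kernel (proj₁ (proj₂ s)) ≅ mod M
  ◁⇒complement {N} {M} (i , r , ri) = sum , (λ {x} {y} → ker≈0⇒injective sum sum-ker {x} {y}) , λ y →
    (r ⟨ y ⟩ , y M.⊖ i ⟨ r ⟨ y ⟩ ⟩ , N.≈ᴹ-trans (⊖-homo r _ _) (N.≈⇒⊖≈0 (N.≈ᴹ-sym (ri _)))) ,
    M.≈ᴹ-trans (M.+ᴹ-comm _ _) (M.⊖-+ y _)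
    where
    module M = ModuleOps (mod M)
    module N = ModuleOps (mod N)
    sum : Hom (mod N ⊕ Kernel r) (mod M)
    sum = [ i , Kernel-incl r ]ʰ
    sum-ker : ∀ x → sum ⟨ x ⟩≈0 → mod N ⊕ Kernel r ∋ x ≈ zeroᴹ (mod N ⊕ Kernel r)
    sum-ker (x , y , ry≈0) e = x≈0 ,
      M.≈ᴹ-trans (M.≈ᴹ-sym (M.+ᴹ-identityˡ y)) (M.≈ᴹ-trans (M.+ᴹ-congʳ (M.≈ᴹ-sym (M.≈ᴹ-trans (cong-h i x≈0) (Hom.0ᴹ-homo i)))) e)
      where
      x≈0 : mod N ∋ x ≈ N.0ᴹ
      x≈0 = N.≈ᴹ-trans (N.≈ᴹ-sym (ri x)) (N.≈ᴹ-trans (N.≈ᴹ-sym (N.+ᴹ-identityʳ _)) (N.≈ᴹ-trans (N.+ᴹ-congˡ (N.≈ᴹ-sym ry≈0))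
        (N.≈ᴹ-trans (N.≈ᴹ-sym (Hom.+ᴹ-homo r _ _)) (N.≈ᴹ-trans (cong-h r e) (Hom.0ᴹ-homo r)))))

  ◁⇒summand : {N M : Mod Λ} → mod N ◁ mod M → DirectSummand N (mod M)
  ◁⇒summand {N} {M} s = kerMod {M} {N} (proj₁ (proj₂ s)) , ◁⇒complement {N} {M} s

  ◁⇒∈add : {N M : Mod Λ} → ∀ n → mod N ◁ mod M ^⊕ n → N ∈add M
  ◁⇒∈add {N} {M} n s = n , subst (DirectSummand N) (^ᴹ-mod M n)
    (◁⇒summand {N} {M ^ᴹ n} (subst (mod N ◁_) (sym (^ᴹ-mod M n)) s))

  ∈add⇒◁ : {N M : Mod Λ} → (s : N ∈add M) → mod N ◁ mod M ^⊕ proj₁ s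
  ∈add⇒◁ {N} (n , s) = summand⇒◁ {N} s

  ∈add-trans : {L M N : Mod Λ} → L ∈add M → M ∈add N → L ∈add N
  ∈add-trans {L} {M} {N} s@(m , _) t@(n , _) = ◁⇒∈add {L} {N} (m ℕ.* n)
    (◁-trans (∈add⇒◁ {L} {M} s) (◁-trans (^⊕-◁ (∈add⇒◁ {M} {N} t) m) (^⊕-* (mod N) m n)))

  ◁⇒∈add₁ : {N M : Mod Λ} → mod N ◁ mod M → N ∈add M
  ◁⇒∈add₁ {N} {M} s = ◁⇒∈add {N} {M} 1 (◁-trans s ⊕-◁₁)

  ∈add-refl : {M : Mod Λ} → M ∈add M
  ∈add-refl {M} = ◁⇒∈add₁ {M} {M} ◁-refl

  zero-∈add : {N M : Mod Λ} → IsZero (mod N) → N ∈add M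
  zero-∈add {N} {M} z = ◁⇒∈add {N} {M} 0 (0ʰ , 0ʰ , λ x → symᴹ (mod N) (z x))

  ⊕-∈add : {A B M : Mod Λ} {C : Mod Λ} → mod C ◁ mod A ⊕ mod B → A ∈add M → B ∈add M → C ∈add M
  ⊕-∈add {A} {B} {M} {C} c s@(m , _) t@(n , _) = ◁⇒∈add {C} {M} (m ℕ.+ n)
    (◁-trans c (◁-trans (⊕-map-◁ (∈add⇒◁ {A} {M} s) (∈add⇒◁ {B} {M} t)) (^⊕-+ (mod M) m n)))

  indecomposable-◁ : {N M : Mod Λ} → Indecomposable M → ¬ IsZero (mod N) → mod N ◁ mod M → mod N ≅ mod M
  indecomposable-◁ {N} {M} (_ , ind) nz s@(i , r , ri) with ind N (kerMod {M} {N} r) (◁⇒complement {N} {M} s)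
  ... | inj₁ z = ⊥-elim (nz z)
  ... | inj₂ z = mk≅ i r ri λ y → M.≈ᴹ-sym (M.⊖≈0⇒≈ (z (y M.⊖ i ⟨ r ⟨ y ⟩ ⟩ ,
      N.≈ᴹ-trans (⊖-homo r _ _) (N.≈⇒⊖≈0 (N.≈ᴹ-sym (ri _))))))
    where
    module M = ModuleOps (mod M)
    module N = ModuleOps (mod N)

  through⇒◁ : {N : Mod Λ} {M : Module} (i : Hom (mod N) M) (r : Hom M (mod N)) → Injective (r ∘ʰ i) → mod N ◁ M
  through⇒◁ {N} {M} i r inj = i , inverse iso ∘ʰ r , inverseˡ iso
    where
    iso : mod N ≅ mod N
    iso = r ∘ʰ i , inj , endo-surjective {N} (r ∘ʰ i) inj

  Simple : Mod Λ → Set (lsuc ℓ)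
  Simple S = ¬ IsZero (mod S) × (∀ (X : Mod Λ) (f : X ⟶ S) → ¬ IsZeroHom f → Surjective f)

  simple⇒indecomposable : {S : Mod Λ} → Simple S → Indecomposable S
  simple⇒indecomposable {S} (nz , simple) = nz , split
    where
    split : ∀ A B → mod A ⊕ mod B ≅ mod S → IsZero (mod A) ⊎ IsZero (mod B)
    split A B e@(f , inj , _) with isZero? A
    ... | inj₁ z = inj₁ z
    ... | inj₂ nzA = inj₂ λ b →
      let a , p = simple A (f ∘ʰ ⊕-inj₁ (mod A) (mod B)) (λ z → nzA λ a → proj₁ (injective⇒ker≈0 f (λ {x} {y} → inj {x} {y}) _ (z a)))
                    (f ⟨ zeroᴹ (mod A) , b ⟩)
      in symᴹ (mod B) (proj₂ (inj p))

  simpleQuotient : (M : Mod Λ) → ¬ IsZero (mod M) → ¬ ¬ Σ (Mod Λ) λ S → Simple S × Σ (M ⟶ S) Surjective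
  simpleQuotient M nz = minimal μ (M , nz , idʰ , λ y → y , reflᴹ (mod M)) >>=
      λ ((S , nzS , q , q-surj) , least) → return (S , (nzS , λ X f f≉0 → case S nzS q q-surj least X f f≉0) , q , q-surj)
    where
    A : Set _
    A = Σ (Mod Λ) λ S → ¬ IsZero (mod S) × Σ (M ⟶ S) Surjective
    μ : A → ℕ
    μ (S , _) = dim S
    case : ∀ S (nzS : ¬ IsZero (mod S)) (q : M ⟶ S) (qs : Surjective q) → (∀ a → dim S ℕ.≤ μ a) →
      ∀ X (f : X ⟶ S) → ¬ IsZeroHom f → Surjective f
    case S nzS q qs least X f f≉0 with isZero? (cokMod {X} {S} f)
    ... | inj₁ z = λ y → coker-exact f y (z y)
    ... | inj₂ nzC = ⊥-elim (f≉0 λ x → injective⇒ker≈0 (coker f) (surjective∧dim≤⇒injective {S} {cokMod {X} {S} f} (coker f)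
            (coker-surjective f) (least (cokMod {X} {S} f , nzC , coker f ∘ʰ q , qs′))) _ (coker-∘ f x))
      where
      qs′ : Surjective (coker f ∘ʰ q)
      qs′ y = proj₁ (qs y) , cong-h (coker f) (proj₂ (qs y))

  element : (M : Module) → El M → Hom Λ.regular M
  element M x = mkHom (λ r → x M.*ᵣ r) M.*ᵣ-congˡ (M.*ᵣ-distribˡ x) (λ r s → M.≈ᴹ-sym (M.*ᵣ-assoc x s r))
    where module M = RightModule M

  spanningHom : ∀ {n} (M : Module) {U : Space} → Dim U n → (i : Hom U (res M)) →
    Σ (Hom (mod (Λᴹ ^ᴹ n)) M) λ f → ∀ u → ∃ λ x → M ∋ f ⟨ x ⟩ ≈ i ⟨ u ⟩
  spanningHom {zero} M d i = 0ʰ , λ u → _ , M.≈ᴹ-sym (M.≈ᴹ-trans (cong-h i (d u)) (Hom.0ᴹ-homo i))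
    where module M = RightModule M
  spanningHom {suc n} M (g , v , gv , d) i with spanningHom M d (i ∘ʰ Kernel-incl g)
  ... | f , onto = [ element M (i ⟨ v ⟩) , f ]ʰ , λ u → let x , e = onto (project ⟨ u ⟩) in
      (Λ.ι (g ⟨ u ⟩) , x) , M.≈ᴹ-trans (M.+ᴹ-comm _ _) (M.≈ᴹ-trans (M.+ᴹ-congʳ e) (M.≈ᴹ-sym (decompose i u)))
    where
    module M = RightModule M
    open Split g v gv

  abstract
    freeCover : (M : Mod Λ) → Σ (Λᴹ ^ᴹ dim M ⟶ M) Surjective
    freeCover M = spanningHom (mod M) (hasDim M) idʰ

  Λ-projective : Projective Λᴹ
  Λ-projective X Y g surj f = element (mod X) x , λ r → Y.≈ᴹ-trans (Hom.*ᵣ-homo g r x)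
      (Y.≈ᴹ-trans (Y.*ᵣ-congʳ e) (Y.≈ᴹ-trans (Y.≈ᴹ-sym (Hom.*ᵣ-homo f r Λ.1#)) (cong-h f (Λ.*-identityˡ r))))
    where
    module Y = RightModule (mod Y)
    x = proj₁ (surj (f ⟨ Λ.1# ⟩))
    e = proj₂ (surj (f ⟨ Λ.1# ⟩))

  ⊕-projective : {P Q : Mod Λ} → Projective P → Projective Q → Projective (P ⊕ᴹ Q)
  ⊕-projective {P} {Q} pP pQ X Y g surj f =
    let h , e = pP X Y g surj (f ∘ʰ ⊕-inj₁ (mod P) (mod Q)) ; h′ , e′ = pQ X Y g surj (f ∘ʰ ⊕-inj₂ (mod P) (mod Q)) in
    [ h , h′ ]ʰ , λ (x , y) → Y.≈ᴹ-trans (Hom.+ᴹ-homo g _ _) (Y.≈ᴹ-trans (Y.+ᴹ-cong (e x) (e′ y)) (Y.≈ᴹ-sym (⊕-split f x y)))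
    where module Y = RightModule (mod Y)

  zero-projective : {P : Mod Λ} → IsZero (mod P) → Projective P
  zero-projective {P} z X Y g surj f = 0ʰ , λ x → Y.≈ᴹ-trans (Hom.0ᴹ-homo g) (Y.≈ᴹ-sym (Y.≈ᴹ-trans (cong-h f (z x)) (Hom.0ᴹ-homo f)))
    where module Y = RightModule (mod Y)

  ^-projective : {P : Mod Λ} → Projective P → ∀ n → Projective (P ^ᴹ n)
  ^-projective pP zero = zero-projective {zeroMod} (λ _ → _)
  ^-projective {P} pP (suc n) = ⊕-projective {P} {P ^ᴹ n} pP (^-projective {P} pP n)

  ◁-projective : {P Q : Mod Λ} → Projective P → mod Q ◁ mod P → Projective Q
  ◁-projective {P} {Q} pP (i , r , ri) X Y g surj f = let h , e = pP X Y g surj (f ∘ʰ r) in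
    h ∘ʰ i , λ x → transᴹ (mod Y) (e _) (cong-h f (ri x))

  projective⇒vanishes : {Q X Y : Mod Λ} → Projective Q → (g : X ⟶ Y) → Surjective g →
    Vanishes (mod Q) (mod X) → Vanishes (mod Q) (mod Y)
  projective⇒vanishes {Q} {X} {Y} pQ g surj van f x = let h , e = pQ X Y g surj f in
    Y.≈ᴹ-trans (Y.≈ᴹ-sym (e x)) (Y.≈ᴹ-trans (cong-h g (van h x)) (Hom.0ᴹ-homo g))
    where module Y = RightModule (mod Y)

  vanishes-^⊕ : {M N : Module} → Vanishes M N → ∀ n → Vanishes (M ^⊕ n) N
  vanishes-^⊕ {M} {N} van zero f x = Hom.0ᴹ-homo f
  vanishes-^⊕ {M} {N} van (suc n) f (x , y) = N.≈ᴹ-trans (⊕-split f x y) (N.≈ᴹ-trans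
      (N.+ᴹ-cong (van (f ∘ʰ ⊕-inj₁ M (M ^⊕ n)) x) (vanishes-^⊕ van n (f ∘ʰ ⊕-inj₂ M (M ^⊕ n)) y)) (N.+ᴹ-identityˡ _))
    where module N = RightModule N

  vanishes-◁ : {L M N : Module} → L ◁ M → Vanishes M N → Vanishes L N
  vanishes-◁ {N = N} (i , r , ri) van f x = N.≈ᴹ-trans (N.≈ᴹ-sym (cong-h f (ri x))) (van (f ∘ʰ r) _)
    where module N = RightModule N

  vanishes-∈add : {P Q : Mod Λ} {N : Module} → Q ∈add P → Vanishes (mod P) N → Vanishes (mod Q) N
  vanishes-∈add {P} {Q} s@(n , _) van = vanishes-◁ (∈add⇒◁ {Q} {P} s) (vanishes-^⊕ van n)

  vanishes-from : {X Y : Module} {N : Module} (q : Hom X Y) → Surjective q → Vanishes X N → Vanishes Y N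
  vanishes-from {N = N} q surj van f y = let x , e = surj y in
    transᴹ N (symᴹ N (cong-h f e)) (van (f ∘ʰ q) x)

  indecomposableSummand : (M : Mod Λ) {S : Mod Λ} (f : M ⟶ S) → ¬ IsZeroHom f →
    ¬ ¬ Σ (Mod Λ) λ N → Indecomposable N × (mod N ◁ mod M) × Σ (N ⟶ S) λ g → ¬ IsZeroHom g
  indecomposableSummand M {S} f f≉0 = minimal μ (M , ◁-refl , f , f≉0) >>=
      λ ((N , s , g , g≉0) , least) → return (N ,
        ((λ z → g≉0 λ x → S.≈ᴹ-trans (cong-h g (z x)) (Hom.0ᴹ-homo g)) , split N s g g≉0 least) , s , g , g≉0)
    where
    module S = RightModule (mod S)
    T : Set _
    T = Σ (Mod Λ) λ N → (mod N ◁ mod M) × Σ (N ⟶ S) λ g → ¬ IsZeroHom g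
    μ : T → ℕ
    μ (N , _) = dim N
    split : ∀ N → mod N ◁ mod M → (g : N ⟶ S) → ¬ IsZeroHom g → (∀ t → dim N ℕ.≤ μ t) →
      ∀ A B → mod A ⊕ mod B ≅ mod N → IsZero (mod A) ⊎ IsZero (mod B)
    split N s g g≉0 least A B e with isZero? A | isZero? B
    ... | inj₁ z | _ = inj₁ z
    ... | inj₂ _ | inj₁ z = inj₂ z
    ... | inj₂ nzA | inj₂ nzB = ⊥-elim (g≉0 λ y → S.≈ᴹ-trans (S.≈ᴹ-sym (cong-h g (inverseʳ e y)))
        (S.≈ᴹ-trans (⊕-split (g ∘ʰ proj₁ e) _ _) (S.≈ᴹ-trans (S.+ᴹ-cong (zA _) (zB _)) (S.+ᴹ-identityˡ _))))
      where
      dimN : dim N ≡ dim B ℕ.+ dim A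
      dimN = trans (sym (≅⇒dim≡ {A ⊕ᴹ B} {N} e)) (dim-⊕ A B)
      gA : A ⟶ S
      gA = g ∘ʰ proj₁ e ∘ʰ ⊕-inj₁ (mod A) (mod B)
      gB : B ⟶ S
      gB = g ∘ʰ proj₁ e ∘ʰ ⊕-inj₂ (mod A) (mod B)
      zA : IsZeroHom gA
      zA = zeroHom-stable {A} {S} gA λ nz → ℕₚ.<⇒≱ (subst (dim A ℕ.<_) (sym dimN) (ℕₚ.+-monoˡ-≤ (dim A) (nonzero⇒dim>0 B nzB)))
        (least (A , ◁-trans ⊕-◁₁ (◁-trans (≅⇒◁ e) s) , gA , nz))
      zB : IsZeroHom gB
      zB = zeroHom-stable {B} {S} gB λ nz → ℕₚ.<⇒≱ (subst (dim B ℕ.<_) (trans (ℕₚ.+-comm (dim A) (dim B)) (sym dimN))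
          (ℕₚ.+-monoˡ-≤ (dim B) (nonzero⇒dim>0 A nzA)))
        (least (B , ◁-trans ⊕-◁₂ (◁-trans (≅⇒◁ e) s) , gB , nz))

  module _ {P : Mod Λ} (ind : Indecomposable P) (proj : Projective P) where

    simple⇒◁projective : {S Q : Mod Λ} → Simple S → (π : P ⟶ S) → ¬ IsZeroHom π →
      Projective Q → (q : Q ⟶ S) → ¬ IsZeroHom q → mod P ◁ mod Q
    simple⇒◁projective {S} {Q} (_ , simple) π π≉0 pQ q q≉0 = through⇒◁ {P} a b
        (over⇒injective {P} ind π π≉0 (b ∘ʰ a) λ x → transᴹ (mod S) (πb≈q _) (qa≈π x))
      where
      lift-a = proj Q S q (simple Q q q≉0) π
      a = proj₁ lift-a
      qa≈π = proj₂ lift-a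
      lift-b = pQ P S π (simple P π π≉0) q
      b = proj₁ lift-b
      πb≈q = proj₂ lift-b

    radical-unique : {S S′ : Mod Λ} → Simple S → Simple S′ → (π : P ⟶ S) → ¬ IsZeroHom π →
      (π′ : P ⟶ S′) → ¬ IsZeroHom π′ → ∀ x → π ⟨ x ⟩≈0 → π′ ⟨ x ⟩≈0
    radical-unique {S} {S′} _ (_ , simple′) π π≉0 π′ π′≉0 x e with zeroHom? {kerMod {P} {S} π} {S′} (π′ ∘ʰ Kernel-incl π)
    ... | inj₁ z = z (x , e)
    ... | inj₂ (y , nz) = ⊥-elim (π≉0 λ z →
        let w , p = endo-surjective {P} (Kernel-incl π ∘ʰ a) (over⇒injective {P} ind π′ π′≉0 (Kernel-incl π ∘ʰ a) lift-ok) z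
        in transᴹ (mod S) (symᴹ (mod S) (cong-h π p)) (proj₂ (a ⟨ w ⟩)))
      where
      K = kerMod {P} {S} π
      lift = proj K S′ (π′ ∘ʰ Kernel-incl π) (simple′ K (π′ ∘ʰ Kernel-incl π) λ z → nz (z y)) π′
      a : P ⟶ K
      a = proj₁ lift
      lift-ok = proj₂ lift

    top-unique : {S S′ : Mod Λ} → Simple S → Simple S′ → (π : P ⟶ S) → ¬ IsZeroHom π →
      (π′ : P ⟶ S′) → ¬ IsZeroHom π′ → mod S ≅ mod S′
    top-unique {S} {S′} s@(_ , simple) s′@(_ , simple′) π π≉0 π′ π′≉0 = f ,
        ker≈0⇒injective f (λ y e → let x , πx≈y = simple P π π≉0 y in
          S.≈ᴹ-trans (S.≈ᴹ-sym πx≈y) (radical-unique {S′} {S} s′ s π′ π′≉0 π π≉0 x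
            (S′.≈ᴹ-trans (S′.≈ᴹ-sym (fπ≈π′ x)) (S′.≈ᴹ-trans (cong-h f πx≈y) e)))) ,
        (λ y → let x , e = simple′ P π′ π′≉0 y in π ⟨ x ⟩ , S′.≈ᴹ-trans (fπ≈π′ x) e)
      where
      module S = RightModule (mod S)
      module S′ = RightModule (mod S′)
      factored = factor-at π (simple P π π≉0) π′ (radical-unique {S} {S′} s s′ π π≉0 π′ π′≉0)
      f = proj₁ factored
      fπ≈π′ = proj₂ factored

module _ {ℓ} {R : Ring ℓ ℓ} {N E K : RightModule R ℓ ℓ} where
  private
    module N = ModuleOps N
    module E = ModuleOps E

  corestrict : (i : Hom N E) → Injective i → (f : Hom K E) → (∀ x → ∃ λ n → E ∋ i ⟨ n ⟩ ≈ f ⟨ x ⟩) →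
    Σ (Hom K N) λ g → i ∘ʰ g ≈ʰ f
  corestrict i inj f pre = mkHom (λ x → proj₁ (pre x))
    (λ {x} {y} e → inj (E.≈ᴹ-trans (ok x) (E.≈ᴹ-trans (cong-h f e) (E.≈ᴹ-sym (ok y)))))
    (λ x y → inj (E.≈ᴹ-trans (ok _) (E.≈ᴹ-trans (Hom.+ᴹ-homo f x y)
      (E.≈ᴹ-sym (E.≈ᴹ-trans (Hom.+ᴹ-homo i _ _) (E.+ᴹ-cong (ok x) (ok y)))))))
    (λ r x → inj (E.≈ᴹ-trans (ok _) (E.≈ᴹ-trans (Hom.*ᵣ-homo f r x)
      (E.≈ᴹ-sym (E.≈ᴹ-trans (Hom.*ᵣ-homo i _ _) (E.*ᵣ-congʳ (ok x))))))) , ok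
    where
    ok : ∀ x → E ∋ i ⟨ proj₁ (pre x) ⟩ ≈ f ⟨ x ⟩
    ok x = proj₂ (pre x)

module HomSpaces {ℓ} {k : Field ℓ} (Λ : FDAlgebra k) where
  open Summands Λ public
  private
    module k = Field k
    module Λ = FDAlgebra Λ

  HomSpace : (M N : Module) → Space
  HomSpace M N = record
    { Carrierᴹ = Hom M N
    ; _≈ᴹ_ = _≈ʰ_
    ; _+ᴹ_ = _+ʰ_
    ; _*ᵣ_ = λ f c → mkHom (λ x → f ⟨ x ⟩ N.*ᵣ Λ.ι c) (λ e → N.*ᵣ-congʳ (cong-h f e))
        (λ x y → N.≈ᴹ-trans (N.*ᵣ-congʳ (Hom.+ᴹ-homo f x y)) (N.*ᵣ-distribʳ _ _ _))
        (λ r x → N.≈ᴹ-trans (N.*ᵣ-congʳ (Hom.*ᵣ-homo f r x)) (N.≈ᴹ-trans (N.*ᵣ-assoc _ _ _)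
          (N.≈ᴹ-trans (N.*ᵣ-congˡ (Λ.sym (Λ.central c r))) (N.≈ᴹ-sym (N.*ᵣ-assoc _ _ _)))))
    ; 0ᴹ = 0ʰ
    ; -ᴹ_ = λ f → 0ʰ -ʰ f
    ; isRightModule = record
      { isRightSemimodule = record
        { +ᴹ-isCommutativeMonoid = record
          { isMonoid = record
            { isSemigroup = record
              { isMagma = record
                { isEquivalence = record
                  { refl = λ _ → N.≈ᴹ-refl ; sym = λ e x → N.≈ᴹ-sym (e x) ; trans = λ d e x → N.≈ᴹ-trans (d x) (e x) }
                ; ∙-cong = λ d e x → N.+ᴹ-cong (d x) (e x)
                }
              ; assoc = λ _ _ _ _ → N.+ᴹ-assoc _ _ _
              }
            ; identity = (λ _ _ → N.+ᴹ-identityˡ _) , (λ _ _ → N.+ᴹ-identityʳ _)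
            }
          ; comm = λ _ _ _ → N.+ᴹ-comm _ _
          }
        ; isPrerightSemimodule = record
          { *ᵣ-cong      = λ d e x → N.*ᵣ-cong (d x) (ι.⟦⟧-cong e)
          ; *ᵣ-zeroʳ     = λ f x → N.≈ᴹ-trans (N.*ᵣ-congˡ ι.0#-homo) (N.*ᵣ-zeroʳ _)
          ; *ᵣ-distribˡ  = λ f c d x → N.≈ᴹ-trans (N.*ᵣ-congˡ (ι.+-homo c d)) (N.*ᵣ-distribˡ _ _ _)
          ; *ᵣ-identityʳ = λ f x → N.≈ᴹ-trans (N.*ᵣ-congˡ ι.1#-homo) (N.*ᵣ-identityʳ _)
          ; *ᵣ-assoc     = λ f c d x → N.≈ᴹ-trans (N.*ᵣ-assoc _ _ _) (N.*ᵣ-congˡ (Λ.sym (ι.*-homo c d)))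
          ; *ᵣ-zeroˡ     = λ c x → N.*ᵣ-zeroˡ _
          ; *ᵣ-distribʳ  = λ c f g x → N.*ᵣ-distribʳ _ _ _
          }
        }
      ; -ᴹ‿cong    = λ e x → N.⊖-cong N.≈ᴹ-refl (e x)
      ; -ᴹ‿inverse = (λ f x → N.≈ᴹ-trans (N.+ᴹ-congʳ (N.+ᴹ-identityˡ _)) (N.-ᴹ‿inverseˡ _)) ,
                     (λ f x → N.≈ᴹ-trans (N.+ᴹ-congˡ (N.+ᴹ-identityˡ _)) (N.-ᴹ‿inverseʳ _))
      }
    }
    where
    module N = ModuleOps N
    module ι = RingMorphisms.IsRingHomomorphism Λ.ι-isHom

  precompose : {L M : Module} (N : Module) → Hom L M → Hom (HomSpace M N) (HomSpace L N)
  precompose N f = mkHom (λ g → g ∘ʰ f) (λ e x → e (f ⟨ x ⟩)) (λ _ _ _ → N.≈ᴹ-refl) (λ _ _ _ → N.≈ᴹ-refl)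
    where module N = RightModule N

  HomSpace-Λ : (N : Module) → res N ≅ HomSpace Λ.regular N
  HomSpace-Λ N = mkHom (element N) (λ e r → N.*ᵣ-congʳ e) (λ x y r → N.*ᵣ-distribʳ r x y)
      (λ c x r → N.≈ᴹ-trans (N.*ᵣ-assoc _ _ _) (N.≈ᴹ-trans (N.*ᵣ-congˡ (Λ.central c r)) (N.≈ᴹ-sym (N.*ᵣ-assoc _ _ _)))) ,
    (λ e → N.≈ᴹ-trans (N.≈ᴹ-sym (N.*ᵣ-identityʳ _)) (N.≈ᴹ-trans (e Λ.1#) (N.*ᵣ-identityʳ _))) ,
    λ f → f ⟨ Λ.1# ⟩ , λ r → N.≈ᴹ-trans (N.≈ᴹ-sym (Hom.*ᵣ-homo f r Λ.1#)) (cong-h f (Λ.*-identityˡ r))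
    where module N = RightModule N

  HomSpace-⊕ : (L M N : Module) → HomSpace L N ⊕ HomSpace M N ≅ HomSpace (L ⊕ M) N
  HomSpace-⊕ L M N = mkHom (λ (f , g) → [ f , g ]ʰ) (λ (d , e) (x , y) → N.+ᴹ-cong (d x) (e y))
      (λ _ _ _ → N.interchange _ _ _ _) (λ _ _ _ → N.≈ᴹ-sym (N.*ᵣ-distribʳ _ _ _)) ,
    (λ {(f , g)} {(f′ , g′)} e →
      (λ x → N.≈ᴹ-trans (N.≈ᴹ-sym (at₁ f g x)) (N.≈ᴹ-trans (e (x , zeroᴹ M)) (at₁ f′ g′ x))) ,
      (λ y → N.≈ᴹ-trans (N.≈ᴹ-sym (at₂ f g y)) (N.≈ᴹ-trans (e (zeroᴹ L , y)) (at₂ f′ g′ y)))) ,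
    λ h → (h ∘ʰ ⊕-inj₁ L M , h ∘ʰ ⊕-inj₂ L M) , λ (x , y) → N.≈ᴹ-sym (⊕-split h x y)
    where
    module N = ModuleOps N
    at₁ : ∀ (f : Hom L N) (g : Hom M N) x → N ∋ [ f , g ]ʰ ⟨ x , zeroᴹ M ⟩ ≈ f ⟨ x ⟩
    at₁ f g x = N.≈ᴹ-trans (N.+ᴹ-congˡ (Hom.0ᴹ-homo g)) (N.+ᴹ-identityʳ _)
    at₂ : ∀ (f : Hom L N) (g : Hom M N) y → N ∋ [ f , g ]ʰ ⟨ zeroᴹ L , y ⟩ ≈ g ⟨ y ⟩
    at₂ f g y = N.≈ᴹ-trans (N.+ᴹ-congʳ (Hom.0ᴹ-homo f)) (N.+ᴹ-identityˡ _)

  Dim-HomSpace-free : (N : Mod Λ) → ∀ n → ∃ (Dim (HomSpace (mod (Λᴹ ^ᴹ n)) (mod N)))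
  Dim-HomSpace-free N zero = 0 , λ f x → Hom.0ᴹ-homo f
  Dim-HomSpace-free N (suc n) = let d , D = Dim-HomSpace-free N n in
    d ℕ.+ dim N , Dim-≅ (HomSpace-⊕ _ _ (mod N)) (Dim-⊕ (Dim-≅ (HomSpace-Λ (mod N)) (hasDim N)) D)

  HomSpace-finite : (M N : Mod Λ) → ∃ (Dim (HomSpace (mod M) (mod N)))
  HomSpace-finite M N = let r , D = Dim-Kernel (proj₂ (Dim-HomSpace-free N (dim M))) (proj₂ (Dim-HomSpace-free N (dim K)))
                                    (precompose (mod N) relations) in r , Dim-≅ (≅-sym iso) D
    where
    module N = RightModule (mod N)
    cover = freeCover M
    π = proj₁ cover
    K = kerMod {Λᴹ ^ᴹ dim M} {M} π
    relations : Λᴹ ^ᴹ dim K ⟶ Λᴹ ^ᴹ dim M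
    relations = Kernel-incl π ∘ʰ proj₁ (freeCover K)
    relations≈0 : ∀ x → π ⟨ relations ⟨ x ⟩ ⟩≈0
    relations≈0 x = proj₂ (proj₁ (freeCover K) ⟨ x ⟩)
    iso : HomSpace (mod M) (mod N) ≅ Kernel (precompose (mod N) relations)
    iso = mkHom (λ f → f ∘ʰ π , λ x → N.≈ᴹ-trans (cong-h f (relations≈0 x)) (Hom.0ᴹ-homo f))
        (λ e x → e (π ⟨ x ⟩)) (λ _ _ _ → N.≈ᴹ-refl) (λ _ _ _ → N.≈ᴹ-refl) ,
      (λ {f} {g} e y → let x , p = proj₂ cover y in
        N.≈ᴹ-trans (cong-h f (symᴹ (mod M) p)) (N.≈ᴹ-trans (e x) (cong-h g p))) ,
      λ (f , z) → factor-at π (proj₂ cover) f λ x e → let y , p = proj₂ (freeCover K) (x , e) in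
        N.≈ᴹ-trans (cong-h f (symᴹ (mod (Λᴹ ^ᴹ dim M)) p)) (z y)

  abstract
    Dim-HomSpace : (M N : Mod Λ) → ∃ (Dim (HomSpace (mod M) (mod N)))
    Dim-HomSpace = HomSpace-finite

  hom : (M N : Mod Λ) → ℕ
  hom M N = proj₁ (Dim-HomSpace M N)

  hom-unique : (M N : Mod Λ) → ∀ {n} → Dim (HomSpace (mod M) (mod N)) n → hom M N ≡ n
  hom-unique M N d = Dim-unique (proj₂ (Dim-HomSpace M N)) d

module Extensions {ℓ} {k : Field ℓ} (Λ : FDAlgebra k) where
  open HomSpaces Λ public
  private module k = Field k

  Extends : {Q N : Module} → Hom Q N → Module → Set ℓ
  Extends {Q} π V = ∀ (g : Hom (Kernel π) V) → Σ (Hom Q V) λ h → ∀ x → V ∋ h ⟨ proj₁ x ⟩ ≈ g ⟨ x ⟩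

  -- Vanishing of Ext¹(N, V), computed with projective presentations of N.
  ExtVanishes : (N V : Mod Λ) → Set (lsuc ℓ)
  ExtVanishes N V = ∀ (Q : Mod Λ) (π : Q ⟶ N) → Projective Q → Surjective π → Extends π (mod V)

  Extends⇒ExtVanishes : {N N′ Q : Mod Λ} {V : Mod Λ} → mod N′ ◁ mod N → (π : Q ⟶ N) → Projective Q → Surjective π →
    Extends π (mod V) → ExtVanishes N′ V
  Extends⇒ExtVanishes {N} {N′} {Q} {V} (i , r , ri) π pQ π-surj ext Q′ π′ pQ′ π′-surj g =
      (h ∘ʰ a +ʰ g ∘ʰ rest) , λ (x , π′x≈0) → V.≈ᴹ-trans (V.+ᴹ-cong
        (h-ok (a ⟨ x ⟩ , N.≈ᴹ-trans (πa≈iπ′ x) (N.≈ᴹ-trans (cong-h i π′x≈0) (Hom.0ᴹ-homo i)))) V.≈ᴹ-refl)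
        (V.≈ᴹ-trans (V.≈ᴹ-sym (Hom.+ᴹ-homo g _ _)) (cong-h g (Q′.≈ᴹ-trans (Q′.+ᴹ-comm _ _) (Q′.⊖-+ x _))))
    where
    module V = ModuleOps (mod V)
    module N = ModuleOps (mod N)
    module N′ = ModuleOps (mod N′)
    module Q′ = ModuleOps (mod Q′)
    lift-a = pQ′ Q N π π-surj (i ∘ʰ π′)
    a = proj₁ lift-a
    πa≈iπ′ = proj₂ lift-a
    lift-b = pQ Q′ N′ π′ π′-surj (r ∘ʰ π)
    b = proj₁ lift-b
    π′b≈rπ = proj₂ lift-b
    b′ : Hom (Kernel π) (Kernel π′)
    b′ = mkHom (λ (x , e) → b ⟨ x ⟩ , N′.≈ᴹ-trans (π′b≈rπ x) (N′.≈ᴹ-trans (cong-h r e) (Hom.0ᴹ-homo r)))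
      (cong-h b) (λ _ _ → Hom.+ᴹ-homo b _ _) (λ _ _ → Hom.*ᵣ-homo b _ _)
    extended = ext (g ∘ʰ b′)
    h = proj₁ extended
    h-ok = proj₂ extended
    p : Hom (mod Q′) (mod Q′)
    p = idʰ -ʰ b ∘ʰ a
    rest : Hom (mod Q′) (Kernel π′)
    rest = mkHom (λ x → p ⟨ x ⟩ , N′.≈ᴹ-trans (⊖-homo π′ _ _) (N′.≈⇒⊖≈0 (N′.≈ᴹ-sym
        (N′.≈ᴹ-trans (π′b≈rπ _) (N′.≈ᴹ-trans (cong-h r (πa≈iπ′ x)) (ri _))))))
      (cong-h p) (Hom.+ᴹ-homo p) (Hom.*ᵣ-homo p)

  abstract
    presentation : (M : Mod Λ) → Σ (Mod Λ) λ Q → Projective Q × Σ (Q ⟶ M) Surjective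
    presentation M = Λᴹ ^ᴹ dim M , ^-projective {Λᴹ} Λ-projective (dim M) , freeCover M

  module Presentation (M : Mod Λ) where
    Q : Mod Λ
    Q = proj₁ (presentation M)
    Q-projective : Projective Q
    Q-projective = proj₁ (proj₂ (presentation M))
    π : Q ⟶ M
    π = proj₁ (proj₂ (proj₂ (presentation M)))
    π-surjective : Surjective π
    π-surjective = proj₂ (proj₂ (proj₂ (presentation M)))
    K : Mod Λ
    K = kerMod {Q} {M} π

  ExtVanishes-◁ : {N N′ V : Mod Λ} → mod N′ ◁ mod N → ExtVanishes N V → ExtVanishes N′ V
  ExtVanishes-◁ {N} {N′} {V} s ext =
    Extends⇒ExtVanishes {N} {N′} {Q} {V} s π Q-projective π-surjective (ext Q π Q-projective π-surjective)
    where open Presentation N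

  ExtVanishes-stable : {N V : Mod Λ} → ¬ ¬ ExtVanishes N V → ExtVanishes N V
  ExtVanishes-stable {N} {V} nn = Extends⇒ExtVanishes {N} {N} {Q} {V} ◁-refl π Q-projective π-surjective extend
    where
    open Presentation N
    extend : Extends π (mod V)
    extend g with solve (proj₂ (Dim-HomSpace Q V)) (proj₂ (Dim-HomSpace K V)) (precompose (mod V) (Kernel-incl π)) g
    ... | inj₁ h = h
    ... | inj₂ (ψ , ψ≈0 , ψg≈1) = ⊥-elim (nn λ ext → let h , e = ext Q π Q-projective π-surjective g in
      k.1≉0 (k.trans (k.sym ψg≈1) (k.trans (k.sym (cong-h ψ {precompose (mod V) (Kernel-incl π) ⟨ h ⟩} {g} e)) (ψ≈0 h))))

  ExtVanishes⇒Ext¹-vanishes : {M N : Mod Λ} → ExtVanishes M N → Ext¹-vanishes M N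
  ExtVanishes⇒Ext¹-vanishes {M} {N} ext (E , se) = ⟨ r , p ⟩ʰ ,
      (λ n → i-inj (E.≈ᴹ-trans (r-ok _) (E.≈ᴹ-trans (E.⊖-cong E.≈ᴹ-refl
        (E.≈ᴹ-trans (cong-h s (p∘i≈0 n)) (Hom.0ᴹ-homo s))) (E.⊖-identityʳ _))) , p∘i≈0 n) ,
      λ e → M.≈ᴹ-refl
    where
    open ShortExact se
    module E = ModuleOps E
    module M = ModuleOps (mod M)
    module N = ModuleOps (mod N)
    Eᴹ : Mod Λ
    Eᴹ = toMod E (Dim-exact (resʰ i) (resʰ p) i-inj p-surj p∘i≈0 ker⊆im (hasDim N) (hasDim M))
    open Presentation M
    lift = Q-projective Eᴹ M p p-surj π
    q = proj₁ lift
    pq≈π = proj₂ lift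
    restricted = corestrict i i-inj (q ∘ʰ Kernel-incl π) (λ (x , e) → ker⊆im _ (M.≈ᴹ-trans (pq≈π x) e))
    extended = ext Q π Q-projective π-surjective (proj₁ restricted)
    h = proj₁ extended
    section = factor-at π π-surjective (q -ʰ i ∘ʰ h) λ x e → E.≈⇒⊖≈0
      (E.≈ᴹ-sym (E.≈ᴹ-trans (cong-h i (proj₂ extended (x , e))) (proj₂ restricted (x , e))))
    s = proj₁ section
    ps≈id : ∀ y → mod M ∋ p ⟨ s ⟨ y ⟩ ⟩ ≈ y
    ps≈id y = let x , e = π-surjective y in
      M.≈ᴹ-trans (cong-h p (E.≈ᴹ-trans (cong-h s (M.≈ᴹ-sym e)) (proj₂ section x)))
      (M.≈ᴹ-trans (⊖-homo p _ _) (M.≈ᴹ-trans (M.⊖-cong (pq≈π x) (p∘i≈0 _)) (M.≈ᴹ-trans (M.⊖-identityʳ _) e)))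
    retraction = corestrict i i-inj (idʰ -ʰ s ∘ʰ p) λ e → ker⊆im _
      (M.≈ᴹ-trans (⊖-homo p _ _) (M.≈⇒⊖≈0 (M.≈ᴹ-sym (ps≈id _))))
    r = proj₁ retraction
    r-ok = proj₂ retraction

  -- The extension pushed out along Ker π → V splits.
  Ext¹-vanishes⇒ExtVanishes : {N V : Mod Λ} → Ext¹-vanishes N V → ExtVanishes N V
  Ext¹-vanishes⇒ExtVanishes {N} {V} ext Q π pQ π-surj g = 0ʰ -ʰ r ∘ʰ ⊕-inj₂ (mod V) (mod Q) , λ z →
      V.≈ᴹ-trans (V.+ᴹ-identityˡ _) (V.≈ᴹ-sym (V.inverseˡ-unique _ _ (V.≈ᴹ-trans (V.+ᴹ-congʳ (V.≈ᴹ-sym (r-inj₁ (g ⟨ z ⟩))))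
        (V.≈ᴹ-trans (V.≈ᴹ-sym (⊕-split r _ _)) (V.≈ᴹ-trans (cong-h (⊕-proj₁ (mod V) (mod N) ∘ʰ φ) (coker-∘ f z))
          (Hom.0ᴹ-homo (⊕-proj₁ (mod V) (mod N) ∘ʰ φ)))))))
    where
    module V = ModuleOps (mod V)
    module N = ModuleOps (mod N)
    module Q = ModuleOps (mod Q)
    f : Hom (Kernel π) (mod V ⊕ mod Q)
    f = ⟨ g , Kernel-incl π ⟩ʰ
    i : Hom (mod V) (Coker f)
    i = coker f ∘ʰ ⊕-inj₁ (mod V) (mod Q)
    projection = factor-at (coker f) (coker-surjective f) (π ∘ʰ ⊕-proj₂ (mod V) (mod Q)) λ x e →
      let (z , πz≈0) , (_ , d) = coker-exact f x e in N.≈ᴹ-trans (cong-h π (Q.≈ᴹ-sym d)) πz≈0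
    p : Hom (Coker f) (mod N)
    p = proj₁ projection
    se : ShortExact (mod V) (Coker f) (mod N)
    se = record
      { i = i
      ; p = p
      ; i-inj = ker≈0⇒injective i λ v e → let z , (d , d′) = coker-exact f (v , Q.0ᴹ) e in
          V.≈ᴹ-trans (V.≈ᴹ-sym d) (V.≈ᴹ-trans (cong-h g {z} {zeroᴹ (Kernel π)} d′) (Hom.0ᴹ-homo g))
      ; p-surj = λ y → let x , e = π-surj y in (V.0ᴹ , x) , e
      ; p∘i≈0 = λ _ → Hom.0ᴹ-homo π
      ; ker⊆im = λ (v , y) e → v V.⊖ g ⟨ y , e ⟩ ,
          symᴹ (Coker f) ((y , e) , V.≈ᴹ-sym (V.≈ᴹ-trans (V.+ᴹ-comm _ _) (V.⊖-+ v _)) , Q.≈ᴹ-sym (Q.+ᴹ-identityʳ y))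
      }
    split = ext (Coker f , se)
    φ = proj₁ split
    r : Hom (mod V ⊕ mod Q) (mod V)
    r = ⊕-proj₁ (mod V) (mod N) ∘ʰ φ ∘ʰ coker f
    r-inj₁ : ∀ v → mod V ∋ r ⟨ v , Q.0ᴹ ⟩ ≈ v
    r-inj₁ v = proj₁ (proj₁ (proj₂ split) v)

  ExtVanishes-⊕ : {A B V : Mod Λ} → ExtVanishes A V → ExtVanishes B V → ExtVanishes (A ⊕ᴹ B) V
  ExtVanishes-⊕ {A} {B} {V} extA extB = Extends⇒ExtVanishes {A ⊕ᴹ B} {A ⊕ᴹ B} {QA ⊕ᴹ QB} {V} ◁-refl π
      (⊕-projective {QA} {QB} pA pB) (λ (x , y) → let a , d = πA-surj x ; b , e = πB-surj y in (a , b) , d , e)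
      λ g → let h , d = extA QA πA pA πA-surj (g ∘ʰ κA) ; h′ , e = extB QB πB pB πB-surj (g ∘ʰ κB) in
        [ h , h′ ]ʰ , λ ((x , y) , (zx , zy)) → V.≈ᴹ-trans (V.+ᴹ-cong (d (x , zx)) (e (y , zy)))
          (V.≈ᴹ-trans (V.≈ᴹ-sym (Hom.+ᴹ-homo g _ _)) (cong-h g (QA.+ᴹ-identityʳ x , QB.+ᴹ-identityˡ y)))
    where
    module V = RightModule (mod V)
    open Presentation A renaming (Q to QA; Q-projective to pA; π to πA; π-surjective to πA-surj) hiding (K)
    open Presentation B renaming (Q to QB; Q-projective to pB; π to πB; π-surjective to πB-surj) hiding (K)
    module QA = RightModule (mod QA)
    module QB = RightModule (mod QB)
    π : Hom (mod QA ⊕ mod QB) (mod A ⊕ mod B)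
    π = ⟨ πA ∘ʰ ⊕-proj₁ (mod QA) (mod QB) , πB ∘ʰ ⊕-proj₂ (mod QA) (mod QB) ⟩ʰ
    κA : Hom (Kernel πA) (Kernel π)
    κA = mkHom (λ (x , e) → (x , QB.0ᴹ) , e , Hom.0ᴹ-homo πB) (λ e → e , QB.≈ᴹ-refl)
      (λ _ _ → QA.≈ᴹ-refl , QB.≈ᴹ-sym (QB.+ᴹ-identityˡ _)) (λ r _ → QA.≈ᴹ-refl , QB.≈ᴹ-sym (QB.*ᵣ-zeroˡ r))
    κB : Hom (Kernel πB) (Kernel π)
    κB = mkHom (λ (y , e) → (QA.0ᴹ , y) , Hom.0ᴹ-homo πA , e) (λ e → QA.≈ᴹ-refl , e)
      (λ _ _ → QA.≈ᴹ-sym (QA.+ᴹ-identityˡ _) , QB.≈ᴹ-refl) (λ r _ → QA.≈ᴹ-sym (QA.*ᵣ-zeroˡ r) , QB.≈ᴹ-refl)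

module AuslanderReiten {ℓ} {k : Field ℓ} (Λ : FDAlgebra k) where
  open Extensions Λ public
  private
    module k = Field k
    module Λ = FDAlgebra Λ

  element-1 : {M : Module} (f : Hom Λ.regular M) → f ≈ʰ element M (f ⟨ Λ.1# ⟩)
  element-1 {M} f r = M.≈ᴹ-sym (M.≈ᴹ-trans (M.≈ᴹ-sym (Hom.*ᵣ-homo f r Λ.1#)) (cong-h f (Λ.*-identityˡ r)))
    where module M = RightModule M

  -- A balanced pairing of M with P* = Hom(P, Λ) is a functional on M ⊗ P*. On the composite of
  -- w : Λᶜ → M and e : P → Λᶜ, which stands for Σ wᵢ ⊗ eᵢ, its value depends only on w ∘ e,
  -- that is, M ⊗ P* → Hom(P, M) is injective for projective P.
  module Pairing (M P : Module) (B : El M → Hom P Λ.regular → k.Carrier)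
    (B-congˡ : ∀ {x y} α → M ∋ x ≈ y → B x α k.≈ B y α)
    (B-congʳ : ∀ x α β → α ≈ʰ β → B x α k.≈ B x β)
    (B-+ˡ : ∀ x y α → B (RightModule._+ᴹ_ M x y) α k.≈ B x α k.+ B y α)
    (B-+ʳ : ∀ x α β → B x (α +ʰ β) k.≈ B x α k.+ B x β)
    (B-* : ∀ x r α → B (RightModule._*ᵣ_ M x r) α k.≈ B x (element Λ.regular r ∘ʰ α)) where
    private
      module M = ModuleOps M
      module K = ModuleOps K¹

    F : ℕ → Module
    F n = mod (Λᴹ ^ᴹ n)

    module F n = RightModule (F n)

    head : ∀ n → Hom P (F (suc n)) → Hom P Λ.regular
    head n e = ⊕-proj₁ Λ.regular (F n) ∘ʰ e

    tail : ∀ n → Hom P (F (suc n)) → Hom P (F n)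
    tail n e = ⊕-proj₂ Λ.regular (F n) ∘ʰ e

    rest : ∀ n {N : Module} → Hom (F (suc n)) N → Hom (F n) N
    rest n w = w ∘ʰ ⊕-inj₂ Λ.regular (F n)

    first : ∀ n {N : Module} → Hom (F (suc n)) N → Hom Λ.regular N
    first n w = w ∘ʰ ⊕-inj₁ Λ.regular (F n)

    double≈0 : ∀ {c} → c k.≈ c k.+ c → c k.≈ k.0#
    double≈0 {c} e = k.trans (k.sym (K.+-⊖ c c)) (K.≈⇒⊖≈0 (k.sym e))

    B-0ˡ : ∀ α → B M.0ᴹ α k.≈ k.0#
    B-0ˡ α = double≈0 (k.trans (B-congˡ α (M.≈ᴹ-sym (M.+ᴹ-identityˡ _))) (B-+ˡ _ _ α))

    B-0ʳ : ∀ x α → IsZeroHom α → B x α k.≈ k.0#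
    B-0ʳ x α z = double≈0 (k.trans (B-congʳ x α (α +ʰ α) (λ u → Λ.trans (Λ.sym (Λ.+-identityˡ _)) (Λ.+-congʳ (Λ.sym (z u))))) (B-+ʳ x α α))

    Ψ : ∀ n → Hom (F n) M → Hom P (F n) → k.Carrier
    Ψ zero w e = k.0#
    Ψ (suc n) w e = B (first n w ⟨ Λ.1# ⟩) (head n e) k.+ Ψ n (rest n w) (tail n e)

    Ψ-cong : ∀ n v w e f → v ≈ʰ w → e ≈ʰ f → Ψ n v e k.≈ Ψ n w f
    Ψ-cong zero v w e f d d′ = k.refl
    Ψ-cong (suc n) v w e f d d′ = k.+-cong
      (k.trans (B-congˡ (head n e) (d _)) (B-congʳ _ (head n e) (head n f) (λ u → proj₁ (d′ u))))
      (Ψ-cong n (rest n v) (rest n w) (tail n e) (tail n f) (λ x → d _) (λ u → proj₂ (d′ u)))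

    Ψ-congʳ : ∀ n w e f → e ≈ʰ f → Ψ n w e k.≈ Ψ n w f
    Ψ-congʳ n w e f d = Ψ-cong n w w e f (λ _ → M.≈ᴹ-refl) d

    Ψ-congˡ : ∀ n v w e → v ≈ʰ w → Ψ n v e k.≈ Ψ n w e
    Ψ-congˡ n v w e d = Ψ-cong n v w e e d (λ _ → F.≈ᴹ-refl n)

    Ψ-+ʳ : ∀ n w e f → Ψ n w (e +ʰ f) k.≈ Ψ n w e k.+ Ψ n w f
    Ψ-+ʳ zero w e f = k.sym (k.+-identityˡ _)
    Ψ-+ʳ (suc n) w e f = k.trans (k.+-cong
        (k.trans (B-congʳ _ (head n (e +ʰ f)) (head n e +ʰ head n f) (λ _ → Λ.refl)) (B-+ʳ _ (head n e) (head n f)))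
        (k.trans (Ψ-congʳ n (rest n w) (tail n (e +ʰ f)) (tail n e +ʰ tail n f) (λ _ → F.≈ᴹ-refl n)) (Ψ-+ʳ n (rest n w) (tail n e) (tail n f))))
      (K.interchange _ _ _ _)

    Ψ-0ʳ : ∀ n w e → IsZeroHom e → Ψ n w e k.≈ k.0#
    Ψ-0ʳ n w e z = double≈0 (k.trans
      (Ψ-congʳ n w e (e +ʰ e) (λ u → F.≈ᴹ-trans n (F.≈ᴹ-sym n (F.+ᴹ-identityˡ n _)) (F.+ᴹ-congʳ n (F.≈ᴹ-sym n (z u)))))
      (Ψ-+ʳ n w e e))

    Ψ-basis : ∀ n v (b : Hom Λ.regular (F n)) α → Ψ n v (b ∘ʰ α) k.≈ B (v ⟨ b ⟨ Λ.1# ⟩ ⟩) α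
    Ψ-basis zero v b α = k.sym (k.trans (B-congˡ α (Hom.0ᴹ-homo v)) (B-0ˡ α))
    Ψ-basis (suc n) v b α = k.trans (k.+-cong first-term rest-terms)
        (k.trans (k.sym (B-+ˡ _ _ α)) (B-congˡ α (M.≈ᴹ-sym (⊕-split v _ _))))
      where
      b₁ : Hom Λ.regular Λ.regular
      b₁ = ⊕-proj₁ Λ.regular (F n) ∘ʰ b
      b₂ : Hom Λ.regular (F n)
      b₂ = ⊕-proj₂ Λ.regular (F n) ∘ʰ b
      r : Λ.Carrier
      r = b₁ ⟨ Λ.1# ⟩
      first-term : B (first n v ⟨ Λ.1# ⟩) (head n (b ∘ʰ α)) k.≈ B (first n v ⟨ r ⟩) α
      first-term = k.trans (B-congʳ _ (head n (b ∘ʰ α)) (element Λ.regular r ∘ʰ α) (λ u → element-1 b₁ (α ⟨ u ⟩)))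
        (k.trans (k.sym (B-* _ r α)) (B-congˡ α (M.≈ᴹ-sym (element-1 (first n v) r))))
      rest-terms : Ψ n (rest n v) (tail n (b ∘ʰ α)) k.≈ B (rest n v ⟨ b₂ ⟨ Λ.1# ⟩ ⟩) α
      rest-terms = k.trans (Ψ-congʳ n (rest n v) (tail n (b ∘ʰ α)) (b₂ ∘ʰ α) (λ _ → F.≈ᴹ-refl n)) (Ψ-basis n (rest n v) b₂ α)

    split : ∀ n {N : Module} (β : Hom (F (suc n)) N) (e : Hom P (F (suc n))) →
      β ∘ʰ e ≈ʰ first n β ∘ʰ head n e +ʰ rest n β ∘ʰ tail n e
    split n β e u = ⊕-split β _ _

    Ψ-balanced : ∀ n m v (β : Hom (F n) (F m)) e → Ψ m v (β ∘ʰ e) k.≈ Ψ n (v ∘ʰ β) e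
    Ψ-balanced zero m v β e = Ψ-0ʳ m v (β ∘ʰ e) (λ u → Hom.0ᴹ-homo β)
    Ψ-balanced (suc n) m v β e = k.trans (Ψ-congʳ m v (β ∘ʰ e) (first n β ∘ʰ head n e +ʰ rest n β ∘ʰ tail n e) (split n β e))
      (k.trans (Ψ-+ʳ m v (first n β ∘ʰ head n e) (rest n β ∘ʰ tail n e))
      (k.+-cong (Ψ-basis m v (first n β) (head n e))
        (k.trans (Ψ-balanced n m v (rest n β) (tail n e))
          (Ψ-congˡ n (v ∘ʰ rest n β) (rest n (v ∘ʰ β)) (tail n e) (λ _ → M.≈ᴹ-refl)))))

    B-through : ∀ n x (γ : Hom (F n) Λ.regular) e → B x (γ ∘ʰ e) k.≈ Ψ n (element M x ∘ʰ γ) e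
    B-through zero x γ e = B-0ʳ x (γ ∘ʰ e) (λ u → Hom.0ᴹ-homo γ)
    B-through (suc n) x γ e = k.trans (B-congʳ x (γ ∘ʰ e) (first n γ ∘ʰ head n e +ʰ rest n γ ∘ʰ tail n e) (split n γ e))
      (k.trans (B-+ʳ x (first n γ ∘ʰ head n e) (rest n γ ∘ʰ tail n e))
      (k.+-cong
        (k.trans (B-congʳ x (first n γ ∘ʰ head n e) (element Λ.regular r ∘ʰ head n e) (λ u → element-1 (first n γ) _))
          (k.sym (B-* x r (head n e))))
        (k.trans (B-through n x (rest n γ) (tail n e))
          (Ψ-congˡ n (element M x ∘ʰ rest n γ) (rest n (element M x ∘ʰ γ)) (tail n e) (λ _ → M.≈ᴹ-refl)))))
      where
      r : Λ.Carrier
      r = first n γ ⟨ Λ.1# ⟩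

    Ψ-vanishes : {P₀ : Module} (d : Hom P P₀) → (∀ x (β : Hom P₀ Λ.regular) → B x (β ∘ʰ d) k.≈ k.0#) →
      ∀ n w (e : Hom P₀ (F n)) → Ψ n w (e ∘ʰ d) k.≈ k.0#
    Ψ-vanishes d z zero w e = k.refl
    Ψ-vanishes d z (suc n) w e = k.trans (k.+-cong
      (k.trans (B-congʳ _ (head n (e ∘ʰ d)) ((⊕-proj₁ Λ.regular (F n) ∘ʰ e) ∘ʰ d) (λ _ → Λ.refl)) (z _ (⊕-proj₁ Λ.regular (F n) ∘ʰ e)))
      (k.trans (Ψ-congʳ n (rest n w) (tail n (e ∘ʰ d)) ((⊕-proj₂ Λ.regular (F n) ∘ʰ e) ∘ʰ d) (λ _ → F.≈ᴹ-refl n))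
        (Ψ-vanishes d z n (rest n w) (⊕-proj₂ Λ.regular (F n) ∘ʰ e)))) (k.+-identityˡ _)

    pairing-vanishes : {P₀ : Module} (d : Hom P P₀) → (∀ x (β : Hom P₀ Λ.regular) → B x (β ∘ʰ d) k.≈ k.0#) →
      ∀ n (s : Hom P (F n)) (f : Hom (F n) P) → f ∘ʰ s ≈ʰ idʰ →
      ∀ m (s₀ : Hom P₀ (F m)) (f₀ : Hom (F m) P₀) → f₀ ∘ʰ s₀ ≈ʰ idʰ →
      ∀ x α (h : Hom P₀ M) → h ∘ʰ d ≈ʰ element M x ∘ʰ α → B x α k.≈ k.0#
    pairing-vanishes {P₀} d z n s f fs m s₀ f₀ fs₀ x α h hd≈xα =
      k.trans (B-congʳ x α ((α ∘ʰ f) ∘ʰ s) (λ u → Hom.⟦⟧-cong α (P.≈ᴹ-sym (fs u))))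
      (k.trans (B-through n x (α ∘ʰ f) s)
      (k.trans (Ψ-congˡ n (element M x ∘ʰ (α ∘ʰ f)) ((h ∘ʰ f₀) ∘ʰ t) s
        (λ y → M.≈ᴹ-trans (M.≈ᴹ-sym (hd≈xα (f ⟨ y ⟩))) (Hom.⟦⟧-cong h (P₀.≈ᴹ-sym (fs₀ (d ⟨ f ⟨ y ⟩ ⟩))))))
      (k.trans (k.sym (Ψ-balanced n m (h ∘ʰ f₀) t s))
      (k.trans (Ψ-congʳ m (h ∘ʰ f₀) (t ∘ʰ s) (s₀ ∘ʰ d) (λ u → Hom.⟦⟧-cong s₀ (Hom.⟦⟧-cong d (fs u))))
        (Ψ-vanishes d z m (h ∘ʰ f₀) s₀)))))
      where
      module P = RightModule P
      module P₀ = RightModule P₀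
      t : Hom (F n) (F m)
      t = s₀ ∘ʰ (d ∘ʰ f)

module AuslanderReitenFormula {ℓ} {k : Field ℓ} (Λ : FDAlgebra k) where
  open AuslanderReiten Λ public
  private
    module k = Field k
    module Λ = FDAlgebra Λ

  record Coordinates (P : Mod Λ) : Set ℓ where
    field
      n  : ℕ
      s  : P ⟶ Λᴹ ^ᴹ n
      f  : Λᴹ ^ᴹ n ⟶ P
      fs : f ∘ʰ s ≈ʰ idʰ

  abstract
    coordinates : {P : Mod Λ} → Projective P → Coordinates P
    coordinates {P} pP = let s , fs = pP (Λᴹ ^ᴹ dim P) P (proj₁ (freeCover P)) (proj₂ (freeCover P)) idʰ in
      record { n = dim P ; s = s ; f = proj₁ (freeCover P) ; fs = fs }

  cover-section : Hereditary Λ → {N : Mod Λ} (p : MinimalPresentation N) → let open MinimalPresentation p in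
    Σ (Hom (Kernel d₀) (mod P₁)) λ s → (d₁ ∘ʰ s ≈ʰ idʰ) × (s ∘ʰ d₁ ≈ʰ idʰ)
  cover-section her {N} p = s , d₁s , λ u → let x , e = s-surj u in
      P₁.≈ᴹ-trans (Hom.⟦⟧-cong s {d₁ ⟨ u ⟩} {d₁ ⟨ s ⟨ x ⟩ ⟩} (Hom.⟦⟧-cong d₁ (P₁.≈ᴹ-sym e))) (P₁.≈ᴹ-trans (Hom.⟦⟧-cong s {d₁ ⟨ s ⟨ x ⟩ ⟩} {x} (d₁s x)) e)
    where
    open MinimalPresentation p
    module P₁ = RightModule (mod P₁)
    Kᴹ = kerMod {P₀} {N} d₀
    split = her P₀ Kᴹ (Kernel-incl d₀) (IsProjectiveCover.projective d₀-cover) (λ e → e) P₁ Kᴹ d₁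
      (IsProjectiveCover.surjective d₁-cover) idʰ
    s : Hom (Kernel d₀) (mod P₁)
    s = proj₁ split
    d₁s = proj₂ split
    s-surj : Surjective s
    s-surj = IsProjectiveCover.essential d₁-cover Kᴹ s λ y → y , d₁s y

  ExtVanishes⇒Hom-τ-vanishes : Hereditary Λ → {N M : Mod Λ} → ExtVanishes N M → Hom-τ-vanishes M N
  ExtVanishes⇒Hom-τ-vanishes her {N} {M} ext p φ x α =
      pairing-vanishes d B-∘d n s f fs n₀ s₀ f₀ fs₀ x α (proj₁ extended)
        λ u → M.≈ᴹ-trans (proj₂ extended (d₁ ⟨ u ⟩)) (M.*ᵣ-congˡ (Hom.⟦⟧-cong α (proj₂ (proj₂ section) u)))
    where
    open MinimalPresentation p
    module M = ModuleOps (mod M)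
    d : P₁ ⟶ P₀
    d = Kernel-incl d₀ ∘ʰ d₁
    P₁* : LeftModule Λ.ring ℓ ℓ
    P₁* = _* {R = Λ.ring} (mod P₁)
    B : El (mod M) → Hom (mod P₁) Λ.regular → k.Carrier
    B y β = Homˡ.fun (Hom.fun φ y) β
    B-congʳ : ∀ y β γ → β ≈ʰ γ → B y β k.≈ B y γ
    B-congʳ y β γ e = Homˡ.⟦⟧-cong (Hom.fun φ y) {β} {γ} (0ʰ , λ u → Λ.trans (e u) (Λ.sym (Λ.+-identityʳ _)))
    B-+ʳ : ∀ y β γ → B y (β +ʰ γ) k.≈ B y β k.+ B y γ
    B-+ʳ y β γ = k.trans (B-congʳ y (β +ʰ γ) (LeftModule._+ᴹ_ P₁* β γ) (λ _ → Λ.refl)) (Homˡ.+ᴹ-homo (Hom.fun φ y) β γ)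
    B-* : ∀ y r β → B (y M.*ᵣ r) β k.≈ B y (element Λ.regular r ∘ʰ β)
    B-* y r β = k.trans (Hom.*ᵣ-homo φ r y β) (B-congʳ y (LeftModule._*ₗ_ P₁* r β) (element Λ.regular r ∘ʰ β) (λ _ → Λ.refl))
    B-∘d : ∀ y β → B y (β ∘ʰ d) k.≈ k.0#
    B-∘d y β = k.trans (Homˡ.⟦⟧-cong (Hom.fun φ y) {β ∘ʰ d} {LeftModule.0ᴹ P₁*} (β , λ u → Λ.sym (Λ.+-identityˡ _)))
      (Homˡ.0ᴹ-homo (Hom.fun φ y))
    open Pairing (mod M) (mod P₁) B (λ β e → Hom.⟦⟧-cong φ e β) B-congʳ (λ y z β → Hom.+ᴹ-homo φ y z β) B-+ʳ B-*
      using (pairing-vanishes)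
    open Coordinates (coordinates {P₁} (IsProjectiveCover.projective d₁-cover))
    open Coordinates (coordinates {P₀} (IsProjectiveCover.projective d₀-cover)) renaming (s to s₀; f to f₀; fs to fs₀; n to n₀)
    section = cover-section her {N} p
    extended = ext P₀ d₀ (IsProjectiveCover.projective d₀-cover) (IsProjectiveCover.surjective d₀-cover)
      (element (mod M) x ∘ʰ α ∘ʰ proj₁ section)

  minimalPresentation : Hereditary Λ → (M : Mod Λ) → ¬ ¬ MinimalPresentation M
  minimalPresentation her M = minimal μ start >>= λ ((P , pP , π , surj) , least) → return record
      { P₁ = kerMod {P} {M} π
      ; P₀ = P
      ; d₀ = π
      ; d₁ = idʰ
      ; d₀-cover = record { projective = pP ; surjective = surj ; essential = λ Y g → essential P pP π surj least {Y} g }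
      ; d₁-cover = record
        { projective = her P (kerMod {P} {M} π) (Kernel-incl π) pP (λ e → e)
        ; surjective = λ y → y , reflᴹ (mod P)
        ; essential = λ Y g surj → surj
        }
      }
    where
    module M = RightModule (mod M)
    Cover : Set _
    Cover = Σ (Mod Λ) λ P → Projective P × Σ (P ⟶ M) Surjective
    μ : Cover → ℕ
    μ (P , _) = dim P
    start : Cover
    start = presentation M
    essential : ∀ P (pP : Projective P) (π : P ⟶ M) (surj : Surjective π) → (∀ c → dim P ℕ.≤ μ c) →
      ∀ {Y} (g : Y ⟶ P) → Surjective (π ∘ʰ g) → Surjective g
    essential P pP π surj least {Y} g πg-surj = surjective-stable {Y} {P} g λ not-surj →
      fitting {P} e λ (n , stable) → not-surj λ y →
        let z , p = endo-surjective {P} e (λ {x} {x′} → e-injective n stable {x} {x′}) y in proj₁ lift ⟨ z ⟩ , p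
      where
      lift = pP Y M (π ∘ʰ g) πg-surj π
      e : P ⟶ P
      e = g ∘ʰ proj₁ lift
      πe≈π : π ∘ʰ e ≈ʰ π
      πe≈π = proj₂ lift
      module P = RightModule (mod P)
      e-injective : ∀ n → (∀ x → (e ^ʰ suc n) ⟨ (e ^ʰ suc n) ⟨ x ⟩ ⟩≈0 → (e ^ʰ suc n) ⟨ x ⟩≈0) → Injective e
      e-injective n stable = ker≈0⇒injective e λ x ex≈0 → injective⇒ker≈0 (coim {P} {P} eⁿ) coim-inj x
          (coim-ker {P} {P} eⁿ x (P.≈ᴹ-trans (P.≈ᴹ-sym (^ʰ-comm {P} e n x)) (P.≈ᴹ-trans (cong-h (e ^ʰ n) ex≈0) (Hom.0ᴹ-homo (e ^ʰ n)))))
        where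
        eⁿ = e ^ʰ suc n
        C = coimMod {P} {P} eⁿ
        C◁P : mod C ◁ mod P
        C◁P = ◁-trans ⊕-◁₂ (≅⇒◁ (stable⇒splits {P} eⁿ stable))
        C-surj : Surjective (π ∘ʰ image {P} {P} eⁿ)
        C-surj y = let x , p = surj y in x , M.≈ᴹ-trans (^ʰ-fix {P} π e πe≈π (suc n) x) p
        coim-inj : Injective (coim {P} {P} eⁿ)
        coim-inj = surjective∧dim≤⇒injective {P} {C} (coim {P} {P} eⁿ) (coker-surjective (Kernel-incl eⁿ))
          (least (C , ◁-projective {P} {C} pP C◁P , π ∘ʰ image {P} {P} eⁿ , C-surj))

  module Functional (M P : Module) (ψ : Hom (HomSpace P M) K¹) where
    private
      module M = ModuleOps M
      module P* = LeftModule (_* {R = Λ.ring} P)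

    ψ-cong : (f g : Hom P M) → f ≈ʰ g → ψ ⟨ f ⟩ k.≈ ψ ⟨ g ⟩
    ψ-cong f g e = Hom.⟦⟧-cong ψ {f} {g} e

    value : El M → Hom P Λ.regular → k.Carrier
    value x α = ψ ⟨ element M x ∘ʰ α ⟩

    value-congˡ : ∀ {x y} → M ∋ x ≈ y → ∀ α → value x α k.≈ value y α
    value-congˡ {x} {y} e α = ψ-cong (element M x ∘ʰ α) (element M y ∘ʰ α) λ u → M.*ᵣ-congʳ e

    value-+ˡ : ∀ x y α → value (x M.+ᴹ y) α k.≈ value x α k.+ value y α
    value-+ˡ x y α = k.trans (ψ-cong (element M (x M.+ᴹ y) ∘ʰ α) (element M x ∘ʰ α +ʰ element M y ∘ʰ α) (λ u → M.*ᵣ-distribʳ _ x y))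
      (Hom.+ᴹ-homo ψ (element M x ∘ʰ α) (element M y ∘ʰ α))

    value-+ʳ : ∀ x α β → value x (α P*.+ᴹ β) k.≈ value x α k.+ value x β
    value-+ʳ x α β = k.trans (ψ-cong (element M x ∘ʰ (α P*.+ᴹ β)) (element M x ∘ʰ α +ʰ element M x ∘ʰ β) (λ u → M.*ᵣ-distribˡ x _ _))
      (Hom.+ᴹ-homo ψ (element M x ∘ʰ α) (element M x ∘ʰ β))

    value-*ˡ : ∀ r x α → value (x M.*ᵣ r) α k.≈ value x (r P*.*ₗ α)
    value-*ˡ r x α = ψ-cong (element M (x M.*ᵣ r) ∘ʰ α) (element M x ∘ʰ (r P*.*ₗ α)) λ u → M.*ᵣ-assoc x r _

    value-*ʳ : ∀ x c α → value x (Λ.ι c P*.*ₗ α) k.≈ c k.* value x α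
    value-*ʳ x c α = k.trans (ψ-cong (element M x ∘ʰ (Λ.ι c P*.*ₗ α))
        (RightModule._*ᵣ_ (HomSpace P M) (element M x ∘ʰ α) c)
        (λ u → M.≈ᴹ-trans (M.*ᵣ-congˡ (Λ.central c _)) (M.≈ᴹ-sym (M.*ᵣ-assoc x _ _))))
      (k.trans (Hom.*ᵣ-homo ψ c (element M x ∘ʰ α)) (k.*-comm _ _))

    value-descends : {P₀ : Module} (d : Hom P P₀) → IsZeroHom (ψ ∘ʰ precompose M d) → ∀ x {α β} (γ : Hom P₀ Λ.regular) →
      (∀ u → α ⟨ u ⟩ Λ.≈ β ⟨ u ⟩ Λ.+ γ ⟨ d ⟨ u ⟩ ⟩) → value x α k.≈ value x β
    value-descends d ψd≈0 x {α} {β} γ e = k.trans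
        (ψ-cong (element M x ∘ʰ α) (element M x ∘ʰ β +ʰ (element M x ∘ʰ γ) ∘ʰ d) (λ u → M.≈ᴹ-trans (M.*ᵣ-congˡ (e u)) (M.*ᵣ-distribˡ x _ _)))
      (k.trans (Hom.+ᴹ-homo ψ (element M x ∘ʰ β) ((element M x ∘ʰ γ) ∘ʰ d))
        (k.trans (k.+-congˡ (ψd≈0 (element M x ∘ʰ γ))) (k.+-identityʳ _)))

    functional-hom : {P₀ : Module} (d : Hom P P₀) → IsZeroHom (ψ ∘ʰ precompose M d) →
      Hom M (D {Λ = Λ} (Cokerˡ (transpose d)))
    functional-hom {P₀} d ψd≈0 = mkHom pairing (λ {x} {y} e α → value-congˡ {x} {y} e α)
        (λ x y α → value-+ˡ x y α) (λ r x α → value-*ˡ r x α)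
      where
      pairing : M.Carrierᴹ → RightModule.Carrierᴹ (D {Λ = Λ} (Cokerˡ (transpose d)))
      pairing x = mkHomˡ (value x) (λ {α} {β} (γ , e) → value-descends d ψd≈0 x {α} {β} γ e)
        (λ α β → value-+ʳ x α β) (λ c α → value-*ʳ x c α)

    values-detect : (∀ x α → value x α k.≈ k.0#) →
      ∀ n (w : Hom (mod (Λᴹ ^ᴹ n)) M) (e : Hom P (mod (Λᴹ ^ᴹ n))) → ψ ⟨ w ∘ʰ e ⟩ k.≈ k.0#
    values-detect z zero w e = k.trans (ψ-cong (w ∘ʰ e) 0ʰ (λ _ → Hom.0ᴹ-homo w)) (Hom.0ᴹ-homo ψ)
    values-detect z (suc n) w e = k.trans
        (ψ-cong (w ∘ʰ e) (element M x ∘ʰ e₁ +ʰ w₂ ∘ʰ e₂) (λ u → M.≈ᴹ-trans (⊕-split w _ _) (M.+ᴹ-congʳ (element-1 (w ∘ʰ ⊕-inj₁ Λ.regular F) _))))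
      (k.trans (Hom.+ᴹ-homo ψ (element M x ∘ʰ e₁) (w₂ ∘ʰ e₂))
        (k.trans (k.+-cong (z x e₁) (values-detect z n w₂ e₂)) (k.+-identityˡ _)))
      where
      F = mod (Λᴹ ^ᴹ n)
      x = w ⟨ Λ.1# , zeroᴹ F ⟩
      w₂ = w ∘ʰ ⊕-inj₂ Λ.regular F
      e₁ = ⊕-proj₁ Λ.regular F ∘ʰ e
      e₂ = ⊕-proj₂ Λ.regular F ∘ʰ e

  -- The constructor keeps conversion from unfolding D L.
  record DVanishes (M : Module) (L : LeftModule Λ.ring ℓ ℓ) : Set ℓ where
    constructor wrap
    field
      unwrap : Vanishes M (D {Λ = Λ} L)

  τ-vanishes⇒functional≈0 : {M P P₀ : Module} (d : Hom P P₀) (L : LeftModule Λ.ring ℓ ℓ) → L ≡ Cokerˡ (transpose d) →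
    DVanishes M L → (ψ : Hom (HomSpace P M) K¹) → IsZeroHom (ψ ∘ʰ precompose M d) →
    ∀ n (w : Hom (mod (Λᴹ ^ᴹ n)) M) (e : Hom P (mod (Λᴹ ^ᴹ n))) → ψ ⟨ w ∘ʰ e ⟩ k.≈ k.0#
  τ-vanishes⇒functional≈0 {M} {P} d L refl (wrap vanishes) ψ ψd≈0 = values-detect λ x α → vanishes (functional-hom d ψd≈0) x α
    where open Functional M P ψ

  τ-vanishes⇒D-Tr-vanishes : {M : Module} {N : Mod Λ} (p : MinimalPresentation N) → Vanishes M (τ p) → DVanishes M (Tr p)
  τ-vanishes⇒D-Tr-vanishes p vanishes = wrap vanishes

  minimalPresentation⇒ExtVanishes : Hereditary Λ → {N M : Mod Λ} (p : MinimalPresentation N) →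
    DVanishes (mod M) (Tr p) → ExtVanishes N M
  minimalPresentation⇒ExtVanishes her {N} {M} p vanishes =
      Extends⇒ExtVanishes {N} {N} {P₀} {M} ◁-refl d₀ (IsProjectiveCover.projective d₀-cover)
        (IsProjectiveCover.surjective d₀-cover) extend
    where
    open MinimalPresentation p
    module M = RightModule (mod M)
    d : P₁ ⟶ P₀
    d = Kernel-incl d₀ ∘ʰ d₁
    section : Σ (Hom (Kernel d₀) (mod P₁)) λ s → (d₁ ∘ʰ s ≈ʰ idʰ) × (s ∘ʰ d₁ ≈ʰ idʰ)
    section = cover-section her {N} p
    open Coordinates (coordinates {P₁} (IsProjectiveCover.projective d₁-cover))
    module _ (g : Hom (Kernel d₀) (mod M)) where
      Solution : Set ℓ
      Solution = Σ (P₀ ⟶ M) λ h → ∀ x → mod M ∋ h ⟨ proj₁ x ⟩ ≈ g ⟨ x ⟩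
      extended : (∃ λ (h : P₀ ⟶ M) → h ∘ʰ d ≈ʰ g ∘ʰ d₁) → Solution
      extended (h , e) = h , λ x → M.≈ᴹ-trans (Hom.⟦⟧-cong h (symᴹ (mod P₀) (proj₁ (proj₂ section) x)))
        (M.≈ᴹ-trans (e (proj₁ section ⟨ x ⟩)) (Hom.⟦⟧-cong g {d₁ ⟨ proj₁ section ⟨ x ⟩ ⟩} {x} (proj₁ (proj₂ section) x)))
      unobstructed : ¬ ∃ λ (ψ : Hom (HomSpace (mod P₁) (mod M)) K¹) →
        IsZeroHom (ψ ∘ʰ precompose (mod M) d) × (ψ ⟨ g ∘ʰ d₁ ⟩ k.≈ k.1#)
      unobstructed (ψ , ψd≈0 , ψg≈1) = k.1≉0 (k.trans (k.sym ψg≈1) (k.trans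
        (Hom.⟦⟧-cong ψ {g ∘ʰ d₁} {((g ∘ʰ d₁) ∘ʰ f) ∘ʰ s} (λ u → Hom.⟦⟧-cong (g ∘ʰ d₁) (symᴹ (mod P₁) (fs u))))
        (τ-vanishes⇒functional≈0 {mod M} {mod P₁} {mod P₀} d (Tr p) refl vanishes ψ ψd≈0 n ((g ∘ʰ d₁) ∘ʰ f) s)))
      extend : Solution
      extend with solve (proj₂ (Dim-HomSpace P₀ M)) (proj₂ (Dim-HomSpace P₁ M)) (precompose (mod M) d) (g ∘ʰ d₁)
      ... | inj₁ solution    = extended solution
      ... | inj₂ obstruction = ⊥-elim (unobstructed obstruction)

  Hom-τ-vanishes⇒ExtVanishes : Hereditary Λ → {N M : Mod Λ} → Hom-τ-vanishes M N → ExtVanishes N M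
  Hom-τ-vanishes⇒ExtVanishes her {N} {M} vanishes = ExtVanishes-stable {N} {M} λ not-ext →
    minimalPresentation her N λ p → not-ext (minimalPresentation⇒ExtVanishes her {N} {M} p (τ-vanishes⇒D-Tr-vanishes {mod M} {N} p (vanishes p)))

finite-choice : ∀ {a} n {A : Fin n → Set a} → (∀ i → ¬ ¬ A i) → ¬ ¬ (∀ i → A i)
finite-choice zero f = return λ ()
finite-choice (suc n) f = f zero >>= λ a → finite-choice n (λ i → f (suc i)) >>= λ as →
  return λ { zero → a ; (suc i) → as i }

module Counting {ℓ} {k : Field ℓ} (Λ : FDAlgebra k) where
  open AuslanderReitenFormula Λ public
  open ∣_∣≡_ public
  private
    module Λ = FDAlgebra Λ

  Count : Module → ℕ → Set (lsuc ℓ)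
  Count M n = ∣_∣≡_ {Λ = Λ} M n

  Tops : ∀ {n} → Count Λ.regular n → Set (lsuc ℓ)
  Tops c = ∀ j → Σ (Mod Λ) λ S → Simple S × Σ (summand c j ⟶ S) Surjective

  Count-index-injective : ∀ {m n} {M N : Module} (cM : Count M m) (cN : Count N n) (σ : Fin m → Fin n) →
    (∀ i → mod (summand cM i) ≅ mod (summand cN (σ i))) → ∀ {i j} → σ i ≡ σ j → i ≡ j
  Count-index-injective cM cN σ iso {i} {j} e with i Finₚ.≟ j
  ... | yes p = p
  ... | no ¬p = ⊥-elim (distinct cM i j ¬p (≅-trans (iso i)
          (subst (λ l → mod (summand cN (σ i)) ≅ mod (summand cM j)) e (≅-sym (subst (λ l → mod (summand cM j) ≅ mod (summand cN l)) (sym e) (iso j))))))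

  DirectSummand-≅ : {N : Mod Λ} {M M′ : Module} → M ≅ M′ → DirectSummand N M → DirectSummand N M′
  DirectSummand-≅ e (L , d) = L , ≅-trans d e

  Count-≅ : ∀ {n} {M M′ : Module} → M ≅ M′ → Count M n → Count M′ n
  Count-≅ e c = record
    { summand = summand c
    ; indecomposable = indecomposable c
    ; isSummand = λ i → DirectSummand-≅ {summand c i} e (isSummand c i)
    ; distinct = distinct c
    ; complete = λ N ind d → complete c N ind (DirectSummand-≅ {N} (≅-sym e) d)
    }

  Count-≤ : ∀ {m n} {M : Module} → Count M m → Count M n → m ℕ.≤ n
  Count-≤ c d = Finₚ.injective⇒≤ {f = λ i → proj₁ (found i)} λ {i} {j} →
      Count-index-injective c d (λ i → proj₁ (found i)) (λ i → proj₂ (found i)) {i} {j}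
    where
    found : ∀ i → ∃ λ j → mod (summand c i) ≅ mod (summand d j)
    found i = complete d (summand c i) (indecomposable c i) (isSummand c i)

  Count-unique : ∀ {m n} {M : Module} → Count M m → Count M n → m ≡ n
  Count-unique c d = ℕₚ.≤-antisym (Count-≤ c d) (Count-≤ d c)

  Count-zero : ∀ {n} {M : Module} → IsZero M → Count M n → n ≡ 0
  Count-zero {zero} z c = refl
  Count-zero {suc n} z c = ⊥-elim (proj₁ (indecomposable c zero) (◁-zero (summand⇒◁ {summand c zero} (isSummand c zero)) z))

  Count-0⇒IsZero : {M : Mod Λ} → Count (mod M) 0 → IsZero (mod M)
  Count-0⇒IsZero {M} c with isZero? M
  ... | inj₁ z = z
  ... | inj₂ nz = ⊥-elim (indecomposableSummand M {M} idʰ nz λ (N , ind , s , _) →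
          Finₚ.¬Fin0 (proj₁ (complete c N ind (◁⇒summand {N} {M} s))))

  singleton : (M : Mod Λ) → Indecomposable M → Count (mod M) 1
  singleton M ind = record
    { summand = λ _ → M
    ; indecomposable = λ _ → ind
    ; isSummand = λ _ → ◁⇒summand {M} {M} ◁-refl
    ; distinct = λ { zero zero ne → ⊥-elim (ne refl) }
    ; complete = λ N indN s → zero , indecomposable-◁ {N} {M} ind (proj₁ indN) (summand⇒◁ {N} s)
    }

  zero-Count : {M : Module} → IsZero M → Count M 0
  zero-Count z = record
    { summand = λ ()
    ; indecomposable = λ ()
    ; isSummand = λ ()
    ; distinct = λ ()
    ; complete = λ N ind s → ⊥-elim (proj₁ ind (◁-zero (summand⇒◁ {N} s) z))
    }

  indecomposable⇒basic : {M : Mod Λ} → Indecomposable M → Basic {Λ = Λ} (mod M)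
  indecomposable⇒basic {M} (_ , ind) N₁ N₂ L ind₁ ind₂ e _ with ind N₁ (N₂ ⊕ᴹ L) e
  ... | inj₁ z = proj₁ ind₁ z
  ... | inj₂ z = proj₁ ind₂ λ x → proj₁ (z (x , zeroᴹ (mod L)))

  zero⇒basic : {M : Module} → IsZero M → Basic {Λ = Λ} M
  zero⇒basic z N₁ N₂ L ind₁ ind₂ e _ = proj₁ ind₁ (◁-zero (◁-trans ⊕-◁₁ (≅⇒◁ e)) z)

  basic-◁ : {M N : Mod Λ} → mod N ◁ mod M → Basic {Λ = Λ} (mod M) → Basic {Λ = Λ} (mod N)
  basic-◁ {M} {N} s basic N₁ N₂ L ind₁ ind₂ e = basic N₁ N₂ (L ⊕ᴹ C) ind₁ ind₂
      (≅-trans (⊕-assoc₃ (mod N₁) (mod N₂) (mod L) (mod C)) (≅-trans (⊕-map-≅ e) (proj₂ (◁⇒summand {N} {M} s))))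
    where
    C : Mod Λ
    C = proj₁ (◁⇒summand {N} {M} s)
    ⊕-map-≅ : {A B D : Module} → A ≅ B → A ⊕ D ≅ B ⊕ D
    ⊕-map-≅ {A} {B} {D} (f , inj , surj) = ⟨ f ∘ʰ ⊕-proj₁ A D , ⊕-proj₂ A D ⟩ʰ , (λ (d , e) → inj d , e) ,
      λ (x , y) → (proj₁ (surj x) , y) , proj₂ (surj x) , reflᴹ D
    ⊕-assoc₃ : ∀ A B D E → A ⊕ (B ⊕ (D ⊕ E)) ≅ (A ⊕ (B ⊕ D)) ⊕ E
    ⊕-assoc₃ A B D E = mkHom (λ (a , b , d , e) → (a , b , d) , e) (λ (p , q , r , s) → (p , q , r) , s)
        (λ _ _ → reflᴹ ((A ⊕ (B ⊕ D)) ⊕ E)) (λ _ _ → reflᴹ ((A ⊕ (B ⊕ D)) ⊕ E)) ,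
      (λ ((p , q , r) , s) → p , q , r , s) ,
      λ ((a , b , d) , e) → (a , b , d , e) , reflᴹ ((A ⊕ (B ⊕ D)) ⊕ E)

module Frame {ℓ} {k : Field ℓ} (Λ : FDAlgebra k) (hereditary : Hereditary Λ) (basicAlgebra : BasicAlgebra Λ)
  {n : ℕ} (count : ∣_∣≡_ {Λ = Λ} (FDAlgebra.regular Λ) n)
  (top : Counting.Tops Λ count) where
  open Counting Λ public
  private
    module Λ = FDAlgebra Λ

  P S : Fin n → Mod Λ
  P = summand count
  S j = proj₁ (top j)

  S-simple : ∀ j → Simple (S j)
  S-simple j = proj₁ (proj₂ (top j))

  π : ∀ j → P j ⟶ S j
  π j = proj₁ (proj₂ (proj₂ (top j)))

  π-surjective : ∀ j → Surjective (π j)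
  π-surjective j = proj₂ (proj₂ (proj₂ (top j)))

  surjective⇒nonzero : {M N : Mod Λ} → ¬ IsZero (mod N) → (f : M ⟶ N) → Surjective f → ¬ IsZeroHom f
  surjective⇒nonzero {N = N} nz f surj z = nz λ y → let x , e = surj y in
    transᴹ (mod N) (symᴹ (mod N) e) (z x)

  π≉0 : ∀ j → ¬ IsZeroHom (π j)
  π≉0 j = surjective⇒nonzero {P j} {S j} (proj₁ (S-simple j)) (π j) (π-surjective j)

  P-indecomposable : ∀ j → Indecomposable (P j)
  P-indecomposable = indecomposable count

  P◁Λ : ∀ j → mod (P j) ◁ Λ.regular
  P◁Λ j = summand⇒◁ {P j} (isSummand count j)

  P-projective : ∀ j → Projective (P j)
  P-projective j = ◁-projective {Λᴹ} {P j} Λ-projective (P◁Λ j)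

  ≅⇒≡ : ∀ {i j} → mod (P i) ≅ mod (P j) → i ≡ j
  ≅⇒≡ {i} {j} e with i Finₚ.≟ j
  ... | yes p = p
  ... | no ¬p = ⊥-elim (distinct count i j ¬p e)

  covered : {T : Mod Λ} → Simple T → ¬ ¬ ∃ λ j → Σ (P j ⟶ T) λ f → ¬ IsZeroHom f
  covered {T} (nz , _) not = nz λ x → zeroAt x λ x≉0 → indecomposableSummand Λᴹ {T} (element (mod T) x)
      (λ z → x≉0 (T.≈ᴹ-trans (T.≈ᴹ-sym (T.*ᵣ-identityʳ x)) (z Λ.1#))) λ (N , ind , s , g , g≉0) →
      let j , e = complete count N ind (◁⇒summand {N} {Λᴹ} s) in
      not (j , g ∘ʰ inverse e , λ z → g≉0 λ y → T.≈ᴹ-trans (cong-h g (symᴹ (mod N) (inverseˡ e y))) (z (proj₁ e ⟨ y ⟩)))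
    where
    module T = RightModule (mod T)
    zeroAt : ∀ x → ¬ ¬ (mod T ∋ x ≈ T.0ᴹ) → mod T ∋ x ≈ T.0ᴹ
    zeroAt x nn with zero-or-detected (hasDim T) x
    ... | inj₁ e = e
    ... | inj₂ (χ , e) = ⊥-elim (nn (1≉0-value χ e))

  simple≅S : ∀ {j} {T : Mod Λ} → Simple T → (f : P j ⟶ T) → ¬ IsZeroHom f → mod T ≅ mod (S j)
  simple≅S {j} {T} s f f≉0 = top-unique {P j} (P-indecomposable j) (P-projective j) {T} {S j} s (S-simple j) f f≉0 (π j) (π≉0 j)

  P→S⇒≡ : ∀ {i j} (f : P i ⟶ S j) → ¬ IsZeroHom f → i ≡ j
  P→S⇒≡ {i} {j} f f≉0 = ≅⇒≡ (indecomposable-◁ {P i} {P j} (P-indecomposable j) (proj₁ (P-indecomposable i))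
    (simple⇒◁projective {P i} (P-indecomposable i) (P-projective i) {S j} {P j} (S-simple j) f f≉0 (P-projective j) (π j) (π≉0 j)))

  P-S-vanishes : ∀ {i j} → i ≢ j → Vanishes (mod (P i)) (mod (S j))
  P-S-vanishes {i} {j} i≢j f = zeroHom-stable {P i} {S j} f λ f≉0 → i≢j (P→S⇒≡ f f≉0)

  S≅⇒≡ : ∀ {i j} → mod (S i) ≅ mod (S j) → i ≡ j
  S≅⇒≡ {i} {j} e = P→S⇒≡ (proj₁ e ∘ʰ π i) λ z → π≉0 i λ x →
    transᴹ (mod (S i)) (symᴹ (mod (S i)) (inverseˡ e _))
      (transᴹ (mod (S i)) (cong-h (inverse e) (z x)) (Hom.0ᴹ-homo (inverse e)))

  topQuotient : (M : Mod Λ) → ¬ IsZero (mod M) → ¬ ¬ ∃ λ j → Σ (M ⟶ S j) Surjective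
  topQuotient M nz = simpleQuotient M nz >>= λ (T , simple , q , q-surj) → covered {T} simple >>= λ (j , f , f≉0) →
    let e = simple≅S {j} {T} simple f f≉0 in
    return (j , proj₁ e ∘ʰ q , λ y → let t , p = proj₂ (proj₂ e) y ; x , p′ = q-surj t in
      x , transᴹ (mod (S j)) (cong-h (proj₁ e) p′) p)

  P◁projective : ∀ {j} {Q : Mod Λ} → Projective Q → (q : Q ⟶ S j) → ¬ IsZeroHom q → mod (P j) ◁ mod Q
  P◁projective {j} {Q} pQ q q≉0 = simple⇒◁projective {P j} (P-indecomposable j) (P-projective j) {S j} {Q} (S-simple j)
    (π j) (π≉0 j) pQ q q≉0

  projective-induction : (C : Mod Λ → Set (lsuc ℓ)) → (∀ Q → IsZero (mod Q) → C Q) →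
    (∀ j (Q Q′ : Mod Λ) → mod (P j) ⊕ mod Q′ ≅ mod Q → C Q′ → C Q) → {Q : Mod Λ} → Projective Q → ¬ ¬ C Q
  projective-induction C C-zero C-step {Q} pQ = go (dim Q) Q ℕₚ.≤-refl pQ
    where
    go : ∀ d (Q : Mod Λ) → dim Q ℕ.≤ d → Projective Q → ¬ ¬ C Q
    go zero Q le pQ not = not (C-zero Q (dim≡0⇒IsZero Q (ℕₚ.n≤0⇒n≡0 le)))
    go (suc d) Q le pQ not = [ (λ z → not (C-zero Q z)) , (λ nz → topQuotient Q nz λ (j , q , q-surj) →
        split j (P◁projective {j} {Q} pQ q (surjective⇒nonzero {Q} {S j} (proj₁ (S-simple j)) q q-surj))) ]′ (isZero? Q)
      where
      split : ∀ j → mod (P j) ◁ mod Q → ⊥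
      split j s = go d Q′ (ℕₚ.≤-pred (ℕₚ.≤-trans dim< le)) (◁-projective {Q} {Q′} pQ (◁-trans ⊕-◁₂ (≅⇒◁ e))) λ c → not (C-step j Q Q′ e c)
        where
        Q′ : Mod Λ
        Q′ = proj₁ (◁⇒summand {P j} {Q} s)
        e : mod (P j) ⊕ mod Q′ ≅ mod Q
        e = proj₂ (◁⇒summand {P j} {Q} s)
        dim< : dim Q′ ℕ.< dim Q
        dim< = subst (dim Q′ ℕ.<_) (trans (sym (dim-⊕ (P j) Q′)) (≅⇒dim≡ {P j ⊕ᴹ Q′} {Q} e))
          (subst (ℕ._≤ dim Q′ ℕ.+ dim (P j)) (ℕₚ.+-comm (dim Q′) 1) (ℕₚ.+-monoʳ-≤ (dim Q′) (nonzero⇒dim>0 (P j) (proj₁ (P-indecomposable j)))))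

  projective-∈add : {Q Z : Mod Λ} → Projective Q → (∀ j (f : Q ⟶ S j) → ¬ IsZeroHom f → P j ∈add Z) → ¬ ¬ Q ∈add Z
  projective-∈add {Q} {Z} pQ tops not = projective-induction C (λ Q z _ → zero-∈add {Q} {Z} z) step {Q} pQ λ c → not (c tops)
    where
    C : Mod Λ → Set (lsuc ℓ)
    C Q = (∀ j (f : Q ⟶ S j) → ¬ IsZeroHom f → P j ∈add Z) → Q ∈add Z
    extended-nonzero : {N Q : Mod Λ} (s : mod N ◁ mod Q) {l : Fin n} (f : N ⟶ S l) → ¬ IsZeroHom f → ¬ IsZeroHom (f ∘ʰ proj₁ (proj₂ s))
    extended-nonzero {N} (i , r , ri) {l} f f≉0 z = f≉0 λ x → transᴹ (mod (S l))
      (Hom.⟦⟧-cong f {x} {r ⟨ i ⟨ x ⟩ ⟩} (symᴹ (mod N) {r ⟨ i ⟨ x ⟩ ⟩} {x} (ri x))) (z (i ⟨ x ⟩))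
    step : ∀ j (Q Q′ : Mod Λ) → mod (P j) ⊕ mod Q′ ≅ mod Q → C Q′ → C Q
    step j Q Q′ e c tops = ⊕-∈add {P j} {Q′} {Z} {Q} (≅⇒◁ (≅-sym e))
        (tops j (π j ∘ʰ proj₁ (proj₂ Pj◁Q)) (extended-nonzero {P j} {Q} Pj◁Q (π j) (π≉0 j)))
        (c λ l f f≉0 → tops l (f ∘ʰ proj₁ (proj₂ Q′◁Q)) (extended-nonzero {Q′} {Q} Q′◁Q f f≉0))
      where
      Pj◁Q : mod (P j) ◁ mod Q
      Pj◁Q = ◁-trans ⊕-◁₁ (≅⇒◁ e)
      Q′◁Q : mod Q′ ◁ mod Q
      Q′◁Q = ◁-trans ⊕-◁₂ (≅⇒◁ e)

  indecomposable-projective≅P : {Q : Mod Λ} → Indecomposable Q → Projective Q → ¬ ¬ ∃ λ j → mod Q ≅ mod (P j)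
  indecomposable-projective≅P {Q} ind pQ = topQuotient Q (proj₁ ind) >>= λ (j , q , q-surj) →
    return (j , ≅-sym (indecomposable-◁ {P j} {Q} ind (proj₁ (P-indecomposable j))
      (P◁projective {j} {Q} pQ q (surjective⇒nonzero {Q} {S j} (proj₁ (S-simple j)) q q-surj))))

  module _ {Q : Mod Λ} (pQ : Projective Q) {q : ℕ} (cQ : Count (mod Q) q) where

    summand-index : ¬ ¬ Σ (Fin q → Fin n) λ σ → ∀ i → mod (summand cQ i) ≅ mod (P (σ i))
    summand-index = finite-choice q (λ i → indecomposable-projective≅P {summand cQ i} (indecomposable cQ i)
        (◁-projective {Q} {summand cQ i} pQ (summand⇒◁ {summand cQ i} (isSummand cQ i)))) >>= λ f →
      return ((λ i → proj₁ (f i)) , λ i → proj₂ (f i))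

    P◁Q-at : (σ : Fin q → Fin n) → (∀ i → mod (summand cQ i) ≅ mod (P (σ i))) → ∀ i → mod (P (σ i)) ◁ mod Q
    P◁Q-at σ iso i = ◁-trans (≅⇒◁ (≅-sym (iso i))) (summand⇒◁ {summand cQ i} (isSummand cQ i))

    missing-one : ∀ {j} → ¬ mod (P j) ◁ mod Q → q ℕ.< n
    missing-one {j} ¬s with q ℕₚ.<? n
    ... | yes p = p
    ... | no ¬p = ⊥-elim (summand-index λ (σ , iso) → ¬p (Finₚ.injective⇒≤ {f = f σ} λ {x} {y} → f-injective σ iso {x} {y}))
      where
      f : (Fin q → Fin n) → Fin (suc q) → Fin n
      f σ zero = j
      f σ (suc i) = σ i
      f-injective : ∀ σ (iso : ∀ i → mod (summand cQ i) ≅ mod (P (σ i))) {x y} → f σ x ≡ f σ y → x ≡ y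
      f-injective σ iso {zero} {zero} e = refl
      f-injective σ iso {zero} {suc y} refl = ⊥-elim (¬s (P◁Q-at σ iso y))
      f-injective σ iso {suc x} {zero} refl = ⊥-elim (¬s (P◁Q-at σ iso x))
      f-injective σ iso {suc x} {suc y} e = cong suc (Count-index-injective cQ count σ iso e)

    missing-two : ∀ {i j} → i ≢ j → ¬ mod (P i) ◁ mod Q → ¬ mod (P j) ◁ mod Q → suc q ℕ.< n
    missing-two {i} {j} i≢j ¬si ¬sj with suc q ℕₚ.<? n
    ... | yes p = p
    ... | no ¬p = ⊥-elim (summand-index λ (σ , iso) → ¬p (Finₚ.injective⇒≤ {f = f σ} λ {x} {y} → f-injective σ iso {x} {y}))
      where
      f : (Fin q → Fin n) → Fin (suc (suc q)) → Fin n
      f σ zero = i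
      f σ (suc zero) = j
      f σ (suc (suc l)) = σ l
      f-injective : ∀ σ (iso : ∀ l → mod (summand cQ l) ≅ mod (P (σ l))) {x y} → f σ x ≡ f σ y → x ≡ y
      f-injective σ iso {zero} {zero} e = refl
      f-injective σ iso {zero} {suc zero} e = ⊥-elim (i≢j e)
      f-injective σ iso {zero} {suc (suc y)} refl = ⊥-elim (¬si (P◁Q-at σ iso y))
      f-injective σ iso {suc zero} {zero} e = ⊥-elim (i≢j (sym e))
      f-injective σ iso {suc zero} {suc zero} e = refl
      f-injective σ iso {suc zero} {suc (suc y)} refl = ⊥-elim (¬sj (P◁Q-at σ iso y))
      f-injective σ iso {suc (suc x)} {zero} refl = ⊥-elim (¬si (P◁Q-at σ iso x))
      f-injective σ iso {suc (suc x)} {suc zero} refl = ⊥-elim (¬sj (P◁Q-at σ iso x))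
      f-injective σ iso {suc (suc x)} {suc (suc y)} e = cong (λ l → suc (suc l)) (Count-index-injective cQ count σ iso e)

≡-or-≢ : ∀ {n} (i j : Fin n) → i ≡ j ⊎ i ≢ j
≡-or-≢ i j with i Finₚ.≟ j
... | yes e = inj₁ e
... | no ne = inj₂ ne

open s-τ-tilt using () renaming (M to Mˢ; P to Pˢ)

module Elements {ℓ} {k : Field ℓ} (Λ : FDAlgebra k) (hereditary : Hereditary Λ) (basicAlgebra : BasicAlgebra Λ)
  {n : ℕ} (count : ∣_∣≡_ {Λ = Λ} (FDAlgebra.regular Λ) n)
  (top : Counting.Tops Λ count) where
  open Frame Λ hereditary basicAlgebra count top public
  private
    module k = Field k
    module Λ = FDAlgebra Λ

  module _ (z : s-τ-tilt Λ) where
    open IsSupportτTiltingPair (s-τ-tilt.isPair z) using (projective; τ-rigid; Hom[P,M]≈0)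

    Pˢ-projective : Projective (Pˢ z)
    Pˢ-projective = projective

    Pˢ-Mˢ-vanishes : Vanishes (mod (Pˢ z)) (mod (Mˢ z))
    Pˢ-Mˢ-vanishes = Hom[P,M]≈0

    τ-rigidˢ : Hom-τ-vanishes (Mˢ z) (Mˢ z)
    τ-rigidˢ = τ-rigid

    counts : ∃₂ λ m p → Count (mod (Mˢ z)) m × Count (mod (Pˢ z)) p × (m ℕ.+ p ≡ n)
    counts = let m , p , cM , cP , cΛ = IsSupportτTiltingPair.count (s-τ-tilt.isPair z) in
      m , p , cM , cP , Count-unique cΛ count

  ≤ˢ-intro : ∀ {z x : s-τ-tilt Λ} → Hom-τ-vanishes (Mˢ z) (Mˢ x) → Pˢ x ∈add Pˢ z → z ≤ˢ x
  ≤ˢ-intro {z} {x} van add = van , λ N N∈ → ∈add-trans {N} {Pˢ x} {Pˢ z} N∈ add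

  ≤ˢ⇒∈add : ∀ {z x : s-τ-tilt Λ} → z ≤ˢ x → Pˢ x ∈add Pˢ z
  ≤ˢ⇒∈add {z} {x} le = proj₂ le (Pˢ x) (∈add-refl {Pˢ x})

  vanishes-into : {L M N : Module} (i : Hom M N) → Injective i → Vanishes L N → Vanishes L M
  vanishes-into i inj van f x = injective⇒ker≈0 i inj (f ⟨ x ⟩) (van (i ∘ʰ f) x)

  ◁-injective : {M N : Module} (s : M ◁ N) → Injective (proj₁ s)
  ◁-injective {M} (i , r , ri) e = M.≈ᴹ-trans (M.≈ᴹ-sym (ri _)) (M.≈ᴹ-trans (cong-h r e) (ri _))
    where module M = RightModule M

  vanishes-◁-into : {L M N : Module} → M ◁ N → Vanishes L N → Vanishes L M
  vanishes-◁-into s van = vanishes-into (proj₁ s) (◁-injective s) van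

  zero-complement : {A B C : Module} → B ⊕ C ≅ A → IsZero C → A ≅ B
  zero-complement {A} {B} {C} e z = ≅-trans (≅-sym e) (mk≅ (⊕-proj₁ B C) (⊕-inj₁ B C)
    (λ (x , y) → reflᴹ B , symᴹ C (z y)) (λ _ → reflᴹ B))

  ⊕-map-≅ʳ : {A B B′ : Module} → B ≅ B′ → A ⊕ B ≅ A ⊕ B′
  ⊕-map-≅ʳ {A} {B} {B′} (f , inj , surj) = ⟨ ⊕-proj₁ A B , f ∘ʰ ⊕-proj₂ A B ⟩ʰ , (λ (p , q) → p , inj q) ,
    λ (x , y) → (x , proj₁ (surj y)) , reflᴹ A , proj₂ (surj y)

  zero-source : {M N : Module} → IsZero M → Vanishes M N
  zero-source {N = N} z f x = transᴹ N (cong-h f (z x)) (Hom.0ᴹ-homo f)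

  zero-count : ∀ (z : s-τ-tilt Λ) → IsZero (mod (Mˢ z)) → Count (mod (Pˢ z)) n
  zero-count z zero-M with counts z
  ... | m , p , cM , cP , e with Count-zero zero-M cM
  ...   | refl = subst (Count (mod (Pˢ z))) e cP

  zero-P◁ : ∀ (z : s-τ-tilt Λ) → IsZero (mod (Mˢ z)) → ∀ j → ¬ ¬ (mod (P j) ◁ mod (Pˢ z))
  zero-P◁ z zero-M j ¬s = ℕₚ.<-irrefl refl (missing-one {Pˢ z} (Pˢ-projective z) (zero-count z zero-M) {j} ¬s)

  zero-τ-vanishes : ∀ (M N : Mod Λ) → IsZero (mod M) → Hom-τ-vanishes M N
  zero-τ-vanishes M N z p = zero-source {mod M} {τ {k = k} {Λ = Λ} {M = N} p} z

  quotient-τ-vanishes : (M M′ N : Mod Λ) (q : M ⟶ M′) → Surjective q → Hom-τ-vanishes M N → Hom-τ-vanishes M′ N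
  quotient-τ-vanishes M M′ N q q-surj van p = vanishes-from {mod M} {mod M′} {τ {k = k} {Λ = Λ} {M = N} p} q q-surj (van p)

  zero-least : ∀ (z x : s-τ-tilt Λ) → IsZero (mod (Mˢ z)) → ¬ ¬ z ≤ˢ x
  zero-least z x zero-M not-≤ = finite-choice n (zero-P◁ z zero-M) λ s →
    projective-∈add {Pˢ x} {Pˢ z} (Pˢ-projective x) (λ j _ _ → ◁⇒∈add₁ {P j} {Pˢ z} (s j)) λ add →
    not-≤ (≤ˢ-intro {z} {x} (zero-τ-vanishes (Mˢ z) (Mˢ x) zero-M) add)

  R : Fin n → Mod Λ
  R j = kerMod {P j} {S j} (π j)

  R-projective : ∀ j → Projective (R j)
  R-projective j = hereditary (P j) (R j) (Kernel-incl (π j)) (P-projective j) (λ d → d)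

  R-S-vanishes : ∀ j → Vanishes (mod (R j)) (mod (S j))
  R-S-vanishes j f = zeroHom-stable {R j} {S j} f λ f≉0 →
    let s = P◁projective {j} {R j} (R-projective j) f f≉0 in
    ℕₚ.<⇒≱ (ℕₚ.≤-trans (ℕₚ.+-monoˡ-≤ (dim (R j)) (nonzero⇒dim>0 (S j) (proj₁ (S-simple j))))
        (ℕₚ.≤-reflexive (sym (dim-ker {P j} {S j} (π j) (π-surjective j)))))
      (injective⇒dim≤ {P j} {R j} (proj₁ s) (◁-injective s))

  module SimpleLike (z : s-τ-tilt Λ) (j : Fin n) (e : mod (Mˢ z) ≅ mod (S j)) where

    P-vanishes : Vanishes (mod (Pˢ z)) (mod (S j))
    P-vanishes = vanishes-into (inverse e) (proj₁ (proj₂ (≅-sym e))) (Pˢ-Mˢ-vanishes z)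

    Pj⋪ : ¬ mod (P j) ◁ mod (Pˢ z)
    Pj⋪ s = π≉0 j (vanishes-◁ s P-vanishes (π j))

    Pl◁ : ∀ l → l ≢ j → ¬ ¬ (mod (P l) ◁ mod (Pˢ z))
    Pl◁ l l≢j ¬s with counts z
    ... | m , p , cM , cP , m+p≡n with Count-unique (Count-≅ e cM) (singleton (S j) (simple⇒indecomposable {S j} (S-simple j)))
    ...   | refl = ℕₚ.<-irrefl m+p≡n (missing-two {Pˢ z} (Pˢ-projective z) cP l≢j ¬s Pj⋪)

    ∈add-P : {Q : Mod Λ} → Projective Q → Vanishes (mod Q) (mod (S j)) → ¬ ¬ Q ∈add Pˢ z
    ∈add-P {Q} pQ van = finite-choice n choose >>= λ s → projective-∈add {Q} {Pˢ z} pQ (tops s)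
      where
      choose : ∀ l → ¬ ¬ (l ≢ j → mod (P l) ◁ mod (Pˢ z))
      choose l with l Finₚ.≟ j
      ... | yes l≡j = return λ l≢j → ⊥-elim (l≢j l≡j)
      ... | no l≢j = Pl◁ l l≢j >>= λ s → return λ _ → s
      tops : (∀ l → l ≢ j → mod (P l) ◁ mod (Pˢ z)) → ∀ l (f : Q ⟶ S l) → ¬ IsZeroHom f → P l ∈add Pˢ z
      tops s l f f≉0 with l Finₚ.≟ j
      ... | yes refl = ⊥-elim (f≉0 (van f))
      ... | no l≢j = ◁⇒∈add₁ {P l} {Pˢ z} (s l l≢j)

    below : ∀ (x : s-τ-tilt Λ) (q : Mˢ x ⟶ S j) → Surjective q → ¬ ¬ z ≤ˢ x
    below x q q-surj not-≤ = ∈add-P {Pˢ x} (Pˢ-projective x)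
        (projective⇒vanishes {Pˢ x} {Mˢ x} {S j} (Pˢ-projective x) q q-surj (Pˢ-Mˢ-vanishes x)) λ add →
      not-≤ (≤ˢ-intro {z} {x} (quotient-τ-vanishes (Mˢ x) (Mˢ z) (Mˢ x) (inverse e ∘ʰ q) surj (τ-rigidˢ x)) add)
      where
      surj : Surjective (inverse e ∘ʰ q)
      surj y = let w , d = q-surj (proj₁ e ⟨ y ⟩) in
        w , transᴹ (mod (Mˢ z)) (cong-h (inverse e) d) (inverseˡ e y)

    not-below-zero : ∀ (w : s-τ-tilt Λ) → IsZero (mod (Mˢ w)) → ¬ z ≤ˢ w
    not-below-zero w zero-M le = zero-P◁ w zero-M j λ s → π≉0 j
      (vanishes-◁ s (vanishes-∈add {Pˢ z} {Pˢ w} (≤ˢ⇒∈add {z} {w} le) P-vanishes) (π j))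

    S◁ : {N : Mod Λ} → ¬ IsZero (mod N) → Vanishes (mod (Pˢ z)) (mod N) → ¬ ¬ (mod (S j) ◁ mod N)
    S◁ {N} nz van = topQuotient N nz >>= λ (l , q , q-surj) → case l q q-surj
      where
      module N = RightModule (mod N)
      case : ∀ l (q : N ⟶ S l) → Surjective q → ¬ ¬ (mod (S j) ◁ mod N)
      case l q q-surj with P-projective l N (S l) q q-surj (π l) | l Finₚ.≟ j
      ... | h , qh≈π | no l≢j = λ _ → Pl◁ l l≢j λ s → π≉0 l λ x → transᴹ (mod (S l))
              (symᴹ (mod (S l)) (qh≈π x))
              (transᴹ (mod (S l)) (cong-h q (vanishes-◁ s van h x)) (Hom.0ᴹ-homo q))
      ... | h , qh≈π | yes refl = ∈add-P {R j} (R-projective j) (R-S-vanishes j) >>= λ add →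
              let s , sπ≈h = factor-at (π j) (π-surjective j) h λ x d → vanishes-∈add {Pˢ z} {R j} add van (h ∘ʰ Kernel-incl (π j)) (x , d) in
              return (s , q , λ y → let x , d = π-surjective j y in
                transᴹ (mod (S j)) (cong-h q (N.≈ᴹ-trans (cong-h s (symᴹ (mod (S j)) d)) (sπ≈h x)))
                  (transᴹ (mod (S j)) (qh≈π x) d))

    above-only : ∀ (x : s-τ-tilt Λ) → x ≤ˢ z → ¬ ¬ (IsZero (mod (Mˢ x)) ⊎ mod (Mˢ x) ≅ mod (S j))
    above-only x le not = [ (λ zero-M → not (inj₁ zero-M)) , (λ nz → S◁ {Mˢ x} nz van λ s → split (◁⇒summand {S j} {Mˢ x} s)) ]′ (isZero? (Mˢ x))
      where
      van : Vanishes (mod (Pˢ z)) (mod (Mˢ x))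
      van = vanishes-∈add {Pˢ x} {Pˢ z} (≤ˢ⇒∈add {x} {z} le) (Pˢ-Mˢ-vanishes x)
      S-indecomposable : Indecomposable (S j)
      S-indecomposable = simple⇒indecomposable {S j} (S-simple j)
      split : DirectSummand (S j) (mod (Mˢ x)) → ⊥
      split (C , d) = [ (λ zero-C → not (inj₂ (zero-complement {mod (Mˢ x)} {mod (S j)} {mod C} d zero-C))) , again ]′ (isZero? C)
        where
        again : ¬ IsZero (mod C) → ⊥
        again nzC = S◁ {C} nzC (vanishes-◁-into {mod (Pˢ z)} {mod C} {mod (Mˢ x)} (◁-trans ⊕-◁₂ (≅⇒◁ d)) van) λ s →
          s-τ-tilt.basic x (S j) (S j) (proj₁ (◁⇒summand {S j} {C} s)) S-indecomposable S-indecomposable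
            (≅-trans (⊕-map-≅ʳ {mod (S j)} (proj₂ (◁⇒summand {S j} {C} s))) d) ≅-refl

  dévissage : {M : Mod Λ} {T : Module} →
    (∀ (U : Mod Λ) (u : U ⟶ M) → Injective u → ∀ (V : Mod Λ) (q : U ⟶ V) → Simple V → Surjective q → ¬ ¬ Vanishes (mod V) T) →
    (φ : Hom (mod M) T) → ¬ ¬ IsZeroHom φ
  dévissage {M} {T} simple-vanishes φ φ≉0 = minimal μ (M , idʰ , (λ d → d) , φ≉0) λ ((U , u , u-inj , φu≉0) , least) →
      simpleQuotient U (λ z → φu≉0 (zero-source z (φ ∘ʰ u))) λ (V , V-simple , q , q-surj) →
      simple-vanishes U u (λ {x} {y} → u-inj {x} {y}) V q V-simple q-surj λ van →
      kernel-zero U u (λ {x} {y} → u-inj {x} {y}) φu≉0 least V V-simple q q-surj λ z →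
      let φ̄ , φ̄q≈φu = factor-at q q-surj (φ ∘ʰ u) λ x d → z (x , d) in
      φu≉0 λ x → transᴹ T (symᴹ T (φ̄q≈φu x)) (van φ̄ _)
    where
    A : Set _
    A = Σ (Mod Λ) λ U → Σ (U ⟶ M) λ u → Injective u × ¬ IsZeroHom (φ ∘ʰ u)
    μ : A → ℕ
    μ (U , _) = dim U
    kernel-zero : ∀ (U : Mod Λ) (u : U ⟶ M) → Injective u → ¬ IsZeroHom (φ ∘ʰ u) → (∀ a → dim U ℕ.≤ μ a) →
      ∀ (V : Mod Λ) → Simple V → (q : U ⟶ V) → Surjective q → ¬ ¬ IsZeroHom (φ ∘ʰ u ∘ʰ Kernel-incl q)
    kernel-zero U u u-inj φu≉0 least V V-simple q q-surj nz = ℕₚ.<⇒≱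
      (ℕₚ.≤-trans (ℕₚ.+-monoˡ-≤ (dim (kerMod {U} {V} q)) (nonzero⇒dim>0 V (proj₁ V-simple)))
        (ℕₚ.≤-reflexive (sym (dim-ker {U} {V} q q-surj))))
      (least (kerMod {U} {V} q , u ∘ʰ Kernel-incl q , (λ d → u-inj d) , nz))

  τ-zero-stable : {M N : Mod Λ} (p : MinimalPresentation N) (φ : Hom (mod M) (τ {k = k} {Λ = Λ} {M = N} p)) → ¬ ¬ IsZeroHom φ → IsZeroHom φ
  τ-zero-stable p φ nn x α with k-zero? (Homˡ.fun (Hom.fun φ x) α)
  ... | inj₁ e = e
  ... | inj₂ ne = ⊥-elim (nn λ z → ne (z x α))

  above-all-other-simples : ∀ (x y : s-τ-tilt Λ) i → mod (P i) ◁ mod (Pˢ x) →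
    (∀ j → j ≢ i → Σ (s-τ-tilt Λ) λ s → (s ≤ˢ y) × (mod (Mˢ s) ≅ mod (S j))) → ¬ ¬ x ≤ˢ y
  above-all-other-simples x y i Pi◁ others not-≤ = projective-∈add {Pˢ y} {Pˢ x} (Pˢ-projective y) tops λ add →
      not-≤ (≤ˢ-intro {x} {y} (λ p φ → τ-zero-stable {Mˢ x} {Mˢ y} p φ
        (dévissage {Mˢ x} {τ {k = k} {Λ = Λ} {M = Mˢ y} p} (simple-vanishes p) φ)) add)
    where
    tops : ∀ l (f : Pˢ y ⟶ S l) → ¬ IsZeroHom f → P l ∈add Pˢ x
    tops l f f≉0 = [ (λ l≡i → ◁⇒∈add₁ {P l} {Pˢ x} (subst (λ h → mod (P h) ◁ mod (Pˢ x)) (sym l≡i) Pi◁)) ,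
        (λ l≢i → let s , le , e = others l l≢i in
          ⊥-elim (f≉0 (vanishes-∈add {Pˢ s} {Pˢ y} (≤ˢ⇒∈add {s} {y} le) (SimpleLike.P-vanishes s l e) f))) ]′ (≡-or-≢ l i)
    -- Mˢ x has no composition factor S i, and Hom(S l, τ (Mˢ y)) = 0 for l ≠ i.
    simple-vanishes : ∀ (p : MinimalPresentation (Mˢ y)) (U : Mod Λ) (u : U ⟶ Mˢ x) → Injective u →
      ∀ (V : Mod Λ) (q : U ⟶ V) → Simple V → Surjective q → ¬ ¬ Vanishes (mod V) (τ {k = k} {Λ = Λ} {M = Mˢ y} p)
    simple-vanishes p U u u-inj V q V-simple q-surj not-van = covered {V} V-simple λ (l , f , f≉0) →
        [ (λ l≡i → f≉0 (projective⇒vanishes {P l} {U} {V} (P-projective l) q q-surj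
              (vanishes-into u (λ {x} {y} → u-inj {x} {y})
                (vanishes-◁ (subst (λ h → mod (P h) ◁ mod (Pˢ x)) (sym l≡i) Pi◁) (Pˢ-Mˢ-vanishes x))) f)) ,
          (λ l≢i → not-van (other l f f≉0 (others l l≢i))) ]′ (≡-or-≢ l i)
      where
      other : ∀ l (f : P l ⟶ V) → ¬ IsZeroHom f → (Σ (s-τ-tilt Λ) λ s → (s ≤ˢ y) × (mod (Mˢ s) ≅ mod (S l))) →
        Vanishes (mod V) (τ {k = k} {Λ = Λ} {M = Mˢ y} p)
      other l f f≉0 (s , le , e) = quotient-τ-vanishes (Mˢ s) V (Mˢ y) (proj₁ e′) (proj₂ (proj₂ e′)) (proj₁ le) p
        where
        e′ : mod (Mˢ s) ≅ mod V
        e′ = ≅-trans e (≅-sym (simple≅S {l} {V} V-simple f f≉0))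

module Sums {ℓ} {k : Field ℓ} (Λ : FDAlgebra k) where
  open Counting Λ public

  indecomposable-◁-⊕ : {N : Mod Λ} {A B : Module} → Indecomposable N → mod N ◁ A ⊕ B → (mod N ◁ A) ⊎ (mod N ◁ B)
  indecomposable-◁-⊕ {N} {A} {B} ind (i , r , ri) = choose
      (local {N} ind ((r ∘ʰ ⊕-inj₁ A B) ∘ʰ (⊕-proj₁ A B ∘ʰ i)) ((r ∘ʰ ⊕-inj₂ A B) ∘ʰ (⊕-proj₂ A B ∘ʰ i))
        λ x → N.≈ᴹ-trans (N.≈ᴹ-sym (⊕-split r _ _)) (ri x))
    where
    module N = RightModule (mod N)
    choose : Injective ((r ∘ʰ ⊕-inj₁ A B) ∘ʰ (⊕-proj₁ A B ∘ʰ i)) ⊎ Injective ((r ∘ʰ ⊕-inj₂ A B) ∘ʰ (⊕-proj₂ A B ∘ʰ i)) →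
      (mod N ◁ A) ⊎ (mod N ◁ B)
    choose (inj₁ inj) = inj₁ (through⇒◁ {N} (⊕-proj₁ A B ∘ʰ i) (r ∘ʰ ⊕-inj₁ A B) inj)
    choose (inj₂ inj) = inj₂ (through⇒◁ {N} (⊕-proj₂ A B ∘ʰ i) (r ∘ʰ ⊕-inj₂ A B) inj)

  ⨁ : ∀ m → (Fin m → Mod Λ) → Mod Λ
  ⨁ zero A = zeroMod
  ⨁ (suc m) A = A zero ⊕ᴹ ⨁ m (λ i → A (suc i))

  ⨁-◁ : ∀ m (A : Fin m → Mod Λ) i → mod (A i) ◁ mod (⨁ m A)
  ⨁-◁ (suc m) A zero = ⊕-◁₁
  ⨁-◁ (suc m) A (suc i) = ◁-trans (⨁-◁ m (λ i → A (suc i)) i) ⊕-◁₂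

  indecomposable-◁-⨁ : ∀ m (A : Fin m → Mod Λ) {N : Mod Λ} → Indecomposable N → mod N ◁ mod (⨁ m A) → ∃ λ i → mod N ◁ mod (A i)
  indecomposable-◁-⨁ zero A {N} ind s = ⊥-elim (proj₁ ind (◁-zero s (λ _ → _)))
  indecomposable-◁-⨁ (suc m) A {N} ind s = [ (λ t → zero , t) , (λ t → let i , u = indecomposable-◁-⨁ m (λ i → A (suc i)) {N} ind t in suc i , u) ]′
    (indecomposable-◁-⊕ {N} {mod (A zero)} {mod (⨁ m (λ i → A (suc i)))} ind s)

  vanishes-to-⨁ : ∀ m (A : Fin m → Mod Λ) {L : Module} → (∀ i → Vanishes L (mod (A i))) → Vanishes L (mod (⨁ m A))
  vanishes-to-⨁ zero A van f x = _
  vanishes-to-⨁ (suc m) A van f x = van zero (⊕-proj₁ (mod (A zero)) (mod (⨁ m (λ i → A (suc i)))) ∘ʰ f) x ,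
    vanishes-to-⨁ m (λ i → A (suc i)) (λ i → van (suc i)) (⊕-proj₂ (mod (A zero)) (mod (⨁ m (λ i → A (suc i)))) ∘ʰ f) x

  zero-ExtVanishes : {N V : Mod Λ} → IsZero (mod N) → ExtVanishes N V
  zero-ExtVanishes {N} {V} z Q π′ pQ surj g = g ∘ʰ all , λ (x , e) → cong-h g (reflᴹ (mod Q))
    where
    all : Hom (mod Q) (Kernel π′)
    all = mkHom (λ x → x , z _) (λ e → e) (λ _ _ → reflᴹ (mod Q)) (λ _ _ → reflᴹ (mod Q))

  ⨁-ExtVanishes : ∀ m (A : Fin m → Mod Λ) {V : Mod Λ} → (∀ i → ExtVanishes (A i) V) → ExtVanishes (⨁ m A) V
  ⨁-ExtVanishes zero A {V} ext = zero-ExtVanishes {zeroMod} {V} (λ _ → _)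
  ⨁-ExtVanishes (suc m) A {V} ext = ExtVanishes-⊕ {A zero} {⨁ m (λ i → A (suc i))} {V} (ext zero)
    (⨁-ExtVanishes m (λ i → A (suc i)) {V} (λ i → ext (suc i)))

  ⨁-concentrated : ∀ m (A : Fin m → Mod Λ) {T : Module} i → (∀ j → j ≢ i → Vanishes (mod (A j)) T) →
    (f : Hom (mod (⨁ m A)) T) → ∀ x → T ∋ f ⟨ x ⟩ ≈ f ⟨ proj₁ (⨁-◁ m A i) ⟨ proj₁ (proj₂ (⨁-◁ m A i)) ⟨ x ⟩ ⟩ ⟩
  ⨁-concentrated (suc m) A {T} zero van f (x , y) = T.≈ᴹ-trans (⊕-split f x y) (T.≈ᴹ-trans
      (T.+ᴹ-congˡ (rest-zero m (λ i → A (suc i)) (λ j → van (suc j) λ ()) (f ∘ʰ ⊕-inj₂ (mod (A zero)) (mod (⨁ m (λ i → A (suc i))))) y)) (T.+ᴹ-identityʳ _))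
    where
    module T = RightModule T
    rest-zero : ∀ m (B : Fin m → Mod Λ) → (∀ j → Vanishes (mod (B j)) T) → Vanishes (mod (⨁ m B)) T
    rest-zero zero B van g y = Hom.0ᴹ-homo g
    rest-zero (suc m) B van g (x , y) = T.≈ᴹ-trans (⊕-split g x y) (T.≈ᴹ-trans
      (T.+ᴹ-cong (van zero (g ∘ʰ ⊕-inj₁ (mod (B zero)) (mod (⨁ m (λ i → B (suc i))))) x)
        (rest-zero m (λ i → B (suc i)) (λ j → van (suc j)) (g ∘ʰ ⊕-inj₂ (mod (B zero)) (mod (⨁ m (λ i → B (suc i))))) y)) (T.+ᴹ-identityˡ _))
  ⨁-concentrated (suc m) A {T} (suc i) van f (x , y) = T.≈ᴹ-trans (⊕-split f x y) (T.≈ᴹ-trans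
      (T.+ᴹ-congʳ (van zero (λ ()) (f ∘ʰ ⊕-inj₁ (mod (A zero)) (mod (⨁ m (λ i → A (suc i))))) x))
      (T.≈ᴹ-trans (T.+ᴹ-identityˡ _) (⨁-concentrated m (λ i → A (suc i)) {T} i (λ j ne → van (suc j) λ e → ne (Finₚ.suc-injective e))
        (f ∘ʰ ⊕-inj₂ (mod (A zero)) (mod (⨁ m (λ i → A (suc i))))) y)))
    where module T = RightModule T

  quotient-indecomposable : {P C : Mod Λ} → Indecomposable P → Projective P → (q : P ⟶ C) → Surjective q →
    ¬ IsZero (mod C) → Indecomposable C
  quotient-indecomposable {P} {C} ind proj q q-surj nz = nz , split
    where
    module C = ModuleOps (mod C)
    module P = ModuleOps (mod P)
    split : ∀ A B → mod A ⊕ mod B ≅ mod C → IsZero (mod A) ⊎ IsZero (mod B)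
    split A B e = choose (local {P} ind a (idʰ -ʰ a) λ x → P.≈ᴹ-trans (P.+ᴹ-comm _ _) (P.⊖-+ x _))
      where
      module A = RightModule (mod A)
      module B = RightModule (mod B)
      toA : C ⟶ A
      toA = ⊕-proj₁ (mod A) (mod B) ∘ʰ inverse e
      toB : C ⟶ B
      toB = ⊕-proj₂ (mod A) (mod B) ∘ʰ inverse e
      eA : C ⟶ C
      eA = proj₁ e ∘ʰ ⊕-inj₁ (mod A) (mod B) ∘ʰ toA
      lift = proj P C q q-surj (eA ∘ʰ q)
      a : P ⟶ P
      a = proj₁ lift
      qa≈eq = proj₂ lift
      toB-eA : ∀ y → toB ⟨ eA ⟨ y ⟩ ⟩≈0
      toB-eA y = proj₂ (inverseˡ e (toA ⟨ y ⟩ , B.0ᴹ))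
      toA-eA : ∀ y → mod A ∋ toA ⟨ eA ⟨ y ⟩ ⟩ ≈ toA ⟨ y ⟩
      toA-eA y = proj₁ (inverseˡ e (toA ⟨ y ⟩ , B.0ᴹ))
      choose : Injective a ⊎ Injective (idʰ -ʰ a) → IsZero (mod A) ⊎ IsZero (mod B)
      choose (inj₁ inj) = inj₂ λ b →
        let x , p = q-surj (proj₁ e ⟨ A.0ᴹ , b ⟩) ; w , p′ = endo-surjective {P} a inj x in
        B.≈ᴹ-trans (B.≈ᴹ-sym (proj₂ (inverseˡ e (A.0ᴹ , b)))) (B.≈ᴹ-trans (cong-h toB (C.≈ᴹ-sym p))
          (B.≈ᴹ-trans (cong-h toB (cong-h q (P.≈ᴹ-sym p′))) (B.≈ᴹ-trans (cong-h toB (qa≈eq w)) (toB-eA _))))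
      choose (inj₂ inj) = inj₁ λ y →
        let x , p = q-surj (proj₁ e ⟨ y , B.0ᴹ ⟩) ; w , p′ = endo-surjective {P} (idʰ -ʰ a) inj x in
        A.≈ᴹ-trans (A.≈ᴹ-sym (proj₁ (inverseˡ e (y , B.0ᴹ)))) (A.≈ᴹ-trans (cong-h toA (C.≈ᴹ-sym p))
          (A.≈ᴹ-trans (cong-h toA (cong-h q (P.≈ᴹ-sym p′))) (A.≈ᴹ-trans (⊖-homo (toA ∘ʰ q) w (a ⟨ w ⟩))
            (ModuleOps.≈⇒⊖≈0 (mod A) (A.≈ᴹ-sym (A.≈ᴹ-trans (cong-h toA (qa≈eq w)) (toA-eA _)))))))

  -- The trace of T in X is the image of a hom Tᶜ → X with smallest cokernel.
  trace : (T X : Mod Λ) → ¬ ¬ ∃ λ c → Σ (T ^ᴹ c ⟶ X) λ t → ∀ (h : T ⟶ X) x → coker t ⟨ h ⟨ x ⟩ ⟩≈0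
  trace T X not = minimal μ (0 , 0ʰ) λ ((c , t) , least) → not (c , t , λ h x → contained c t least h x)
    where
    A : Set ℓ
    A = ∃ λ c → T ^ᴹ c ⟶ X
    μ : A → ℕ
    μ (c , t) = dim (cokMod {T ^ᴹ c} {X} t)
    contained : ∀ c (t : T ^ᴹ c ⟶ X) → (∀ a → μ (c , t) ℕ.≤ μ a) → ∀ (h : T ⟶ X) x → coker t ⟨ h ⟨ x ⟩ ⟩≈0
    contained c t least h x = injective⇒ker≈0 φ φ-injective (coker t ⟨ h ⟨ x ⟩ ⟩)
        (transᴹ (Coker t′) {φ ⟨ coker t ⟨ h ⟨ x ⟩ ⟩ ⟩} {coker t′ ⟨ h ⟨ x ⟩ ⟩} {zeroᴹ (Coker t′)}
          (φ-ok (h ⟨ x ⟩)) ((x , F.0ᴹ) , X.≈ᴹ-sym (X.≈ᴹ-trans (X.+ᴹ-identityʳ _) (X.≈ᴹ-trans (X.+ᴹ-congˡ (Hom.0ᴹ-homo t)) (X.+ᴹ-identityʳ _)))))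
      where
      module X = RightModule (mod X)
      module F = RightModule (mod (T ^ᴹ c))
      t′ : T ^ᴹ suc c ⟶ X
      t′ = [ h , t ]ʰ
      factored : Σ (Hom (Coker t) (Coker t′)) λ φ → φ ∘ʰ coker t ≈ʰ coker t′
      factored = factor-at (coker t) (coker-surjective t) (coker t′) λ y e → let z , p = coker-exact t y e in
        (zeroᴹ (mod T) , z) , X.≈ᴹ-trans (X.≈ᴹ-sym p) (X.≈ᴹ-sym (X.≈ᴹ-trans (X.+ᴹ-identityʳ _)
          (X.≈ᴹ-trans (X.+ᴹ-congʳ (Hom.0ᴹ-homo h)) (X.+ᴹ-identityˡ _))))
      φ = proj₁ factored
      φ-ok = proj₂ factored
      φ-injective : Injective φ
      φ-injective = surjective∧dim≤⇒injective {cokMod {T ^ᴹ c} {X} t} {cokMod {T ^ᴹ suc c} {X} t′} φ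
        (λ y → y , φ-ok y) (least (suc c , t′))

  once⇒not-twice : {Y N₁ N₂ K T : Module} → N₁ ⊕ N₂ ⊕ K ≅ Y → N₁ ≅ N₂ → (f : Hom N₁ T) → ¬ IsZeroHom f →
    ¬ (∀ (f g : Hom Y T) → ¬ IsZeroHom f → ¬ IsZeroHom g → ∀ x → g ⟨ x ⟩≈0 → f ⟨ x ⟩≈0)
  once⇒not-twice {Y} {N₁} {N₂} {K} {T} e i f f≉0 once = f≉0 λ x →
      T.≈ᴹ-trans (T.≈ᴹ-sym (cong-h f (pr₁-in₁ x))) (once (f ∘ʰ pr₁) (g ∘ʰ pr₂) f-nonzero g-nonzero (in₁ ⟨ x ⟩)
        (T.≈ᴹ-trans (cong-h g (proj₁ (proj₂ (inverseˡ e (x , N₂.0ᴹ , K.0ᴹ))))) (Hom.0ᴹ-homo g)))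
    where
    module N₁ = RightModule N₁
    module N₂ = RightModule N₂
    module K = RightModule K
    module T = RightModule T
    g : Hom N₂ T
    g = f ∘ʰ inverse i
    in₁ : Hom N₁ Y
    in₁ = proj₁ e ∘ʰ ⊕-inj₁ N₁ (N₂ ⊕ K)
    in₂ : Hom N₂ Y
    in₂ = proj₁ e ∘ʰ ⊕-inj₂ N₁ (N₂ ⊕ K) ∘ʰ ⊕-inj₁ N₂ K
    pr₁ : Hom Y N₁
    pr₁ = ⊕-proj₁ N₁ (N₂ ⊕ K) ∘ʰ inverse e
    pr₂ : Hom Y N₂
    pr₂ = ⊕-proj₁ N₂ K ∘ʰ ⊕-proj₂ N₁ (N₂ ⊕ K) ∘ʰ inverse e
    pr₁-in₁ : ∀ x → N₁ ∋ pr₁ ⟨ in₁ ⟨ x ⟩ ⟩ ≈ x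
    pr₁-in₁ x = proj₁ (inverseˡ e (x , N₂.0ᴹ , K.0ᴹ))
    pr₂-in₂ : ∀ y → N₂ ∋ pr₂ ⟨ in₂ ⟨ y ⟩ ⟩ ≈ y
    pr₂-in₂ y = proj₁ (proj₂ (inverseˡ e (N₁.0ᴹ , y , K.0ᴹ)))
    f-nonzero : ¬ IsZeroHom (f ∘ʰ pr₁)
    f-nonzero z = f≉0 λ x → T.≈ᴹ-trans (T.≈ᴹ-sym (cong-h f (pr₁-in₁ x))) (z (in₁ ⟨ x ⟩))
    g-nonzero : ¬ IsZeroHom (g ∘ʰ pr₂)
    g-nonzero z = f≉0 λ x → T.≈ᴹ-trans (T.≈ᴹ-sym (cong-h f (inverseˡ i x)))
      (T.≈ᴹ-trans (T.≈ᴹ-sym (cong-h g (pr₂-in₂ (proj₁ i ⟨ x ⟩)))) (z (in₂ ⟨ proj₁ i ⟨ x ⟩ ⟩)))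

module SpecialElements {ℓ} {k : Field ℓ} (Λ : FDAlgebra k) (hereditary : Hereditary Λ) (basicAlgebra : BasicAlgebra Λ)
  {n′ : ℕ} (count : ∣_∣≡_ {Λ = Λ} (FDAlgebra.regular Λ) (suc n′))
  (top : Counting.Tops Λ count) where
  open Elements Λ hereditary basicAlgebra count top public
  open Sums Λ public using (indecomposable-◁-⊕; ⨁; ⨁-◁; indecomposable-◁-⨁; vanishes-to-⨁; ⨁-ExtVanishes; ⨁-concentrated; quotient-indecomposable; trace; once⇒not-twice)
  private
    module Λ = FDAlgebra Λ

  vanishes⇒Extends : {Q N V : Module} (π′ : Hom Q N) → Vanishes (Kernel π′) V → Extends π′ V
  vanishes⇒Extends {V = V} π′ van g = 0ʰ , λ x → symᴹ V (van g x)

  zeroElement : s-τ-tilt Λ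
  zeroElement = record
    { M = zeroMod
    ; basic = zero⇒basic (λ _ → _)
    ; P = Λᴹ
    ; P-basic = basicAlgebra
    ; isPair = record
      { projective = Λ-projective
      ; τ-rigid = zero-τ-vanishes zeroMod zeroMod (λ _ → _)
      ; Hom[P,M]≈0 = λ f x → _
      ; count = 0 , suc n′ , zero-Count (λ _ → _) , count , count
      }
    }

  module SimpleElement (j : Fin (suc n′)) where
    L : Mod Λ
    L = proj₁ (isSummand count j)

    P⊕L : mod (P j) ⊕ mod L ≅ Λ.regular
    P⊕L = proj₂ (isSummand count j)

    L◁Λ : mod L ◁ Λ.regular
    L◁Λ = ◁-trans ⊕-◁₂ (≅⇒◁ P⊕L)

    L-projective : Projective L
    L-projective = ◁-projective {Λᴹ} {L} Λ-projective L◁Λ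

    P⋪L : {N : Mod Λ} → mod N ◁ mod L → ¬ mod N ≅ mod (P j)
    P⋪L {N} s e = basicAlgebra (P j) N (proj₁ (◁⇒summand {N} {L} s)) (P-indecomposable j) ind
        (≅-trans (⊕-map-≅ʳ (proj₂ (◁⇒summand {N} {L} s))) P⊕L) (≅-sym e)
      where
      ind : Indecomposable N
      ind = (λ z → proj₁ (P-indecomposable j) (≅-zero e z)) , λ A B d → proj₂ (P-indecomposable j) A B (≅-trans d e)

    L-S-vanishes : Vanishes (mod L) (mod (S j))
    L-S-vanishes f = zeroHom-stable {L} {S j} f λ f≉0 → P⋪L {P j} (P◁projective {j} {L} L-projective f f≉0) ≅-refl

    P◁L : ∀ i → i ≢ j → mod (P i) ◁ mod L
    P◁L i i≢j = [ (λ s → ⊥-elim (i≢j (≅⇒≡ (indecomposable-◁ {P i} {P j} (P-indecomposable j) (proj₁ (P-indecomposable i)) s)))) , (λ s → s) ]′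
      (indecomposable-◁-⊕ {P i} {mod (P j)} {mod L} (P-indecomposable i) (◁-trans (P◁Λ i) (≅⇒◁ (≅-sym P⊕L))))

    L-count : Count (mod L) n′
    L-count = record
      { summand = λ i → P (punchIn j i)
      ; indecomposable = λ i → P-indecomposable (punchIn j i)
      ; isSummand = λ i → ◁⇒summand {P (punchIn j i)} {L} (P◁L (punchIn j i) (Finₚ.punchInᵢ≢i j i))
      ; distinct = λ i i′ ne e → ne (Finₚ.punchIn-injective j i i′ (≅⇒≡ e))
      ; complete = λ N ind s → found N ind (summand⇒◁ {N} s)
      }
      where
      found : ∀ N → Indecomposable N → mod N ◁ mod L → ∃ λ i → mod N ≅ mod (P (punchIn j i))
      found N ind s = let i , e = complete count N ind (◁⇒summand {N} {Λᴹ} (◁-trans s L◁Λ))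
                          j≢i = λ j≡i → P⋪L {N} s (subst (λ l → mod N ≅ mod (P l)) (sym j≡i) e) in
        punchOut j≢i , subst (λ l → mod N ≅ mod (P l)) (sym (Finₚ.punchIn-punchOut j≢i)) e

    S-ExtVanishes : ExtVanishes (S j) (S j)
    S-ExtVanishes = Extends⇒ExtVanishes {S j} {S j} {P j} {S j} ◁-refl (π j) (P-projective j) (π-surjective j)
      (vanishes⇒Extends (π j) (R-S-vanishes j))

    simpleElement : s-τ-tilt Λ
    simpleElement = record
      { M = S j
      ; basic = indecomposable⇒basic {S j} (simple⇒indecomposable {S j} (S-simple j))
      ; P = L
      ; P-basic = basic-◁ {Λᴹ} {L} L◁Λ basicAlgebra
      ; isPair = record
        { projective = L-projective
        ; τ-rigid = ExtVanishes⇒Hom-τ-vanishes hereditary {S j} {S j} S-ExtVanishes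
        ; Hom[P,M]≈0 = L-S-vanishes
        ; count = 1 , n′ , singleton (S j) (simple⇒indecomposable {S j} (S-simple j)) , L-count , count
        }
      }

  -- The pair (Λ/ΛeᵢΛ, Pᵢ): Y is the sum of the quotients of Pⱼ, j ≠ i, by the trace of Pᵢ.
  module QuotientElement (i : Fin (suc n′))
    (traces : ∀ j → ∃ λ c → Σ (P i ^ᴹ c ⟶ P j) λ t → ∀ (h : P i ⟶ P j) x → coker t ⟨ h ⟨ x ⟩ ⟩≈0) where

    C : Fin (suc n′) → Mod Λ
    C j = cokMod {P i ^ᴹ proj₁ (traces j)} {P j} (proj₁ (proj₂ (traces j)))

    c : ∀ j → P j ⟶ C j
    c j = coker (proj₁ (proj₂ (traces j)))

    c-surjective : ∀ j → Surjective (c j)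
    c-surjective j = coker-surjective (proj₁ (proj₂ (traces j)))

    P-C-vanishes : ∀ j → Vanishes (mod (P i)) (mod (C j))
    P-C-vanishes j f x = let h , e = P-projective i (P j) (C j) (c j) (c-surjective j) f in
      transᴹ (mod (C j)) {f ⟨ x ⟩} {c j ⟨ h ⟨ x ⟩ ⟩} (symᴹ (mod (C j)) {c j ⟨ h ⟨ x ⟩ ⟩} {f ⟨ x ⟩} (e x)) (proj₂ (proj₂ (traces j)) h x)

    module _ {j} (j≢i : j ≢ i) where
      abstract
        factored : Σ (C j ⟶ S j) λ ρ → ρ ∘ʰ c j ≈ʰ π j
        factored = factor-at (c j) (c-surjective j) (π j) λ x e →
          let z , p = coker-exact (proj₁ (proj₂ (traces j))) x e in
          transᴹ (mod (S j)) (symᴹ (mod (S j)) (cong-h (π j) p))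
            (vanishes-^ (proj₁ (traces j)) (π j ∘ʰ proj₁ (proj₂ (traces j))) z)
          where
          vanishes-^ : ∀ m → Vanishes (mod (P i ^ᴹ m)) (mod (S j))
          vanishes-^ m = subst (λ X → Vanishes X (mod (S j))) (sym (^ᴹ-mod (P i) m))
            (vanishes-^⊕ (P-S-vanishes λ e → j≢i (sym e)) m)

      ρ : C j ⟶ S j
      ρ = proj₁ factored

      ρ-surjective : Surjective ρ
      ρ-surjective y = let x , e = π-surjective j y in c j ⟨ x ⟩ , transᴹ (mod (S j)) (proj₂ factored x) e

      C-indecomposable : Indecomposable (C j)
      C-indecomposable = quotient-indecomposable {P j} {C j} (P-indecomposable j) (P-projective j) (c j) (c-surjective j) λ z →
        proj₁ (S-simple j) λ y → let x , e = ρ-surjective y in transᴹ (mod (S j))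
          (symᴹ (mod (S j)) e) (transᴹ (mod (S j)) (Hom.⟦⟧-cong ρ {x} {zeroᴹ (mod (C j))} (z x)) (Hom.0ᴹ-homo ρ))

    C-S-vanishes : ∀ {j l} → j ≢ l → Vanishes (mod (C j)) (mod (S l))
    C-S-vanishes {j} {l} j≢l = vanishes-from (c j) (c-surjective j) (P-S-vanishes j≢l)

    C≅⇒≡ : ∀ {j l} → j ≢ i → mod (C j) ≅ mod (C l) → j ≡ l
    C≅⇒≡ {j} {l} j≢i e = [ (λ j≡l → j≡l) , (λ j≢l → ⊥-elim (surjective⇒nonzero {C j} {S j} (proj₁ (S-simple j)) (ρ j≢i) (ρ-surjective j≢i)
      (vanishes-◁ (≅⇒◁ e) (C-S-vanishes {l} {j} (λ e′ → j≢l (sym e′))) (ρ j≢i)))) ]′ (≡-or-≢ j l)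

    index : Fin n′ → Fin (suc n′)
    index a = punchIn i a

    index≢ : ∀ a → index a ≢ i
    index≢ a = Finₚ.punchInᵢ≢i i a

    A : Fin n′ → Mod Λ
    A a = C (index a)

    Y : Mod Λ
    Y = ⨁ n′ A

    A-indecomposable : ∀ a → Indecomposable (A a)
    A-indecomposable a = C-indecomposable (index≢ a)

    Y-summand : ∀ (N : Mod Λ) → Indecomposable N → mod N ◁ mod Y → ∃ λ a → mod N ≅ mod (A a)
    Y-summand N ind s = let a , t = indecomposable-◁-⨁ n′ A {N} ind s in
      a , indecomposable-◁ {N} {A a} (A-indecomposable a) (proj₁ ind) t

    Y-count : Count (mod Y) n′
    Y-count = record
      { summand = A
      ; indecomposable = A-indecomposable
      ; isSummand = λ a → ◁⇒summand {A a} {Y} (⨁-◁ n′ A a)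
      ; distinct = λ a b ne e → ne (Finₚ.punchIn-injective i a b (C≅⇒≡ (index≢ a) e))
      ; complete = λ N ind s → Y-summand N ind (summand⇒◁ {N} s)
      }

    onto-S : ∀ {j} → j ≢ i → Σ (Y ⟶ S j) Surjective
    onto-S {j} j≢i = subst (λ l → Σ (Y ⟶ S l) Surjective) (Finₚ.punchIn-punchOut i≢j) (f , surj)
      where
      i≢j : i ≢ j
      i≢j e = j≢i (sym e)
      a : Fin n′
      a = punchOut i≢j
      s = ⨁-◁ n′ A a
      f : Y ⟶ S (index a)
      f = ρ (index≢ a) ∘ʰ proj₁ (proj₂ s)
      surj : Surjective f
      surj y = let x , e = ρ-surjective (index≢ a) y in proj₁ s ⟨ x ⟩ ,
        transᴹ (mod (S (index a))) (Hom.⟦⟧-cong (ρ (index≢ a)) {proj₁ (proj₂ s) ⟨ proj₁ s ⟨ x ⟩ ⟩} {x} (proj₂ (proj₂ s) x)) e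

    P-Y-vanishes : Vanishes (mod (P i)) (mod Y)
    P-Y-vanishes = vanishes-to-⨁ n′ A (λ a → P-C-vanishes (index a))

    C-ExtVanishes : ∀ j → ExtVanishes (C j) Y
    C-ExtVanishes j = Extends⇒ExtVanishes {C j} {C j} {P j} {Y} ◁-refl (c j) (P-projective j) (c-surjective j)
      (vanishes⇒Extends (c j) λ g (x , e) → let z , p = coker-exact t x e in
        transᴹ (mod Y) (Hom.⟦⟧-cong g {x , e} {t ⟨ z ⟩ , coker-∘ t z} (symᴹ (mod (P j)) p)) (from-trace (g ∘ʰ into) z))
      where
      m = proj₁ (traces j)
      t : P i ^ᴹ m ⟶ P j
      t = proj₁ (proj₂ (traces j))
      into : Hom (mod (P i ^ᴹ m)) (Kernel (c j))
      into = mkHom (λ z → t ⟨ z ⟩ , coker-∘ t z) (cong-h t) (Hom.+ᴹ-homo t) (Hom.*ᵣ-homo t)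
      from-trace : Vanishes (mod (P i ^ᴹ m)) (mod Y)
      from-trace = subst (λ X → Vanishes X (mod Y)) (sym (^ᴹ-mod (P i) m)) (vanishes-^⊕ P-Y-vanishes m)

    -- Both homs Y → S j factor through P j, whose radical is the only maximal submodule.
    top-once : ∀ a (f g : Y ⟶ S (index a)) → ¬ IsZeroHom f → ¬ IsZeroHom g → ∀ x → g ⟨ x ⟩≈0 → f ⟨ x ⟩≈0
    top-once a f g f≉0 g≉0 x gx≈0 = Sa.≈ᴹ-trans (seen f x) (radical-unique {P j} (P-indecomposable j) (P-projective j) {S j} {S j} (S-simple j) (S-simple j)
        (g ∘ʰ κ) (nonzero g g≉0) (f ∘ʰ κ) (nonzero f f≉0) (lift x) (Sa.≈ᴹ-trans (Sa.≈ᴹ-sym (seen g x)) gx≈0))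
      where
      j = index a
      module Sa = RightModule (mod (S j))
      s = ⨁-◁ n′ A a
      κ : P j ⟶ Y
      κ = proj₁ s ∘ʰ c j
      lift : El (mod Y) → El (mod (P j))
      lift x = proj₁ (c-surjective j (proj₁ (proj₂ s) ⟨ x ⟩))
      seen : ∀ (h : Y ⟶ S j) x → mod (S j) ∋ h ⟨ x ⟩ ≈ h ⟨ κ ⟨ lift x ⟩ ⟩
      seen h x = Sa.≈ᴹ-trans (⨁-concentrated n′ A a (λ b b≢a → C-S-vanishes λ e → b≢a (Finₚ.punchIn-injective i b a e)) h x)
        (cong-h h (Hom.⟦⟧-cong (proj₁ s) {proj₁ (proj₂ s) ⟨ x ⟩} {c j ⟨ lift x ⟩} (symᴹ (mod (A a)) {c j ⟨ lift x ⟩} {proj₁ (proj₂ s) ⟨ x ⟩} (proj₂ (c-surjective j (proj₁ (proj₂ s) ⟨ x ⟩))))))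
      nonzero : ∀ (h : Y ⟶ S j) → ¬ IsZeroHom h → ¬ IsZeroHom (h ∘ʰ κ)
      nonzero h h≉0 z = h≉0 λ y → Sa.≈ᴹ-trans (seen h y) (z (lift y))

    S-top : ∀ a {N : Mod Λ} → mod N ≅ mod (A a) → Σ (N ⟶ S (index a)) λ f → ¬ IsZeroHom f
    S-top a {N} e = ρ (index≢ a) ∘ʰ proj₁ e , λ z →
      surjective⇒nonzero {A a} {S (index a)} (proj₁ (S-simple (index a))) (ρ (index≢ a)) (ρ-surjective (index≢ a)) λ y →
        Sa.≈ᴹ-trans (Hom.⟦⟧-cong (ρ (index≢ a)) {y} {proj₁ e ⟨ inverse e ⟨ y ⟩ ⟩}
          (symᴹ (mod (A a)) {proj₁ e ⟨ inverse e ⟨ y ⟩ ⟩} {y} (inverseʳ e y))) (z (inverse e ⟨ y ⟩))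
      where module Sa = RightModule (mod (S (index a)))

    twice⇒⊥ : ∀ a {N₁ N₂ K : Mod Λ} → mod N₁ ⊕ mod N₂ ⊕ mod K ≅ mod Y → mod N₁ ≅ mod N₂ → ¬ mod N₁ ≅ mod (A a)
    twice⇒⊥ a {N₁} {N₂} {K} e N₁≅N₂ i = once⇒not-twice {mod Y} {mod N₁} {mod N₂} {mod K} {mod (S (index a))} e N₁≅N₂
      (proj₁ (S-top a {N₁} i)) (proj₂ (S-top a {N₁} i)) (top-once a)

    Y-basic : Basic {Λ = Λ} (mod Y)
    Y-basic N₁ N₂ K ind₁ ind₂ e N₁≅N₂ = let a , i = Y-summand N₁ ind₁ (◁-trans ⊕-◁₁ (≅⇒◁ e)) in
      twice⇒⊥ a {N₁} {N₂} {K} e N₁≅N₂ i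

    quotientElement : s-τ-tilt Λ
    quotientElement = record
      { M = Y
      ; basic = Y-basic
      ; P = P i
      ; P-basic = indecomposable⇒basic {P i} (P-indecomposable i)
      ; isPair = record
        { projective = P-projective i
        ; τ-rigid = ExtVanishes⇒Hom-τ-vanishes hereditary {Y} {Y} (⨁-ExtVanishes n′ A {Y} (λ a → C-ExtVanishes (index a)))
        ; Hom[P,M]≈0 = P-Y-vanishes
        ; count = n′ , 1 , Y-count , singleton (P i) (P-indecomposable i) , subst (Count Λ.regular) (ℕₚ.+-comm 1 n′) count
        }
      }

module ℤSum = SemiringSum ℤₚ.+-*-semiring

∑ : ∀ {n} → (Fin n → ℤ) → ℤ
∑ = ℤSum.sum

∑-cong : ∀ {n} {f g : Fin n → ℤ} → (∀ i → f i ≡ g i) → ∑ f ≡ ∑ g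
∑-cong = ℤSum.sum-cong-≋

∑-0 : ∀ {n} {f : Fin n → ℤ} → (∀ i → f i ≡ 0ℤ) → ∑ f ≡ 0ℤ
∑-0 {n} e = trans (∑-cong e) (ℤSum.sum-replicate-zero n)

∑-+ : ∀ {n} (f g : Fin n → ℤ) → ∑ (λ i → f i ℤ.+ g i) ≡ ∑ f ℤ.+ ∑ g
∑-+ = ℤSum.∑-distrib-+

∑-*ˡ : ∀ {n} c (f : Fin n → ℤ) → c ℤ.* ∑ f ≡ ∑ (λ i → c ℤ.* f i)
∑-*ˡ c f = ℤSum.*-distribˡ-sum c f

∑-*ʳ : ∀ {n} c (f : Fin n → ℤ) → ∑ f ℤ.* c ≡ ∑ (λ i → f i ℤ.* c)
∑-*ʳ c f = ℤSum.*-distribʳ-sum c f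

∑-remove : ∀ {n} (p : Fin (suc n)) (f : Fin (suc n) → ℤ) → ∑ f ≡ f p ℤ.+ ∑ (λ i → f (punchIn p i))
∑-remove p f = ℤSum.sum-remove {i = p} f

dependent : ∀ m (g : Fin (suc m) → Fin m → ℤ) →
  ∃ λ (a : Fin (suc m) → ℤ) → (∃ λ i → a i ≢ 0ℤ) × (∀ j → ∑ (λ i → a i ℤ.* g i j) ≡ 0ℤ)
dependent zero g = (λ _ → 1ℤ) , (zero , λ ()) , λ ()
dependent (suc m) g with Finₚ.any? (λ i → ¬? (g i zero ℤₚ.≟ 0ℤ))
... | no none = let a , (i , nz) , rel = dependent m (λ i j → g (suc i) (suc j)) in
  0ℤ ∷ a , (suc i , nz) , λ
  { zero → trans (ℤₚ.+-identityˡ _) (∑-0 λ i → trans (cong (a i ℤ.*_) (column (suc i))) (ℤₚ.*-zeroʳ (a i)))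
  ; (suc j) → trans (ℤₚ.+-identityˡ _) (rel j)
  }
  where
  column : ∀ i → g i zero ≡ 0ℤ
  column i = decidable-stable (g i zero ℤₚ.≟ 0ℤ) λ nz → none (i , nz)
... | yes (p , γ≢0) = a , (punchIn p (proj₁ nz) , λ e → a-nz (trans (sym (a-punchIn (proj₁ nz))) e)) , rel
  where
  γ : ℤ
  γ = g p zero
  r : Fin (suc m) → Fin (suc m) → ℤ
  r i j = g (punchIn p i) j
  IH = dependent m λ i j → γ ℤ.* r i (suc j) ℤ.- r i zero ℤ.* g p (suc j)
  a′ : Fin (suc m) → ℤ
  a′ = proj₁ IH
  nz = proj₁ (proj₂ IH)
  s : ℤ
  s = ∑ λ i → a′ i ℤ.* r i zero
  a : Fin (suc (suc m)) → ℤ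
  a = insertAt (λ i → γ ℤ.* a′ i) p (ℤ.- s)
  a-punchIn : ∀ i → a (punchIn p i) ≡ γ ℤ.* a′ i
  a-punchIn = insertAt-punchIn (λ i → γ ℤ.* a′ i) p (ℤ.- s)
  a-nz : γ ℤ.* a′ (proj₁ nz) ≢ 0ℤ
  a-nz e = [ γ≢0 , proj₂ nz ]′ (ℤₚ.i*j≡0⇒i≡0∨j≡0 γ e)
  expand : ∀ j → ∑ (λ i → a i ℤ.* g i j) ≡ ℤ.- s ℤ.* g p j ℤ.+ ∑ (λ i → (γ ℤ.* a′ i) ℤ.* r i j)
  expand j = trans (∑-remove p (λ i → a i ℤ.* g i j)) (cong₂ ℤ._+_
    (cong (ℤ._* g p j) (insertAt-lookup (λ i → γ ℤ.* a′ i) p (ℤ.- s)))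
    (∑-cong λ i → cong (ℤ._* r i j) (a-punchIn i)))
  rel : ∀ j → ∑ (λ i → a i ℤ.* g i j) ≡ 0ℤ
  rel zero = trans (expand zero) (trans (cong (λ z → ℤ.- s ℤ.* γ ℤ.+ z)
      (trans (∑-cong λ i → ℤₚ.*-assoc γ (a′ i) (r i zero)) (sym (∑-*ˡ γ λ i → a′ i ℤ.* r i zero)))) (cancel s γ))
    where
    cancel : ∀ x y → ℤ.- x ℤ.* y ℤ.+ y ℤ.* x ≡ 0ℤ
    cancel = solve-∀
  rel (suc j) = trans (expand (suc j)) (trans (cong (ℤ._+ ∑ (λ i → (γ ℤ.* a′ i) ℤ.* r i (suc j))) first-term)
      (trans (sym (∑-+ (λ i → ℤ.- (a′ i ℤ.* r i zero) ℤ.* g p (suc j)) (λ i → (γ ℤ.* a′ i) ℤ.* r i (suc j))))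
        (trans (∑-cong λ i → regroup (a′ i) (r i zero) (g p (suc j)) γ (r i (suc j))) (proj₂ (proj₂ IH) j))))
    where
    neg : ∀ x y → ℤ.- x ℤ.* y ≡ x ℤ.* (ℤ.- y)
    neg = solve-∀
    neg′ : ∀ x y → x ℤ.* (ℤ.- y) ≡ ℤ.- x ℤ.* y
    neg′ = solve-∀
    first-term : ℤ.- s ℤ.* g p (suc j) ≡ ∑ (λ i → ℤ.- (a′ i ℤ.* r i zero) ℤ.* g p (suc j))
    first-term = trans (neg s (g p (suc j))) (trans (∑-*ʳ (ℤ.- g p (suc j)) λ i → a′ i ℤ.* r i zero)
      (∑-cong λ i → neg′ (a′ i ℤ.* r i zero) (g p (suc j))))
    regroup : ∀ x y z u v → ℤ.- (x ℤ.* y) ℤ.* z ℤ.+ (u ℤ.* x) ℤ.* v ≡ x ℤ.* (u ℤ.* v ℤ.- y ℤ.* z)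
    regroup = solve-∀

left-kernel : ∀ n (g : Fin n → Fin n → ℤ) (y : Fin n → ℤ) → (∃ λ j → y j ≢ 0ℤ) → (∀ i → ∑ (λ j → g i j ℤ.* y j) ≡ 0ℤ) →
  ∃ λ (a : Fin n → ℤ) → (∃ λ i → a i ≢ 0ℤ) × (∀ j → ∑ (λ i → a i ℤ.* g i j) ≡ 0ℤ)
left-kernel (suc m) g y (q , yq≢0) gy≡0 = a , proj₁ (proj₂ relation) , rel
  where
  relation = dependent m λ i j → g i (punchIn q j)
  a : Fin (suc m) → ℤ
  a = proj₁ relation
  column : Fin (suc m) → ℤ
  column j = ∑ λ i → a i ℤ.* g i j
  total : ∑ (λ j → column j ℤ.* y j) ≡ 0ℤ
  total = trans (∑-cong λ j → ∑-*ʳ (y j) λ i → a i ℤ.* g i j)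
    (trans (ℤSum.∑-comm λ j i → (a i ℤ.* g i j) ℤ.* y j)
      (∑-0 λ i → trans (∑-cong λ j → ℤₚ.*-assoc (a i) (g i j) (y j))
        (trans (sym (∑-*ˡ (a i) λ j → g i j ℤ.* y j)) (trans (cong (a i ℤ.*_) (gy≡0 i)) (ℤₚ.*-zeroʳ (a i))))))
  column-q : column q ≡ 0ℤ
  column-q = [ (λ e → e) , (λ e → ⊥-elim (yq≢0 e)) ]′ (ℤₚ.i*j≡0⇒i≡0∨j≡0 (column q) (trans (sym (ℤₚ.+-identityʳ _))
    (trans (cong (λ z → column q ℤ.* y q ℤ.+ z) (sym (∑-0 λ j → cong (ℤ._* y (punchIn q j)) (proj₂ (proj₂ relation) j))))
      (trans (sym (∑-remove q λ j → column j ℤ.* y j)) total))))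
  rel : ∀ j → column j ≡ 0ℤ
  rel j with q Finₚ.≟ j
  ... | yes refl = column-q
  ... | no q≢j = subst (λ l → column l ≡ 0ℤ) (Finₚ.punchIn-punchOut q≢j) (proj₂ (proj₂ relation) (punchOut q≢j))

bounded : ∀ n (f : Fin n → ℕ) → ∃ λ N → ∀ i → f i ℕ.≤ N
bounded zero f = 0 , λ ()
bounded (suc n) f = let N , le = bounded n (λ i → f (suc i)) in
  f zero ℕ.+ N , λ { zero → ℕₚ.m≤m+n _ _ ; (suc i) → ℕₚ.≤-trans (le i) (ℕₚ.m≤n+m _ _) }

maximal : ∀ {a} {A : Set a} (μ : A → ℕ) N → (∀ x → μ x ℕ.≤ N) → A → ¬ ¬ Σ A λ x → ∀ y → μ y ℕ.≤ μ x
maximal μ N le x not = minimal (λ y → N ℕ.∸ μ y) x λ (y , least) → not (y , λ z →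
  ℕₚ.≮⇒≥ λ lt → ℕₚ.<⇒≱ (ℕₚ.∸-monoʳ-< lt (le z)) (least z))

module Rigid {ℓ} {k : Field ℓ} (Λ : FDAlgebra k) (hereditary : Hereditary Λ) where
  open Counting Λ public

  module PresentationK (M : Mod Λ) where
    open Presentation M public
    K-projective : Projective K
    K-projective = hereditary Q K (Kernel-incl π) Q-projective (λ e → e)

  -- A lift k of π restricted to π⁻¹(im f) through f differs from an extension of k | Ker π by a hom that
  -- factors through im f. So 1 is a sum of two endomorphisms of U, one of which kills ker f, while
  -- invertibility of the other splits V → V / im f.
  happel-ringel : {U V : Mod Λ} → Indecomposable U → Indecomposable V → ExtVanishes V U →
    (f : U ⟶ V) → ¬ IsZeroHom f → Injective f ⊎ Surjective f
  happel-ringel {U} {V} indU indV ext f f≉0 = choose (local {U} indU a b λ u → U.≈ᴹ-trans (U.+ᴹ-comm _ _) (U.⊖-+ u _))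
    where
    module U = ModuleOps (mod U)
    module V = ModuleOps (mod V)
    open Presentation V using (Q; Q-projective; π; π-surjective)
    module Q = RightModule (mod Q)
    C : Mod Λ
    C = cokMod {U} {V} f
    module C = ModuleOps (mod C)
    p : V ⟶ C
    p = coker f
    κ : Q ⟶ C
    κ = p ∘ʰ π
    K : Mod Λ
    K = kerMod {Q} {C} κ
    module K = RightModule (mod K)
    K-projective : Projective K
    K-projective = hereditary Q K (Kernel-incl κ) Q-projective (λ e → e)
    I : Mod Λ
    I = kerMod {V} {C} p
    f′ : U ⟶ I
    f′ = mkHom (λ u → f ⟨ u ⟩ , coker-∘ f u) (cong-h f) (Hom.+ᴹ-homo f) (Hom.*ᵣ-homo f)
    f′-surjective : Surjective f′
    f′-surjective (v , pv≈0) = coker-exact f v pv≈0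
    π′ : K ⟶ I
    π′ = mkHom (λ (y , e) → π ⟨ y ⟩ , e) (cong-h π) (λ _ _ → Hom.+ᴹ-homo π _ _) (λ _ _ → Hom.*ᵣ-homo π _ _)
    π′-surjective : Surjective π′
    π′-surjective (v , pv≈0) = let y , e = π-surjective v in (y , C.≈ᴹ-trans {κ ⟨ y ⟩} {p ⟨ v ⟩} (Hom.⟦⟧-cong p e) pv≈0) , e
    lift : Σ (K ⟶ U) λ h → f′ ∘ʰ h ≈ʰ π′
    lift = K-projective U I f′ f′-surjective π′
    h : K ⟶ U
    h = proj₁ lift
    fh≈π : ∀ y → mod V ∋ f ⟨ h ⟨ y ⟩ ⟩ ≈ π ⟨ proj₁ y ⟩
    fh≈π y = proj₂ lift y
    include : Hom (Kernel π) (mod K)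
    include = mkHom (λ (y , e) → y , C.≈ᴹ-trans {κ ⟨ y ⟩} {p ⟨ V.0ᴹ ⟩} (Hom.⟦⟧-cong p e) (Hom.0ᴹ-homo p)) (λ e → e) (λ _ _ → Q.≈ᴹ-refl) (λ _ _ → Q.≈ᴹ-refl)
    extended : Σ (Q ⟶ U) λ e → ∀ y → mod U ∋ e ⟨ proj₁ y ⟩ ≈ h ⟨ include ⟨ y ⟩ ⟩
    extended = ext Q π Q-projective π-surjective (h ∘ʰ include)
    e₂ : Q ⟶ U
    e₂ = proj₁ extended
    difference : K ⟶ U
    difference = h -ʰ e₂ ∘ʰ Kernel-incl κ
    descended : Σ (I ⟶ U) λ d → d ∘ʰ π′ ≈ʰ difference
    descended = factor-at π′ π′-surjective difference λ (y , κy≈0) πy≈0 →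
      U.≈⇒⊖≈0 (U.≈ᴹ-trans (Hom.⟦⟧-cong h {y , κy≈0} {include ⟨ y , πy≈0 ⟩} Q.≈ᴹ-refl) (U.≈ᴹ-sym (proj₂ extended (y , πy≈0))))
    a : U ⟶ U
    a = proj₁ descended ∘ʰ f′
    b : U ⟶ U
    b = idʰ -ʰ a
    f-injective : Injective a → Injective f
    f-injective inj = ker≈0⇒injective f λ u e → injective⇒ker≈0 a inj u
      (U.≈ᴹ-trans (Hom.⟦⟧-cong (proj₁ descended) {f′ ⟨ u ⟩} {zeroᴹ (mod I)} e) (Hom.0ᴹ-homo (proj₁ descended)))
    bh≈e₂ : ∀ y → mod U ∋ b ⟨ h ⟨ y ⟩ ⟩ ≈ e₂ ⟨ proj₁ y ⟩
    bh≈e₂ y = U.≈ᴹ-trans (U.⊖-cong U.≈ᴹ-refl (U.≈ᴹ-trans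
        (Hom.⟦⟧-cong (proj₁ descended) {f′ ⟨ h ⟨ y ⟩ ⟩} {π′ ⟨ y ⟩} (fh≈π y)) (proj₂ descended y)))
      (U.⊖-⊖ _ _)
    f-surjective : Injective b → Surjective f
    f-surjective inj = [ (λ z v → coker-exact f v (z v)) , (λ nz → ⊥-elim (f≉0 (f≈0 nz))) ]′ (isZero? C)
      where
      b-iso : mod U ≅ mod U
      b-iso = b , inj , endo-surjective {U} b inj
      c : Q ⟶ U
      c = inverse b-iso ∘ʰ e₂
      c-on-K : ∀ y → mod U ∋ c ⟨ proj₁ y ⟩ ≈ h ⟨ y ⟩
      c-on-K y = U.≈ᴹ-trans (Hom.⟦⟧-cong (inverse b-iso) (U.≈ᴹ-sym (bh≈e₂ y))) (inverseˡ b-iso (h ⟨ y ⟩))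
      section : Σ (C ⟶ V) λ s → s ∘ʰ κ ≈ʰ (π -ʰ f ∘ʰ c)
      section = factor-at κ (λ v → π-surjective′ v) (π -ʰ f ∘ʰ c) λ y e →
        V.≈⇒⊖≈0 (V.≈ᴹ-sym (V.≈ᴹ-trans (Hom.⟦⟧-cong f (c-on-K (y , e))) (fh≈π (y , e))))
        where
        π-surjective′ : Surjective κ
        π-surjective′ v = let y , e = π-surjective v in y , Hom.⟦⟧-cong p e
      s : C ⟶ V
      s = proj₁ section
      ps≈id : ∀ v → mod C ∋ p ⟨ s ⟨ v ⟩ ⟩ ≈ v
      ps≈id v = let y , e = π-surjective v in
        C.≈ᴹ-trans {p ⟨ s ⟨ v ⟩ ⟩} {p ⟨ s ⟨ κ ⟨ y ⟩ ⟩ ⟩} {v} (Hom.⟦⟧-cong p (Hom.⟦⟧-cong s {v} {κ ⟨ y ⟩} (C.≈ᴹ-sym {κ ⟨ y ⟩} {v} (Hom.⟦⟧-cong p e))))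
        (C.≈ᴹ-trans {p ⟨ s ⟨ κ ⟨ y ⟩ ⟩ ⟩} {p ⟨ π ⟨ y ⟩ V.⊖ f ⟨ c ⟨ y ⟩ ⟩ ⟩} {v} (Hom.⟦⟧-cong p (proj₂ section y))
        (C.≈ᴹ-trans {p ⟨ π ⟨ y ⟩ V.⊖ f ⟨ c ⟨ y ⟩ ⟩ ⟩} {p ⟨ π ⟨ y ⟩ ⟩ C.⊖ C.0ᴹ} {v}
          (C.≈ᴹ-trans {p ⟨ π ⟨ y ⟩ V.⊖ f ⟨ c ⟨ y ⟩ ⟩ ⟩} {p ⟨ π ⟨ y ⟩ ⟩ C.⊖ p ⟨ f ⟨ c ⟨ y ⟩ ⟩ ⟩} {p ⟨ π ⟨ y ⟩ ⟩ C.⊖ C.0ᴹ} (⊖-homo p _ _)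
            (C.⊖-cong {κ ⟨ y ⟩} {κ ⟨ y ⟩} {p ⟨ f ⟨ c ⟨ y ⟩ ⟩ ⟩} {C.0ᴹ} (C.≈ᴹ-refl {κ ⟨ y ⟩}) (coker-∘ f (c ⟨ y ⟩))))
          (C.≈ᴹ-trans {p ⟨ π ⟨ y ⟩ ⟩ C.⊖ C.0ᴹ} {κ ⟨ y ⟩} {v} (C.⊖-identityʳ (κ ⟨ y ⟩)) (Hom.⟦⟧-cong p e))))
      f≈0 : ¬ IsZero (mod C) → IsZeroHom f
      f≈0 nz u = injective⇒ker≈0 p (surjective∧dim≤⇒injective {V} {C} p (coker-surjective f)
        (ℕₚ.≤-reflexive (sym (≅⇒dim≡ {C} {V} (indecomposable-◁ {C} {V} indV nz (s , p , ps≈id)))))) (f ⟨ u ⟩) (coker-∘ f u)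

    choose : Injective a ⊎ Injective b → Injective f ⊎ Surjective f
    choose (inj₁ inj) = inj₁ (λ {x} {y} → f-injective inj {x} {y})
    choose (inj₂ inj) = inj₂ (f-surjective inj)

  ExtVanishes-quotient : {N X C : Mod Λ} (p : X ⟶ C) → Surjective p → ExtVanishes N X → ExtVanishes N C
  ExtVanishes-quotient {N} {X} {C} p p-surj ext = Extends⇒ExtVanishes {N} {N} {Q} {C} ◁-refl π Q-projective π-surjective λ g →
      let g′ , e = K-projective X C p p-surj g ; h , e′ = ext Q π Q-projective π-surjective g′ in
      p ∘ʰ h , λ x → transᴹ (mod C) (Hom.⟦⟧-cong p (e′ x)) (e x)
    where open PresentationK N

  ExtVanishes-^ : {N V : Mod Λ} → ExtVanishes N V → ∀ m → ExtVanishes N (V ^ᴹ m)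
  ExtVanishes-^ ext zero Q π pQ surj g = 0ʰ , λ x → _
  ExtVanishes-^ {N} {V} ext (suc m) Q π pQ surj g =
    let h , e = ext Q π pQ surj (⊕-proj₁ (mod V) (mod (V ^ᴹ m)) ∘ʰ g)
        h′ , e′ = ExtVanishes-^ {N} {V} ext m Q π pQ surj (⊕-proj₂ (mod V) (mod (V ^ᴹ m)) ∘ʰ g) in
    ⟨ h , h′ ⟩ʰ , λ x → e x , e′ x

  ExtVanishes-into-◁ : {N V V′ : Mod Λ} → mod V′ ◁ mod V → ExtVanishes N V → ExtVanishes N V′
  ExtVanishes-into-◁ {V′ = V′} (i , r , ri) ext Q π pQ surj g = let h , e = ext Q π pQ surj (i ∘ʰ g) in
    r ∘ʰ h , λ x → transᴹ (mod V′) (Hom.⟦⟧-cong r (e x)) (ri _)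

  hom-exact : (N V : Mod Λ) → ExtVanishes N V → let open Presentation N in hom Q V ≡ hom K V ℕ.+ hom N V
  hom-exact N V ext = hom-unique Q V (Dim-exact (precompose (mod V) π) (precompose (mod V) (Kernel-incl π))
      (λ {f} {g} e y → let x , d = π-surjective y in V.≈ᴹ-trans (Hom.⟦⟧-cong f (N.≈ᴹ-sym d)) (V.≈ᴹ-trans (e x) (Hom.⟦⟧-cong g d)))
      (λ g → ext Q π Q-projective π-surjective g)
      (λ f (x , e) → V.≈ᴹ-trans (Hom.⟦⟧-cong f e) (Hom.0ᴹ-homo f))
      (λ h z → factor-at π π-surjective h λ x e → z (x , e))
      (proj₂ (Dim-HomSpace N V)) (proj₂ (Dim-HomSpace K V)))
    where
    open Presentation N
    module N = RightModule (mod N)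
    module V = RightModule (mod V)

  hom-⊕ : (A B V : Mod Λ) {Q : Mod Λ} → mod A ⊕ mod B ≅ mod Q → hom Q V ≡ hom B V ℕ.+ hom A V
  hom-⊕ A B V {Q} e = hom-unique Q V (Dim-≅ (≅-trans (HomSpace-⊕ (mod A) (mod B) (mod V)) pulled) (Dim-⊕ (proj₂ (Dim-HomSpace A V)) (proj₂ (Dim-HomSpace B V))))
    where
    module V = RightModule (mod V)
    pulled : HomSpace (mod A ⊕ mod B) (mod V) ≅ HomSpace (mod Q) (mod V)
    pulled = mk≅ (precompose (mod V) (inverse e)) (precompose (mod V) (proj₁ e))
      (λ f x → Hom.⟦⟧-cong f (inverseˡ e x)) (λ f y → Hom.⟦⟧-cong f (inverseʳ e y))

  hom-0 : (M V : Mod Λ) → Vanishes (mod M) (mod V) → hom M V ≡ 0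
  hom-0 M V van = hom-unique M V {0} van

  hom≡0⇒vanishes : (M V : Mod Λ) → hom M V ≡ 0 → Vanishes (mod M) (mod V)
  hom≡0⇒vanishes M V e = subst (Dim (HomSpace (mod M) (mod V))) e (proj₂ (Dim-HomSpace M V))

  -- Independence of the dimension vectors of the Tᵢ, on which hom(-, Tₗ) depends linearly. A proper surjection
  -- cannot be followed by a proper injection, so among the indices in a relation there is an l such that
  -- no other Tᵢ has a nonzero hom to Tₗ; the l-th equation then reads aₗ hom(Tₗ, Tₗ) = 0.
  module Independence {n} (T : Fin n → Mod Λ) (T-indecomposable : ∀ i → Indecomposable (T i))
    (T-distinct : ∀ i j → i ≢ j → ¬ mod (T i) ≅ mod (T j)) (T-rigid : ∀ i j → ExtVanishes (T i) (T j)) where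

    iso⇒≡ : ∀ {i j} → mod (T i) ≅ mod (T j) → i ≡ j
    iso⇒≡ {i} {j} e = [ (λ p → p) , (λ ne → ⊥-elim (T-distinct i j ne e)) ]′ (≡-or-≢ i j)

    HR : ∀ {i j} (f : T i ⟶ T j) → ¬ IsZeroHom f → Injective f ⊎ Surjective f
    HR {i} {j} = happel-ringel {T i} {T j} (T-indecomposable i) (T-indecomposable j) (T-rigid j i)

    neither : ∀ {i j} {f : T i ⟶ T j} → Injective f ⊎ Surjective f → ¬ Injective f → ¬ Surjective f → ⊥
    neither (inj₁ inj) not-inj _ = not-inj inj
    neither (inj₂ surj) _ not-surj = not-surj surj

    module _ (a : Fin n → ℤ) where
      A : Set
      A = ∃ λ i → a i ≢ 0ℤ

      Source : Fin n → Set ℓ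
      Source l = ∃ λ (i : A) → proj₁ i ≢ l × Σ (T l ⟶ T (proj₁ i)) λ f → ¬ IsZeroHom f × Injective f

      Extremal : Fin n → Set ℓ
      Extremal l = ∀ (i : A) → proj₁ i ≢ l → Vanishes (mod (T (proj₁ i))) (mod (T l))

      extremal : A → ¬ ¬ ∃ λ (l : A) → Extremal (proj₁ l)
      extremal i₀ = ¬¬-em (∃ λ (l : A) → Source (proj₁ l)) >>= λ { (inj₁ s) → sources s ; (inj₂ none) → no-sources none }
        where
        sources : (∃ λ (l : A) → Source (proj₁ l)) → ¬ ¬ ∃ λ (l : A) → Extremal (proj₁ l)
        sources s = minimal (λ (l , _) → dim (T (proj₁ l))) s >>= λ { ((l , (l′ , l′≢l , g , g≉0 , g-inj)) , least) →
          return (l , λ i i≢l f → zeroHom-stable {T (proj₁ i)} {T (proj₁ l)} f λ f≉0 → neither {proj₁ i} {proj₁ l} {f} (HR f f≉0)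
            (λ f-inj → ℕₚ.<⇒≱ (ℕₚ.≤∧≢⇒< (injective⇒dim≤ {T (proj₁ i)} {T (proj₁ l)} f f-inj)
                λ e → i≢l (iso⇒≡ (f , f-inj , injective∧dim≥⇒surjective {T (proj₁ i)} {T (proj₁ l)} f f-inj (ℕₚ.≤-reflexive (sym e)))))
              (least (i , (l , (λ e → i≢l (sym e)) , f , f≉0 , f-inj))))
            (λ f-surj → neither {proj₁ i} {proj₁ l′} {g ∘ʰ f} (HR (g ∘ʰ f) λ z → g≉0 λ y → let x , e = f-surj y in
                transᴹ (mod (T (proj₁ l′))) (Hom.⟦⟧-cong g (symᴹ (mod (T (proj₁ l))) e)) (z x))
              (λ gf-inj → i≢l (iso⇒≡ (f , (λ {x} {y} e → gf-inj (Hom.⟦⟧-cong g e)) , f-surj)))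
              (λ gf-surj → l′≢l (sym (iso⇒≡ (g , g-inj , λ y → let x , e = gf-surj y in f ⟨ x ⟩ , e)))))) }
        no-sources : ¬ (∃ λ (l : A) → Source (proj₁ l)) → ¬ ¬ ∃ λ (l : A) → Extremal (proj₁ l)
        no-sources none = let N , le = bounded n (λ i → dim (T i)) in
          maximal (λ (l : A) → dim (T (proj₁ l))) N (λ l → le (proj₁ l)) i₀ >>= λ (l , greatest) →
          return (l , λ i i≢l f → zeroHom-stable {T (proj₁ i)} {T (proj₁ l)} f λ f≉0 → neither {proj₁ i} {proj₁ l} {f} (HR f f≉0)
            (λ f-inj → none (i , (l , (λ e → i≢l (sym e)) , f , f≉0 , f-inj)))
            (λ f-surj → i≢l (iso⇒≡ (f , surjective∧dim≤⇒injective {T (proj₁ i)} {T (proj₁ l)} f f-surj (greatest i) , f-surj))))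

      independent : A → ¬ (∀ l → ∑ (λ i → a i ℤ.* ℤ.+ hom (T i) (T l)) ≡ 0ℤ)
      independent i₀ rel = extremal i₀ λ (l , ext) → contradict n T (λ i → hom (T i) (T (proj₁ l))) a (proj₁ l) (proj₂ l)
          (λ e → proj₁ (T-indecomposable (proj₁ l)) (hom≡0⇒vanishes (T (proj₁ l)) (T (proj₁ l)) e idʰ))
          (λ i nz ne → hom-0 (T i) (T (proj₁ l)) (ext (i , nz) ne)) (rel (proj₁ l))
        where
        contradict : ∀ n (T : Fin n → Mod Λ) (h : Fin n → ℕ) (a : Fin n → ℤ) l → a l ≢ 0ℤ → h l ≢ 0 → (∀ i → a i ≢ 0ℤ → i ≢ l → h i ≡ 0) →
          ∑ (λ i → a i ℤ.* ℤ.+ h i) ≢ 0ℤ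
        contradict (suc n) T h a l al≢0 hl≢0 rest e = [ al≢0 , (λ d → hl≢0 (ℤₚ.+-injective d)) ]′ (ℤₚ.i*j≡0⇒i≡0∨j≡0 (a l)
          (trans (sym (ℤₚ.+-identityʳ _)) (trans (cong (λ z → a l ℤ.* ℤ.+ h l ℤ.+ z) (sym (∑-0 λ i → term (punchIn l i) (Finₚ.punchInᵢ≢i l i))))
            (trans (sym (∑-remove l λ i → a i ℤ.* ℤ.+ h i)) e))))
          where
          term : ∀ i → i ≢ l → a i ℤ.* ℤ.+ h i ≡ 0ℤ
          term i ne with a i ℤₚ.≟ 0ℤ
          ... | yes e′ = cong (ℤ._* ℤ.+ h i) e′
          ... | no nz = trans (cong (λ m → a i ℤ.* ℤ.+ m) (rest i nz ne)) (ℤₚ.*-zeroʳ (a i))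

δ : ∀ {n} → Fin n → Fin n → ℤ
δ zero    zero    = 1ℤ
δ zero    (suc j) = 0ℤ
δ (suc i) zero    = 0ℤ
δ (suc i) (suc j) = δ i j

∑-δ : ∀ {n} (i : Fin n) (h : Fin n → ℤ) → ∑ (λ j → δ i j ℤ.* h j) ≡ h i
∑-δ zero h = trans (cong₂ ℤ._+_ (ℤₚ.*-identityˡ (h zero)) (∑-0 λ j → ℤₚ.*-zeroˡ (h (suc j)))) (ℤₚ.+-identityʳ _)
∑-δ (suc i) h = trans (cong₂ ℤ._+_ (ℤₚ.*-zeroˡ (h zero)) (∑-δ i λ j → h (suc j))) (ℤₚ.+-identityˡ _)

∑-difference : ∀ {n} (c d h : Fin n → ℤ) → ∑ (λ j → (c j ℤ.- d j) ℤ.* h j) ≡ ∑ (λ j → c j ℤ.* h j) ℤ.- ∑ (λ j → d j ℤ.* h j)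
∑-difference c d h = trans (∑-cong λ j → distribute (c j) (d j) (h j))
    (trans (∑-+ (λ j → c j ℤ.* h j) (λ j → ℤ.-1ℤ ℤ.* (d j ℤ.* h j))) (cong (λ z → ∑ (λ j → c j ℤ.* h j) ℤ.+ z)
      (trans (sym (∑-*ˡ ℤ.-1ℤ λ j → d j ℤ.* h j)) (ℤₚ.-1*i≡-i _))))
  where
  distribute : ∀ x y z → (x ℤ.- y) ℤ.* z ≡ x ℤ.* z ℤ.+ ℤ.-1ℤ ℤ.* (y ℤ.* z)
  distribute = solve-∀

module TiltingTorsion {ℓ} {k : Field ℓ} (Λ : FDAlgebra k) (hereditary : Hereditary Λ) (basicAlgebra : BasicAlgebra Λ)
  {n : ℕ} (count : ∣_∣≡_ {Λ = Λ} (FDAlgebra.regular Λ) n)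
  (top : Counting.Tops Λ count) where
  open Frame Λ hereditary basicAlgebra count top public
  open Rigid Λ hereditary using (hom-exact; hom-⊕; hom-0; hom≡0⇒vanishes; ExtVanishes-quotient; ExtVanishes-^; ExtVanishes-into-◁; module Independence)
  open Sums Λ using (trace)

  h : Mod Λ → Fin n → ℤ
  h V j = ℤ.+ hom (P j) V

  -- Q ≅ ⨁ Pⱼ^(cⱼ), recorded through the dimensions of Hom(Q, -).
  Multiplicities : Mod Λ → Set (lsuc ℓ)
  Multiplicities Q = Σ (Fin n → ℤ) λ c → ∀ V → ℤ.+ hom Q V ≡ ∑ (λ j → c j ℤ.* h V j)

  multiplicities : {Q : Mod Λ} → Projective Q → ¬ ¬ Multiplicities Q
  multiplicities {Q} = projective-induction Multiplicities zero-case step {Q}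
    where
    zero-case : ∀ Q → IsZero (mod Q) → Multiplicities Q
    zero-case Q z = (λ _ → 0ℤ) , λ V → trans (cong ℤ.+_ (hom-0 Q V (λ f x → transᴹ (mod V) (cong-h f (z x)) (Hom.0ᴹ-homo f))))
      (sym (∑-0 λ j → ℤₚ.*-zeroˡ (h V j)))
    step : ∀ j (Q Q′ : Mod Λ) → mod (P j) ⊕ mod Q′ ≅ mod Q → Multiplicities Q′ → Multiplicities Q
    step j Q Q′ e (c , eq) = (λ i → c i ℤ.+ δ j i) , λ V → trans (cong ℤ.+_ (hom-⊕ (P j) Q′ V {Q} e))
      (trans (ℤₚ.pos-+ (hom Q′ V) (hom (P j) V)) (trans (cong₂ ℤ._+_ (eq V) (sym (∑-δ j (h V))))
        (trans (sym (∑-+ (λ i → c i ℤ.* h V i) (λ i → δ j i ℤ.* h V i))) (∑-cong λ i → sym (ℤₚ.*-distribʳ-+ (h V i) (c i) (δ j i))))))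

  IndexVector : Mod Λ → Set (lsuc ℓ)
  IndexVector N = Σ (Fin n → ℤ) λ g → ∀ V → ExtVanishes N V → ℤ.+ hom N V ≡ ∑ (λ j → g j ℤ.* h V j)

  indexVector : (N : Mod Λ) → ¬ ¬ IndexVector N
  indexVector N not = multiplicities {Q} Q-projective λ (c , eq) →
      multiplicities {K} (hereditary Q K (Kernel-incl π₀) Q-projective (λ e → e)) λ (d , eq′) →
      not ((λ j → c j ℤ.- d j) , λ V ext → trans (subtract (hom Q V) (hom K V) (hom N V) (hom-exact N V ext))
        (trans (cong₂ ℤ._-_ (eq V) (eq′ V)) (sym (∑-difference c d (h V)))))
    where
    open Presentation N using (Q; K; Q-projective) renaming (π to π₀)
    subtract : ∀ x y z → x ≡ y ℕ.+ z → ℤ.+ z ≡ ℤ.+ x ℤ.- ℤ.+ y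
    subtract x y z refl = trans (cancel (ℤ.+ y) (ℤ.+ z)) (cong (ℤ._- ℤ.+ y) (sym (ℤₚ.pos-+ y z)))
      where
      cancel : ∀ u v → v ≡ (u ℤ.+ v) ℤ.- u
      cancel = solve-∀

  module _ {T : Mod Λ} (rigid : ExtVanishes T T) (cT : Count (mod T) n) where

    Tᵢ : Fin n → Mod Λ
    Tᵢ = summand cT

    Tᵢ◁T : ∀ i → mod (Tᵢ i) ◁ mod T
    Tᵢ◁T i = summand⇒◁ {Tᵢ i} (isSummand cT i)

    Tᵢ-rigid : ∀ i j → ExtVanishes (Tᵢ i) (Tᵢ j)
    Tᵢ-rigid i j = ExtVanishes-◁ {T} {Tᵢ i} {Tᵢ j} (Tᵢ◁T i) (ExtVanishes-into-◁ {T} {T} {Tᵢ j} (Tᵢ◁T j) rigid)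

    -- The index vectors of the Tᵢ form a nonsingular matrix, and it kills the vector of the hom(Pⱼ, C).
    perpendicular-zero : (C : Mod Λ) → Vanishes (mod T) (mod C) → ExtVanishes T C → ¬ ¬ IsZero (mod C)
    perpendicular-zero C van ext not-zero = topQuotient C not-zero λ (j , q , q-surj) →
        finite-choice n (λ i → indexVector (Tᵢ i)) λ g →
        let a , nz , rel = left-kernel n (λ i → proj₁ (g i)) (h C) (j , h≢0 j q q-surj) (kills g) in
        Independence.independent Tᵢ (indecomposable cT) (distinct cT) Tᵢ-rigid a nz λ l →
          trans (∑-cong λ i → cong (a i ℤ.*_) (proj₂ (g i) (Tᵢ l) (Tᵢ-rigid i l))) (annihilate (λ i → proj₁ (g i)) a rel (h (Tᵢ l)))
      where
      h≢0 : ∀ j (q : C ⟶ S j) → Surjective q → h C j ≢ 0ℤ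
      h≢0 j q q-surj e = let f , qf≈π = P-projective j C (S j) q q-surj (π j) in
        π≉0 j λ x → transᴹ (mod (S j)) (symᴹ (mod (S j)) (qf≈π x))
          (transᴹ (mod (S j)) (Hom.⟦⟧-cong q (hom≡0⇒vanishes (P j) C (ℤₚ.+-injective e) f x)) (Hom.0ᴹ-homo q))
      kills : ∀ (g : ∀ i → IndexVector (Tᵢ i)) i → ∑ (λ j → proj₁ (g i) j ℤ.* h C j) ≡ 0ℤ
      kills g i = trans (sym (proj₂ (g i) C (ExtVanishes-◁ {T} {Tᵢ i} {C} (Tᵢ◁T i) ext)))
        (cong ℤ.+_ (hom-0 (Tᵢ i) C (λ f x → transᴹ (mod C)
          (symᴹ (mod C) (Hom.⟦⟧-cong f (proj₂ (proj₂ (Tᵢ◁T i)) x))) (van (f ∘ʰ proj₁ (proj₂ (Tᵢ◁T i))) _))))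
      annihilate : (G : Fin n → Fin n → ℤ) (a : Fin n → ℤ) → (∀ j → ∑ (λ i → a i ℤ.* G i j) ≡ 0ℤ) → (y : Fin n → ℤ) → ∑ (λ i → a i ℤ.* ∑ (λ j → G i j ℤ.* y j)) ≡ 0ℤ
      annihilate G a rel y = trans (∑-cong λ i → trans (∑-*ˡ (a i) λ j → G i j ℤ.* y j) (∑-cong λ j → sym (ℤₚ.*-assoc (a i) (G i j) (y j))))
        (trans (ℤSum.∑-comm λ i j → (a i ℤ.* G i j) ℤ.* y j)
          (∑-0 λ j → trans (sym (∑-*ʳ (y j) λ i → a i ℤ.* G i j)) (trans (cong (ℤ._* y j) (rel j)) (ℤₚ.*-zeroˡ (y j)))))

    generated : {X : Mod Λ} → ExtVanishes T X → ¬ ¬ ∃ λ m → Σ (T ^ᴹ m ⟶ X) Surjective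
    generated {X} ext not = trace T X λ (m , t , in-trace) → perpendicular-zero (cokMod {T ^ᴹ m} {X} t)
        (vanishes m t in-trace) (ExtVanishes-quotient {T} {X} {cokMod {T ^ᴹ m} {X} t} (coker t) (coker-surjective t) ext) λ z →
      not (m , t , λ x → coker-exact t x (z x))
      where
      module X = ModuleOps (mod X)
      open Presentation T renaming (π to π₀; π-surjective to π₀-surjective)
      K-projective : Projective K
      K-projective = hereditary Q K (Kernel-incl π₀) Q-projective (λ e → e)
      -- A hom T → coker t lifts to T → X, because Ext¹ vanishes on the image of t.
      vanishes : ∀ m (t : T ^ᴹ m ⟶ X) → (∀ (f : T ⟶ X) x → coker t ⟨ f ⟨ x ⟩ ⟩≈0) → Vanishes (mod T) (Coker t)
      vanishes m t in-trace f y = let x , e = π₀-surjective y in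
          C.≈ᴹ-trans {f ⟨ y ⟩} {f ⟨ π₀ ⟨ x ⟩ ⟩} {C.0ᴹ} (Hom.⟦⟧-cong f (symᴹ (mod T) e))
          (C.≈ᴹ-trans {f ⟨ π₀ ⟨ x ⟩ ⟩} {p ⟨ q ⟨ x ⟩ ⟩} {C.0ᴹ} (C.≈ᴹ-sym {p ⟨ q ⟨ x ⟩ ⟩} {f ⟨ π₀ ⟨ x ⟩ ⟩} (pq≈fπ x))
          (C.≈ᴹ-trans {p ⟨ q ⟨ x ⟩ ⟩} {p ⟨ f′ ⟨ π₀ ⟨ x ⟩ ⟩ X.+ᴹ t ⟨ κ′ ⟨ x ⟩ ⟩ ⟩} {C.0ᴹ}
            (Hom.⟦⟧-cong p (X.≈ᴹ-sym (X.≈ᴹ-trans (X.+ᴹ-congʳ (proj₂ factored x)) (X.⊖-+ _ _))))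
            (C.≈ᴹ-trans {p ⟨ f′ ⟨ π₀ ⟨ x ⟩ ⟩ X.+ᴹ t ⟨ κ′ ⟨ x ⟩ ⟩ ⟩} {C.0ᴹ C.+ᴹ C.0ᴹ} {C.0ᴹ}
              (C.+ᴹ-cong {p ⟨ f′ ⟨ π₀ ⟨ x ⟩ ⟩ ⟩} {C.0ᴹ} {p ⟨ t ⟨ κ′ ⟨ x ⟩ ⟩ ⟩} {C.0ᴹ} (in-trace f′ (π₀ ⟨ x ⟩)) (coker-∘ t (κ′ ⟨ x ⟩)))
              (C.+ᴹ-identityˡ C.0ᴹ))))
        where
        Cᴹ : Mod Λ
        Cᴹ = cokMod {T ^ᴹ m} {X} t
        module C = ModuleOps (mod Cᴹ)
        p : X ⟶ Cᴹ
        p = coker t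
        I : Mod Λ
        I = kerMod {X} {Cᴹ} p
        lifted : Σ (Q ⟶ X) λ q → p ∘ʰ q ≈ʰ f ∘ʰ π₀
        lifted = Q-projective X Cᴹ p (coker-surjective t) (f ∘ʰ π₀)
        q : Q ⟶ X
        q = proj₁ lifted
        pq≈fπ : p ∘ʰ q ≈ʰ f ∘ʰ π₀
        pq≈fπ = proj₂ lifted
        t′ : T ^ᴹ m ⟶ I
        t′ = mkHom (λ z → t ⟨ z ⟩ , coker-∘ t z) (cong-h t) (Hom.+ᴹ-homo t) (Hom.*ᵣ-homo t)
        q′ : K ⟶ I
        q′ = mkHom (λ (x , e) → q ⟨ x ⟩ , C.≈ᴹ-trans {p ⟨ q ⟨ x ⟩ ⟩} {f ⟨ π₀ ⟨ x ⟩ ⟩} {C.0ᴹ} (pq≈fπ x)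
            (C.≈ᴹ-trans {f ⟨ π₀ ⟨ x ⟩ ⟩} {f ⟨ zeroᴹ (mod T) ⟩} {C.0ᴹ} (Hom.⟦⟧-cong f e) (Hom.0ᴹ-homo f)))
          (cong-h q) (λ _ _ → Hom.+ᴹ-homo q _ _) (λ _ _ → Hom.*ᵣ-homo q _ _)
        κ : Σ (K ⟶ T ^ᴹ m) λ κ → t′ ∘ʰ κ ≈ʰ q′
        κ = K-projective (T ^ᴹ m) I t′ (λ (x , e) → coker-exact t x e) q′
        extended : Σ (Q ⟶ T ^ᴹ m) λ κ′ → ∀ x → mod (T ^ᴹ m) ∋ κ′ ⟨ proj₁ x ⟩ ≈ proj₁ κ ⟨ x ⟩
        extended = ExtVanishes-^ {T} {T} rigid m Q π₀ Q-projective π₀-surjective (proj₁ κ)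
        κ′ : Q ⟶ T ^ᴹ m
        κ′ = proj₁ extended
        factored : Σ (T ⟶ X) λ f′ → f′ ∘ʰ π₀ ≈ʰ (q -ʰ t ∘ʰ κ′)
        factored = factor-at π₀ π₀-surjective (q -ʰ t ∘ʰ κ′) λ x e →
          X.≈⇒⊖≈0 (X.≈ᴹ-sym (X.≈ᴹ-trans (Hom.⟦⟧-cong t (proj₂ extended (x , e))) (proj₂ κ (x , e))))
        f′ : T ⟶ X
        f′ = proj₁ factored

    ExtVanishes-monotone : {T′ X : Mod Λ} → ExtVanishes T′ T → ExtVanishes T X → ExtVanishes T′ X
    ExtVanishes-monotone {T′} {X} extT extX = ExtVanishes-stable {T′} {X} λ not → generated {X} extX λ (m , t , surj) →
      not (ExtVanishes-quotient {T′} {T ^ᴹ m} {X} t surj (ExtVanishes-^ {T′} {T} extT m))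

-- The graph of ρ. It is total only up to ≈ˢ on the right, and ≤ˢ is not known to respect ≈ˢ.
record Correspondence {ℓ} {k : Field ℓ} (Λ Γ : FDAlgebra k) : Set (lsuc (lsuc ℓ)) where
  field
    R      : s-τ-tilt Λ → s-τ-tilt Γ → Set (lsuc ℓ)
    left   : ∀ (x : s-τ-tilt Λ) → ∃₂ λ x′ y → (x′ ≈ˢ x) × R x′ y
    right  : ∀ (y : s-τ-tilt Γ) → ∃₂ λ y′ x → (y′ ≈ˢ y) × R x y′
    mono   : ∀ {x x′ : s-τ-tilt Λ} {y y′ : s-τ-tilt Γ} → R x y → R x′ y′ → x ≤ˢ x′ → y ≤ˢ y′
    cancel : ∀ {x x′ : s-τ-tilt Λ} {y y′ : s-τ-tilt Γ} → R x y → R x′ y′ → y ≤ˢ y′ → x ≤ˢ x′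
    congˢ  : ∀ {x x′ : s-τ-tilt Λ} {y y′ : s-τ-tilt Γ} → R x y → R x′ y′ → x ≈ˢ x′ → y ≈ˢ y′
    inj    : ∀ {x x′ : s-τ-tilt Λ} {y y′ : s-τ-tilt Γ} → R x y → R x′ y′ → y ≈ˢ y′ → x ≈ˢ x′

converse : ∀ {ℓ} {k : Field ℓ} {Λ Γ : FDAlgebra k} → Correspondence Λ Γ → Correspondence Γ Λ
converse c = record
  { R = λ y x → R x y ; left = right ; right = left
  ; mono = cancel ; cancel = mono ; congˢ = inj ; inj = congˢ
  }
  where open Correspondence c

module Transfer {ℓ} {k : Field ℓ} (Λ Γ : FDAlgebra k)
  (hereditaryΛ : Hereditary Λ) (basicΛ : BasicAlgebra Λ) (hereditaryΓ : Hereditary Γ) (basicΓ : BasicAlgebra Γ)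
  {n m : ℕ} (countΛ : ∣_∣≡_ {Λ = Λ} (FDAlgebra.regular Λ) (suc n)) (countΓ : ∣_∣≡_ {Λ = Γ} (FDAlgebra.regular Γ) (suc m))
  (topΛ : Counting.Tops Λ countΛ)
  (topΓ : Counting.Tops Γ countΓ)
  (correspondence : Correspondence Λ Γ) where
  open Correspondence correspondence
  open Mod
  private
    module A = SpecialElements Λ hereditaryΛ basicΛ countΛ topΛ
    module B = SpecialElements Γ hereditaryΓ basicΓ countΓ topΓ

  record Match (j : Fin (suc n)) : Set (lsuc ℓ) where
    field
      s  : s-τ-tilt Λ
      t  : s-τ-tilt Γ
      r  : R s t
      σ  : Fin (suc m)
      s≅ : mod (Mˢ s) ≅ mod (A.S j)
      t≅ : mod (Mˢ t) ≅ mod (B.S σ)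

  match : ∀ j → ¬ ¬ Match j
  match j not = from (left (A.SimpleElement.simpleElement j))
    where
    from : (∃₂ λ s t → (s ≈ˢ A.SimpleElement.simpleElement j) × R s t) → ⊥
    from (s , t , s≅ , r) = B.topQuotient (Mˢ t) t-nonzero λ (j′ , q , q-surj) → top j′ q q-surj (right (B.SimpleElement.simpleElement j′))
      where
      t-nonzero : ¬ IsZero (mod (Mˢ t))
      t-nonzero z = against (left A.zeroElement)
        where
        against : (∃₂ λ w w′ → (w ≈ˢ A.zeroElement) × R w w′) → ⊥
        against (w , w′ , w≈0 , r′) = B.zero-least t w′ z λ t≤w′ →
          A.SimpleLike.not-below-zero s j s≅ w (≅-zero (≅-sym w≈0) (λ _ → _)) (cancel r r′ t≤w′)
      top : ∀ j′ (q : Hom (mod (Mˢ t)) (mod (B.S j′))) → Surjective q →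
        (∃₂ λ z′ z → (z′ ≈ˢ B.SimpleElement.simpleElement j′) × R z z′) → ⊥
      top j′ q q-surj (z′ , z , z′≅ , r′) = B.SimpleLike.below z′ j′ z′≅ t q q-surj λ z′≤t →
          A.SimpleLike.above-only s j s≅ z (cancel r′ r z′≤t) λ
          { (inj₁ zero-z) → against zero-z (right B.zeroElement)
          ; (inj₂ z≅) → not (record { s = s ; t = t ; r = r ; σ = j′ ; s≅ = s≅
              ; t≅ = ≅-trans (≅-sym (congˢ r′ r (≅-trans z≅ (≅-sym s≅)))) z′≅ }) }
        where
        against : IsZero (mod (Mˢ z)) → (∃₂ λ w′ w → (w′ ≈ˢ B.zeroElement) × R w w′) → ⊥
        against zero-z (w′ , w , w′≈0 , r″) = A.zero-least z w zero-z λ z≤w →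
          B.SimpleLike.not-below-zero z′ j′ z′≅ w′ (≅-zero (≅-sym w′≈0) (λ _ → _)) (mono r′ r″ z≤w)

  module _ (matches : ∀ j → Match j) where
    module Matched j = Match (matches j)

    σ-injective : ∀ {i j} → Matched.σ i ≡ Matched.σ j → i ≡ j
    σ-injective {i} {j} e = A.S≅⇒≡ (≅-trans (≅-sym (Matched.s≅ i)) (≅-trans
      (inj (Matched.r i) (Matched.r j) (≅-trans (subst (λ l → mod (Mˢ (Matched.t i)) ≅ mod (B.S l)) e (Matched.t≅ i)) (≅-sym (Matched.t≅ j))))
      (Matched.s≅ j)))

    module _ {x : s-τ-tilt Λ} {x′ : s-τ-tilt Γ} (r : R x x′) (i : Fin (suc n)) (Pi◁ : mod (A.P i) ◁ mod (Pˢ x)) where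

      module _ (traces : ∀ j → ∃ λ c → Σ (B._⟶_ (B._^ᴹ_ (B.P (Matched.σ i)) c) (B.P j)) λ t →
                 ∀ (h : B._⟶_ (B.P (Matched.σ i)) (B.P j)) y → coker t ⟨ h ⟨ y ⟩ ⟩≈0) where
        open B.QuotientElement (Matched.σ i) traces using (Y; Y-count; quotientElement; onto-S)

        module _ (y′ : s-τ-tilt Γ) (y : s-τ-tilt Λ) (y′≅ : mod (Mˢ y′) ≅ mod Y) (r′ : R y y′) where

          below-y : ∀ j → j ≢ i → ¬ ¬ (Matched.s j ≤ˢ y)
          below-y j j≢i not = B.SimpleLike.below (Matched.t j) (Matched.σ j) (Matched.t≅ j) y′ (proj₁ onto ∘ʰ proj₁ y′≅) onto′
              λ le → not (cancel (Matched.r j) r′ le)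
            where
            onto : Σ (Hom (mod Y) (mod (B.S (Matched.σ j)))) Surjective
            onto = onto-S λ e → j≢i (σ-injective e)
            onto′ : Surjective (proj₁ onto ∘ʰ proj₁ y′≅)
            onto′ v = let u , d = proj₂ onto v in inverse y′≅ ⟨ u ⟩ ,
              transᴹ (mod (B.S (Matched.σ j))) (Hom.⟦⟧-cong (proj₁ onto) (inverseʳ y′≅ u)) d

          others : ∀ j → ¬ ¬ (j ≢ i → Σ (s-τ-tilt Λ) λ s → (s ≤ˢ y) × (mod (Mˢ s) ≅ mod (A.S j)))
          others j not = [ (λ e → not λ ne → ⊥-elim (ne e)) , (λ ne → below-y j ne λ le → not λ _ → Matched.s j , le , Matched.s≅ j) ]′ (≡-or-≢ j i)

          y-P-nonzero : ¬ IsZero (mod (Pˢ y′))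
          y-P-nonzero z = let m₁ , p₁ , cM , cP , e = B.counts y′ in
            ℕₚ.m≢1+m+n m (trans (trans (B.Count-unique (B.Count-≅ (≅-sym y′≅) Y-count) cM)
              (trans (sym (ℕₚ.+-identityʳ m₁)) (trans (cong (m₁ ℕ.+_) (sym (B.Count-zero z cP))) e))) (cong suc (sym (ℕₚ.+-identityʳ m))))

          quotient-P-nonzero : ¬ IsZero (mod (Pˢ x′))
          quotient-P-nonzero z = finite-choice (suc n) others λ others → A.above-all-other-simples x y i Pi◁ others λ le →
            y-P-nonzero λ u → B.vanishes-∈add {Pˢ x′} {Pˢ y′} (B.≤ˢ⇒∈add {x′} {y′} (mono r r′ le)) (B.zero-source z) idʰ u

        P-nonzero : ¬ IsZero (mod (Pˢ x′))
        P-nonzero z = let y′ , y , y′≅ , r′ = right quotientElement in quotient-P-nonzero y′ y y′≅ r′ z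

  P-nonzero-transfer : {x : s-τ-tilt Λ} {x′ : s-τ-tilt Γ} → R x x′ → ¬ IsZero (mod (Pˢ x)) → ¬ IsZero (mod (Pˢ x′))
  P-nonzero-transfer {x} {x′} r nz z = finite-choice (suc n) match λ matches →
    A.topQuotient (Pˢ x) nz λ (i , q , q-surj) →
    finite-choice (suc m) (λ j → B.trace (B.P (Match.σ (matches i))) (B.P j)) λ traces →
    P-nonzero matches {x} {x′} r i
      (A.P◁projective {i} {Pˢ x} (A.Pˢ-projective x) q (A.surjective⇒nonzero {Pˢ x} {A.S i} (proj₁ (A.S-simple i)) q q-surj))
      traces z

module Rank {ℓ} {k : Field ℓ} (Λ : FDAlgebra k) (hereditary : Hereditary Λ) where
  open Counting Λ
  private
    module Λ = FDAlgebra Λ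

  rank-P : s-τ-tilt Λ → ℕ
  rank-P x = proj₁ (proj₂ (IsSupportτTiltingPair.count (s-τ-tilt.isPair x)))

  module _ (x : s-τ-tilt Λ) where
    rank-M : ℕ
    rank-M = proj₁ (IsSupportτTiltingPair.count (s-τ-tilt.isPair x))

    count-M : Count (mod (Mˢ x)) rank-M
    count-M = proj₁ (proj₂ (proj₂ (IsSupportτTiltingPair.count (s-τ-tilt.isPair x))))

    count-P : Count (mod (Pˢ x)) (rank-P x)
    count-P = proj₁ (proj₂ (proj₂ (proj₂ (IsSupportτTiltingPair.count (s-τ-tilt.isPair x)))))

    count-Λ : Count Λ.regular (rank-M ℕ.+ rank-P x)
    count-Λ = proj₂ (proj₂ (proj₂ (proj₂ (IsSupportτTiltingPair.count (s-τ-tilt.isPair x)))))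

    P-zero : rank-P x ≡ 0 → IsZero (mod (Pˢ x))
    P-zero e = Count-0⇒IsZero {Pˢ x} (subst (Count (mod (Pˢ x))) e count-P)

    rank-P≡0⇒tilting : rank-P x ≡ 0 → IsTilting (Mˢ x)
    rank-P≡0⇒tilting e = record
      { pd≤1 = K , Q , hereditary Q K (Kernel-incl π) Q-projective (λ d → d) , Q-projective , record
        { i = Kernel-incl π
        ; p = π
        ; i-inj = λ d → d
        ; p-surj = π-surjective
        ; p∘i≈0 = proj₂
        ; ker⊆im = λ y d → (y , d) , reflᴹ (mod Q)
        }
      ; rigid = ExtVanishes⇒Ext¹-vanishes {Mˢ x} {Mˢ x}
          (Hom-τ-vanishes⇒ExtVanishes hereditary {Mˢ x} {Mˢ x} (IsSupportτTiltingPair.τ-rigid (s-τ-tilt.isPair x)))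
      ; count = rank-M , count-M , subst (Count Λ.regular) (trans (cong (rank-M ℕ.+_) e) (ℕₚ.+-identityʳ rank-M)) count-Λ
      }
      where open Presentation (Mˢ x)

    tilting⇒rank-P≡0 : {T : Mod Λ} → IsTilting T → mod (Mˢ x) ≅ mod T → rank-P x ≡ 0
    tilting⇒rank-P≡0 {T} tilting e = let n , cT , cΛ = IsTilting.count tilting in
      ℕₚ.+-cancelˡ-≡ rank-M (rank-P x) 0 (trans (Count-unique count-Λ cΛ)
        (trans (sym (Count-unique (Count-≅ e count-M) cT)) (sym (ℕₚ.+-identityʳ rank-M))))

  tilting⇒τ-rigid : {T U : Mod Λ} → Ext¹-vanishes U T → Hom-τ-vanishes T U
  tilting⇒τ-rigid {T} {U} ext = ExtVanishes⇒Hom-τ-vanishes hereditary {U} {T} (Ext¹-vanishes⇒ExtVanishes {U} {T} ext)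

  pair : tilt Λ → s-τ-tilt Λ
  pair T = record
    { M = tilt.T T
    ; basic = tilt.basic T
    ; P = zeroMod
    ; P-basic = zero⇒basic (λ _ → _)
    ; isPair = record
      { projective = zero-projective {zeroMod} (λ _ → _)
      ; τ-rigid = tilting⇒τ-rigid {tilt.T T} {tilt.T T} (IsTilting.rigid (tilt.isTilting T))
      ; Hom[P,M]≈0 = λ f x → Hom.0ᴹ-homo f
      ; count = let n , cT , cΛ = IsTilting.count (tilt.isTilting T) in
          n , 0 , cT , zero-Count (λ _ → _) , subst (Count Λ.regular) (sym (ℕₚ.+-identityʳ n)) cΛ
      }
    }

  module-part : (x : s-τ-tilt Λ) → rank-P x ≡ 0 → tilt Λ
  module-part x e = record { T = Mˢ x ; basic = s-τ-tilt.basic x ; isTilting = rank-P≡0⇒tilting x e }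

  tops : ∀ {n} (c : Count Λ.regular n) → ¬ ¬ Tops c
  tops {n} c = finite-choice n λ j → simpleQuotient (summand c j) (proj₁ (indecomposable c j))

  ≤ᵗ⇒τ-vanishes : (T U : tilt Λ) → T ≤ᵗ U → Hom-τ-vanishes (tilt.T T) (tilt.T U)
  ≤ᵗ⇒τ-vanishes T U le = tilting⇒τ-rigid {tilt.T T} {tilt.T U} (le (tilt.T T) (IsTilting.rigid (tilt.isTilting T)))

  -- The equations, here and below, keep tilt.T T and Mˢ x out of the condition on τ, which is costly to convert.
  τ-vanishes⇒≤ᵗ : BasicAlgebra Λ → (T U : tilt Λ) {M N : Mod Λ} → M ≡ tilt.T T → N ≡ tilt.T U → Hom-τ-vanishes M N → T ≤ᵗ U
  τ-vanishes⇒≤ᵗ basic T U {M} {N} refl refl van X ext = ExtVanishes⇒Ext¹-vanishes {N} {X} (ExtVanishes-stable {N} {X} λ not →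
      tops (proj₂ (proj₂ (IsTilting.count tilting))) λ top →
      not (TiltingTorsion.ExtVanishes-monotone Λ hereditary basic (proj₂ (proj₂ (IsTilting.count tilting))) top {M}
        (Ext¹-vanishes⇒ExtVanishes {M} {M} (IsTilting.rigid tilting)) (proj₁ (proj₂ (IsTilting.count tilting))) {N} {X}
        (Hom-τ-vanishes⇒ExtVanishes hereditary {N} {M} van) (Ext¹-vanishes⇒ExtVanishes {M} {X} ext)))
    where
    tilting : IsTilting (tilt.T T)
    tilting = tilt.isTilting T

  τ-vanishes⇒≤ˢ : (x y : s-τ-tilt Λ) {M N : Mod Λ} → M ≡ Mˢ x → N ≡ Mˢ y → rank-P y ≡ 0 → Hom-τ-vanishes M N → x ≤ˢ y
  τ-vanishes⇒≤ˢ x y refl refl e van = van , λ N N∈ → ∈add-trans {N} {Pˢ y} {Pˢ x} N∈ (zero-∈add {Pˢ y} {Pˢ x} (P-zero y e))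

  count-positive : ¬ IsZeroAlgebra Λ → ∀ {n} → Count Λ.regular n → ∃ λ m → n ≡ suc m
  count-positive nz {zero} c = ⊥-elim (nz (Count-0⇒IsZero {Λᴹ} c Λ.1#))
  count-positive nz {suc m} c = m , refl

module _ {ℓ} {k : Field ℓ} (Λ Γ : FDAlgebra k) (hereditaryΛ : Hereditary Λ) (basicΛ : BasicAlgebra Λ) (nonzeroΛ : ¬ IsZeroAlgebra Λ)
  (hereditaryΓ : Hereditary Γ) (basicΓ : BasicAlgebra Γ) (nonzeroΓ : ¬ IsZeroAlgebra Γ) where
  private
    module A = Rank Λ hereditaryΛ
    module B = Rank Γ hereditaryΓ
    module CΛ = Counting Λ
    module CΓ = Counting Γ

  rank-P-transfer : (c : Correspondence Λ Γ) {x : s-τ-tilt Λ} {y : s-τ-tilt Γ} → Correspondence.R c x y → B.rank-P y ≡ 0 → A.rank-P x ≡ 0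
  rank-P-transfer c {x} {y} r e = CΛ.Count-zero (transfer (A.count-positive nonzeroΛ (A.count-Λ x)) (B.count-positive nonzeroΓ (B.count-Λ y))) (A.count-P x)
    where
    transfer : (∃ λ n → A.rank-M x ℕ.+ A.rank-P x ≡ suc n) → (∃ λ m → B.rank-M y ℕ.+ B.rank-P y ≡ suc m) → IsZero (Mod.mod (Pˢ x))
    transfer (n , en) (m , em) = [ (λ z → z) , (λ nz → ⊥-elim (
        A.tops countΛ λ topΛ → B.tops countΓ λ topΓ →
        Transfer.P-nonzero-transfer Λ Γ hereditaryΛ basicΛ hereditaryΓ basicΓ countΛ countΓ topΛ topΓ c {x} {y} r nz (B.P-zero y e))) ]′ (CΛ.isZero? (Pˢ x))
      where
      countΛ : CΛ.Count (FDAlgebra.regular Λ) (suc n)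
      countΛ = subst (CΛ.Count (FDAlgebra.regular Λ)) en (A.count-Λ x)
      countΓ : CΓ.Count (FDAlgebra.regular Γ) (suc m)
      countΓ = subst (CΓ.Count (FDAlgebra.regular Γ)) em (B.count-Λ y)

graph : ∀ {ℓ} {k : Field ℓ} {Λ Γ : FDAlgebra k} (ρ : s-τ-tilt Λ → s-τ-tilt Γ) →
  IsOrderIsomorphism _≈ˢ_ _≈ˢ_ _≤ˢ_ _≤ˢ_ ρ → Correspondence Λ Γ
graph {Λ = Λ} {Γ} ρ iso = record
  { R = λ x y → y ≡ ρ x
  ; left = λ x → x , ρ x , ≅-refl , refl
  ; right = λ y → ρ (proj₁ (surjective y)) , proj₁ (surjective y) , proj₂ (surjective y) {proj₁ (surjective y)} ≅-refl , refl
  ; mono = λ {x} {x′} → mono′ {x} {x′}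
  ; cancel = λ {x} {x′} → cancel′ {x} {x′}
  ; congˢ = λ {x} {x′} → cong′ {x} {x′}
  ; inj = λ {x} {x′} → injective′ {x} {x′}
  }
  where
  open IsOrderIsomorphism iso using (surjective)
  module ρ = IsOrderIsomorphism iso
  mono′ : {x x′ : s-τ-tilt Λ} {y y′ : s-τ-tilt Γ} → y ≡ ρ x → y′ ≡ ρ x′ → x ≤ˢ x′ → y ≤ˢ y′
  mono′ {x} {x′} refl refl = ρ.mono {x} {x′}
  cancel′ : {x x′ : s-τ-tilt Λ} {y y′ : s-τ-tilt Γ} → y ≡ ρ x → y′ ≡ ρ x′ → y ≤ˢ y′ → x ≤ˢ x′
  cancel′ {x} {x′} refl refl = ρ.cancel {x} {x′}
  cong′ : {x x′ : s-τ-tilt Λ} {y y′ : s-τ-tilt Γ} → y ≡ ρ x → y′ ≡ ρ x′ → x ≈ˢ x′ → y ≈ˢ y′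
  cong′ {x} {x′} refl refl = ρ.cong {x} {x′}
  injective′ : {x x′ : s-τ-tilt Λ} {y y′ : s-τ-tilt Γ} → y ≡ ρ x → y′ ≡ ρ x′ → y ≈ˢ y′ → x ≈ˢ x′
  injective′ {x} {x′} refl refl = ρ.injective {x} {x′}

theorem1p2 : ∀ {ℓ} (k : Field ℓ) → AlgebraicallyClosed k →
    (Λ Γ : FDAlgebra k) →
    BasicAlgebra Λ → IndecomposableAlgebra Λ → Hereditary Λ →
    BasicAlgebra Γ → IndecomposableAlgebra Γ → Hereditary Γ →
    (ρ : s-τ-tilt Λ → s-τ-tilt Γ) →
    IsOrderIsomorphism _≈ˢ_ _≈ˢ_ _≤ˢ_ _≤ˢ_ ρ →
    (∀ (N : s-τ-tilt Γ) →
    IsTiltingElement N ⇔ ∃ λ (M : s-τ-tilt Λ) → IsTiltingElement M × (ρ M ≈ˢ N)) ×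
    (∃ λ (ρ′ : tilt Λ → tilt Γ) →
    IsRestriction ρ ρ′ × IsOrderIsomorphism _≈ᵗ_ _≈ᵗ_ _≤ᵗ_ _≤ᵗ_ ρ′)
theorem1p2 {ℓ} k _ Λ Γ basicΛ (nonzeroΛ , _) hereditaryΛ basicΓ (nonzeroΓ , _) hereditaryΓ ρ iso =
    (λ N → mk⇔ (pull N) (push N)) , ρ′ , (λ T → A.pair T , ≅-refl , ≅-refl) , record
    { isOrderMonomorphism = record
      { isOrderHomomorphism = record
        { cong = λ {T} {U} → ρ.cong {A.pair T} {A.pair U}
        ; mono = λ {T} {U} → ρ′-mono T U
        }
      ; injective = λ {T} {U} → ρ.injective {A.pair T} {A.pair U}
      ; cancel = λ {T} {U} → ρ′-cancel T U
      }
    ; surjective = ρ′-surjective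
    }
  where
  module A = Rank Λ hereditaryΛ
  module B = Rank Γ hereditaryΓ
  module ρ = IsOrderIsomorphism iso

  reflect : (x : s-τ-tilt Λ) → B.rank-P (ρ x) ≡ 0 → A.rank-P x ≡ 0
  reflect x = rank-P-transfer Λ Γ hereditaryΛ basicΛ nonzeroΛ hereditaryΓ basicΓ nonzeroΓ (graph ρ iso) {x} {ρ x} refl

  preserve : (x : s-τ-tilt Λ) → A.rank-P x ≡ 0 → B.rank-P (ρ x) ≡ 0
  preserve x = rank-P-transfer Γ Λ hereditaryΓ basicΓ nonzeroΓ hereditaryΛ basicΛ nonzeroΛ (converse (graph ρ iso)) {ρ x} {x} refl

  preimage : s-τ-tilt Γ → s-τ-tilt Λ
  preimage y = proj₁ (ρ.surjective y)

  ρ-preimage : (y : s-τ-tilt Γ) → ρ (preimage y) ≈ˢ y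
  ρ-preimage y = proj₂ (ρ.surjective y) {preimage y} ≅-refl

  preimage-rank : (y : s-τ-tilt Γ) → IsTilting (Mˢ y) → A.rank-P (preimage y) ≡ 0
  preimage-rank y tilting = reflect (preimage y) (B.tilting⇒rank-P≡0 (ρ (preimage y)) {Mˢ y} tilting (ρ-preimage y))

  pull : (N : s-τ-tilt Γ) → IsTiltingElement N → ∃ λ (M : s-τ-tilt Λ) → IsTiltingElement M × (ρ M ≈ˢ N)
  pull N tilting = preimage N , A.rank-P≡0⇒tilting (preimage N) (preimage-rank N tilting) , ρ-preimage N

  push : (N : s-τ-tilt Γ) → (∃ λ (M : s-τ-tilt Λ) → IsTiltingElement M × (ρ M ≈ˢ N)) → IsTiltingElement N
  push N (M , tilting , e) = B.rank-P≡0⇒tilting N (B.tilting⇒rank-P≡0 N {Mˢ (ρ M)}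
    (B.rank-P≡0⇒tilting (ρ M) (preserve M (A.tilting⇒rank-P≡0 M {Mˢ M} tilting ≅-refl))) (≅-sym e))

  rank-ρ-pair : (T : tilt Λ) → B.rank-P (ρ (A.pair T)) ≡ 0
  rank-ρ-pair T = preserve (A.pair T) refl

  ρ′ : tilt Λ → tilt Γ
  ρ′ T = B.module-part (ρ (A.pair T)) (rank-ρ-pair T)

  ρ′-mono : (T U : tilt Λ) → T ≤ᵗ U → ρ′ T ≤ᵗ ρ′ U
  ρ′-mono T U le = B.τ-vanishes⇒≤ᵗ basicΓ (ρ′ T) (ρ′ U) {Mˢ (ρ (A.pair T))} {Mˢ (ρ (A.pair U))} refl refl (proj₁ (ρ.mono {A.pair T} {A.pair U}
    (A.τ-vanishes⇒≤ˢ (A.pair T) (A.pair U) {tilt.T T} {tilt.T U} refl refl refl (A.≤ᵗ⇒τ-vanishes T U le))))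

  ρ′-cancel : (T U : tilt Λ) → ρ′ T ≤ᵗ ρ′ U → T ≤ᵗ U
  ρ′-cancel T U le = A.τ-vanishes⇒≤ᵗ basicΛ T U {Mˢ (A.pair T)} {Mˢ (A.pair U)} refl refl (proj₁ (ρ.cancel {A.pair T} {A.pair U}
    (B.τ-vanishes⇒≤ˢ (ρ (A.pair T)) (ρ (A.pair U)) {tilt.T (ρ′ T)} {tilt.T (ρ′ U)} refl refl (rank-ρ-pair U) (B.≤ᵗ⇒τ-vanishes (ρ′ T) (ρ′ U) le))))

  ρ′-surjective : (U : tilt Γ) → ∃ λ (T : tilt Λ) → ∀ {Z : tilt Λ} → Z ≈ᵗ T → ρ′ Z ≈ᵗ U
  ρ′-surjective U = A.module-part x (preimage-rank (B.pair U) (tilt.isTilting U)) ,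
      λ {Z} e → proj₂ (ρ.surjective (B.pair U)) {A.pair Z} e
    where
    x : s-τ-tilt Λ
    x = preimage (B.pair U)
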